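{- Let $p$ be a prime and let $A\in\operatorname{SL}(2,p)$ be diagonalisable with both eigenvalues in $\mathbb F_{p^2}^*\setminus\mathbb F_p$. Let $\tau$ be the multiplicative order of $A$, and let $F_{2,p}(A)$ be the number of $6$-tuples of integers $(x_1,\ldots,x_6)$ with $1\le x_1,\ldots,x_6\le\tau$ such that $$A^{x_1}+A^{x_2}+A^{x_3}=A^{x_4}+A^{x_5}+A^{x_6}.$$ Then $$F_{2,p}(A)\ll \tau^{19/5}+\tau^5p^{ -1},$$ with an absolute implied constant.
   Context: $\operatorname{SL}(2,p)$ is the group of $2\times 2$ matrices of determinant $1$ over $\mathbb F_p$. The multiplicative order of $A$ is the least $\tau\ge 1$ with $A^\tau=I$. $U\ll V$ means $|U|\le cV$ for some constant $c>0$. -}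

module Defs where

open import Data.Nat using (ℕ; zero; suc; _+_; _*_; _∸_; _<_; _≤_; _≟_)
open import Data.Nat.DivMod using (_%_)
open import Data.List using (List; map; upTo)
open import Data.Nat.ListAction using (sum)
open import Data.Product using (_×_; _,_)
open import Relation.Nullary using (¬_; Dec; yes; no)
open import Relation.Binary.PropositionalEquality using (_≡_; refl; cong)

-- reduction modulo q (for q = 0 we leave x unchanged; only used with q = p prime)
_mod_ : ℕ → ℕ → ℕ
x mod zero = x
x mod suc q = x % suc q

-- 2×2 matrices  [ a b ; c d ]  with natural-number entries,
-- representing elements of F_p via their residues in {0,…,p-1}
record Mat : Set where
  constructor mat
  field
    a b c d : ℕ
open Mat public

Reduced : ℕ → Mat → Set
Reduced p A = (a A < p) × (b A < p) × (c A < p) × (d A < p)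

I₂ : ℕ → Mat
I₂ p = mat (1 mod p) 0 0 (1 mod p)

mul : ℕ → Mat → Mat → Mat
mul p (mat a₁ b₁ c₁ d₁) (mat a₂ b₂ c₂ d₂) =
  mat ((a₁ * a₂ + b₁ * c₂) mod p) ((a₁ * b₂ + b₁ * d₂) mod p)
      ((c₁ * a₂ + d₁ * c₂) mod p) ((c₁ * b₂ + d₁ * d₂) mod p)

add : ℕ → Mat → Mat → Mat
add p (mat a₁ b₁ c₁ d₁) (mat a₂ b₂ c₂ d₂) =
  mat ((a₁ + a₂) mod p) ((b₁ + b₂) mod p) ((c₁ + c₂) mod p) ((d₁ + d₂) mod p)

pow : ℕ → Mat → ℕ → Mat
pow p A zero = I₂ p
pow p A (suc n) = mul p A (pow p A n)

InSL2 : ℕ → Mat → Set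
InSL2 p A = (a A * d A) mod p ≡ (b A * c A + 1) mod p

-- λ ∈ F_p is an eigenvalue of A : det(A - λI) = (a-λ)(d-λ) - bc = 0 in F_p
-- (a - λ is computed as a + (p - λ) for 0 ≤ λ < p)
IsEigenvalueFp : ℕ → Mat → ℕ → Set
IsEigenvalueFp p A λ′ =
  ((a A + (p ∸ λ′)) * (d A + (p ∸ λ′))) mod p ≡ (b A * c A) mod p

-- no eigenvalue of A lies in F_p (so both eigenvalues lie in F_{p²}* \ F_p)
NoEigenvalueInFp : ℕ → Mat → Set
NoEigenvalueInFp p A = ∀ λ′ → λ′ < p → ¬ IsEigenvalueFp p A λ′

IsOrder : ℕ → Mat → ℕ → Set
IsOrder p A τ = (1 ≤ τ) × (pow p A τ ≡ I₂ p) × (∀ k → 1 ≤ k → k < τ → ¬ (pow p A k ≡ I₂ p))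

_≟M_ : (A B : Mat) → Dec (A ≡ B)
mat a₁ b₁ c₁ d₁ ≟M mat a₂ b₂ c₂ d₂ with a₁ ≟ a₂ | b₁ ≟ b₂ | c₁ ≟ c₂ | d₁ ≟ d₂
... | yes refl | yes refl | yes refl | yes refl = yes refl
... | no ne | _ | _ | _ = no (λ e → ne (cong a e))
... | yes _ | no ne | _ | _ = no (λ e → ne (cong b e))
... | yes _ | yes _ | no ne | _ = no (λ e → ne (cong c e))
... | yes _ | yes _ | yes _ | no ne = no (λ e → ne (cong d e))

range1 : ℕ → List ℕ
range1 τ = map suc (upTo τ)

Σ1 : ℕ → (ℕ → ℕ) → ℕ
Σ1 τ f = sum (map f (range1 τ))

indicator : Mat → Mat → ℕ
indicator A B with A ≟M B
... | yes _ = 1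
... | no _ = 0

F2 : ℕ → Mat → ℕ → ℕ
F2 p A τ =
  Σ1 τ λ x₁ → Σ1 τ λ x₂ → Σ1 τ λ x₃ → Σ1 τ λ x₄ → Σ1 τ λ x₅ → Σ1 τ λ x₆ →
    indicator (add p (add p (pow p A x₁) (pow p A x₂)) (pow p A x₃))
              (add p (add p (pow p A x₄) (pow p A x₅)) (pow p A x₆))

{-# OPTIONS --safe #-}
module Submission where

-- The powers of A span a copy of F_{p²}, in which A becomes an element λ of norm one, so that σ(x) = 1/x on the
-- group G generated by λ, σ being the conjugation. Let r(u) count the representations u = x + y + z in G; the
-- number of solutions is Σ r(x + y + z) over triples of elements of G.
--
-- If s = y + z ≠ 0, then yz = s/σ(s), so y and z are determined up to order. Since r(u) ≤ 3τ always, the triples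
-- with u = 0 or u σ(u) = 1 contribute O(τ³): in the second case (x + y)(y + z)(z + x) = (u σ(u) − 1) xyz vanishes.
-- For the other u, any x in a representation satisfies x^τ = 1 and (u − x)^τ = (σ(u) x − 1)^τ. Stepanov's method
-- bounds the number of such x by 4τ/β whenever 2β³ ≤ τ and 2βτ ≤ p: an auxiliary polynomial built from
-- (u − X)^e (σ(u) X − 1)^h X^(τb) vanishes at all of them to order β².
--
-- Hence the number of solutions is at most 21 τ⁴/β, and the largest β with β⁵ ≤ τ and 2βτ ≤ p gives the theorem.

open import Level using (0ℓ)
open import Algebra.Bundles using (CommutativeRing; RawRing)
import Algebra.Properties.AbelianGroup
import Algebra.Properties.CommutativeSemigroup
import Algebra.Properties.CommutativeSemiring.Exp
import Algebra.Properties.Ring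
import Algebra.Properties.Semiring.Exp
import Algebra.Properties.Semiring.Mult
import Algebra.Solver.Ring
open import Algebra.Solver.Ring.AlmostCommutativeRing
  using (_-Raw-AlmostCommutative⟶_; fromCommutativeRing)
open import Data.List as List using (List; []; _∷_; _++_; length; map; filter; take; upTo; cartesianProductWith)
open import Data.List.Membership.Propositional using (_∈_; find)
open import Data.List.Membership.Propositional.Properties
  using (∈-∃++; ∈-++⁻; ∈-++⁺ˡ; ∈-++⁺ʳ; ∈-map⁺; ∈-map⁻; ∈-filter⁻; ∈-upTo⁺; ∈-upTo⁻; ∈-cartesianProductWith⁺)
import Data.List.Properties as Listₚ
open import Data.List.Relation.Unary.All as All using (All; []; _∷_)
import Data.List.Relation.Unary.All.Properties as Allₚ
open import Data.List.Relation.Unary.AllPairs using (AllPairs; []; _∷_)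
import Data.List.Relation.Unary.AllPairs.Properties as AllPairsₚ
open import Data.List.Relation.Unary.Any as Any using (Any; here; there)
open import Data.List.Relation.Unary.Unique.Propositional using (Unique)
import Data.List.Relation.Unary.Unique.Propositional.Properties as Uniqueₚ
open import Data.Maybe using (Maybe; just; nothing)
open import Data.Nat as ℕ using (ℕ; zero; suc; z≤n; s≤s; _≤_; _<_; NonZero)
open import Data.Nat.Coprimality using (prime⇒coprime; coprime-Bézout)
open import Data.Nat.Divisibility using (∣-refl; n∣m*n; ∣⇒≤)
open import Data.Nat.DivMod using (_/_; _%_; m%n<n; m<n⇒m%n≡m; m<n⇒m/n≡0; m≡m%n+[m/n]*n; [m+n]%n≡m%n;
  [m+kn]%n≡m%n; m<n*o⇒m/o<n; +-distrib-/-∣ˡ; +-distrib-/-∣ʳ; m*n/n≡m; n/n≡1)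
open import Data.Nat.GCD using (module Bézout)
open import Data.Nat.ListAction using (sum)
open import Data.Nat.Primality using (Prime; prime⇒nonZero; prime⇒nonTrivial)
import Data.Nat.Properties as ℕₚ
open import Data.Nat.Tactic.RingSolver using (solve-∀)
open import Data.Product using (_×_; _,_; proj₁; proj₂; ∃-syntax)
open import Data.Sum using (_⊎_; inj₁; inj₂)
open import Data.Unit using (⊤; tt)
open import Relation.Binary.Definitions using (tri<; tri≈; tri>)
open import Relation.Binary.PropositionalEquality as ≡ using (_≡_)
import Relation.Binary.Reasoning.Setoid
open import Relation.Nullary using (¬_; Dec; yes; no; contradiction)
open import Relation.Nullary.Decidable using (¬?; decidable-stable; map′; _×-dec_)

-- The conjugation is not a polynomial of small degree, so it has to disappear before Stepanov's
-- method can apply. It is needed only on G, where it is inversion, and on u, where it gives a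
-- constant: with s = u - x one has x σ(s) = σ(u) x - 1, while yz = s/σ(s) has τ-th power 1.
--
-- The linear polynomials u - X and σ(u) X - 1 have the constant Wronskian 1 - u σ(u), so u σ(u) = 1
-- must be counted apart; so must u = 0, because u - X must not vanish at 0.
--
-- The difficulty is to keep the auxiliary polynomial nonzero. If its blocks with different powers
-- X^(τb) cancelled, the lowest would vanish at 0 to order τ, which is impossible for at most τ
-- products with distinct exponents e and fixed e + h. A block has 2β · β² products, whence 2β³ ≤ τ.
-- The exponents stay below 2βτ, and 2βτ ≤ p keeps them distinct in the field and lets derivatives
-- detect multiplicities.
--
-- The exponent 19/5 is 4 - 1/5, with β of size τ^(1/5).

-- Algebraic preliminaries: ring identities and finite sums.

module RingSolver (R : CommutativeRing 0ℓ 0ℓ) where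
  open CommutativeRing R
  open Algebra.Properties.Ring ring using (-‿distribˡ-*; -‿distribʳ-*; -‿involutive; -0#≈0#)
  open Algebra.Properties.AbelianGroup +-abelianGroup using (⁻¹-∙-comm)
  open Algebra.Properties.Semiring.Mult semiring using (×-homo-+; ×1-homo-*) renaming (_×_ to _·_)
  open Relation.Binary.Reasoning.Setoid setoid
  private module S = Algebra.Properties.CommutativeSemigroup +-commutativeSemigroup

  -- The integer m − n is represented by the pair (m , n), reduced so that one of m, n is 0:
  -- the solver compares normal forms syntactically.
  private
    reduce : ℕ × ℕ → ℕ × ℕ
    reduce (a , b) = a ℕ.∸ b , b ℕ.∸ a

    Diff : RawRing 0ℓ 0ℓ
    Diff = record
      { Carrier = ℕ × ℕ ; _≈_ = _≡_
      ; _+_ = λ (a , b) (c , d) → reduce (a ℕ.+ c , b ℕ.+ d)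
      ; _*_ = λ (a , b) (c , d) → reduce (a ℕ.* c ℕ.+ b ℕ.* d , a ℕ.* d ℕ.+ b ℕ.* c)
      ; -_ = λ (a , b) → b , a
      ; 0# = 0 , 0 ; 1# = 1 , 0 }

    ι : ℕ → Carrier
    ι n = n · 1#

    ⟦_⟧ : ℕ × ℕ → Carrier
    ⟦ a , b ⟧ = ι a - ι b

    -x*-y : ∀ x y → - x * - y ≈ x * y
    -x*-y x y = begin
      - x * - y ≈⟨ -‿distribˡ-* x (- y) ⟨
      - (x * - y) ≈⟨ -‿cong (-‿distribʳ-* x y) ⟨
      - - (x * y) ≈⟨ -‿involutive _ ⟩
      x * y ∎

    sub+sub : ∀ a b c d → (a + c) - (b + d) ≈ (a - b) + (c - d)
    sub+sub a b c d = trans (+-congˡ (sym (⁻¹-∙-comm b d))) (S.interchange a c (- b) (- d))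

    sub*sub : ∀ a b c d → (a * c + b * d) - (a * d + b * c) ≈ (a - b) * (c - d)
    sub*sub a b c d = sym (begin
      (a - b) * (c - d) ≈⟨ distribʳ _ _ _ ⟩
      a * (c - d) + - b * (c - d) ≈⟨ +-cong (distribˡ _ _ _) (distribˡ _ _ _) ⟩
      (a * c + a * - d) + (- b * c + - b * - d)
        ≈⟨ +-cong (+-congˡ (sym (-‿distribʳ-* a d))) (trans (+-cong (sym (-‿distribˡ-* b c)) (-x*-y b d))
            (+-comm _ _)) ⟩
      (a * c - a * d) + (b * d - b * c) ≈⟨ sub+sub _ _ _ _ ⟨
      (a * c + b * d) - (a * d + b * c) ∎)

    sub-cong : ∀ a b c d → a + d ≈ b + c → a - b ≈ c - d
    sub-cong a b c d e = begin
      a - b ≈⟨ +-identityʳ _ ⟨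
      (a - b) + 0# ≈⟨ +-congˡ (-‿inverseʳ d) ⟨
      (a - b) + (d - d) ≈⟨ S.interchange a (- b) d (- d) ⟩
      (a + d) + (- b - d) ≈⟨ +-congʳ e ⟩
      (b + c) + (- b - d) ≈⟨ S.interchange b c (- b) (- d) ⟩
      (b - b) + (c - d) ≈⟨ +-congʳ (-‿inverseʳ b) ⟩
      0# + (c - d) ≈⟨ +-identityˡ _ ⟩
      c - d ∎

    ⟦reduce⟧ : ∀ x → ⟦ reduce x ⟧ ≈ ⟦ x ⟧
    ⟦reduce⟧ (a , b) = sub-cong _ _ _ _ (trans (sym (×-homo-+ 1# (a ℕ.∸ b) b))
      (trans (reflexive (≡.cong ι (balance a b))) (×-homo-+ 1# (b ℕ.∸ a) a)))
      where
      balance : ∀ a b → (a ℕ.∸ b) ℕ.+ b ≡ (b ℕ.∸ a) ℕ.+ a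
      balance zero b = ≡.trans (≡.cong (ℕ._+ b) (ℕₚ.0∸n≡0 b)) (≡.sym (ℕₚ.+-identityʳ b))
      balance (suc a) zero = ℕₚ.+-identityʳ (suc a)
      balance (suc a) (suc b) = ≡.trans (ℕₚ.+-suc _ b) (≡.trans (≡.cong suc (balance a b)) (≡.sym (ℕₚ.+-suc _ a)))

    homo : Diff -Raw-AlmostCommutative⟶ fromCommutativeRing R
    homo = record
      { ⟦_⟧ = ⟦_⟧
      ; +-homo = λ (a , b) (c , d) →
          trans (⟦reduce⟧ (a ℕ.+ c , b ℕ.+ d)) (trans (+-cong (×-homo-+ 1# a c) (-‿cong (×-homo-+ 1# b d)))
              (sub+sub _ _ _ _))
      ; *-homo = λ (a , b) (c , d) → trans (⟦reduce⟧ (a ℕ.* c ℕ.+ b ℕ.* d , a ℕ.* d ℕ.+ b ℕ.* c)) (trans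
          (+-cong (trans (×-homo-+ 1# (a ℕ.* c) (b ℕ.* d)) (+-cong (×1-homo-* a c) (×1-homo-* b d)))
            (-‿cong (trans (×-homo-+ 1# (a ℕ.* d) (b ℕ.* c)) (+-cong (×1-homo-* a d) (×1-homo-* b c)))))
          (sub*sub _ _ _ _))
      ; -‿homo = λ (a , b) → begin
          ι b - ι a ≈⟨ +-comm _ _ ⟩
          - ι a + ι b ≈⟨ +-congˡ (-‿involutive (ι b)) ⟨
          - ι a - - ι b ≈⟨ ⁻¹-∙-comm _ _ ⟩
          - (ι a - ι b) ∎
      ; 0-homo = -‿inverseʳ 0#
      ; 1-homo = trans (+-cong (+-identityʳ 1#) -0#≈0#) (+-identityʳ 1#) }

    decide : ∀ a b c d → Dec (a ℕ.+ d ≡ b ℕ.+ c) → Maybe (⟦ a , b ⟧ ≈ ⟦ c , d ⟧)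
    decide a b c d (yes e) = just (sub-cong _ _ _ _
      (trans (sym (×-homo-+ 1# a d)) (trans (reflexive (≡.cong ι e)) (×-homo-+ 1# b c))))
    decide a b c d (no _) = nothing

  open Algebra.Solver.Ring Diff (fromCommutativeRing R) homo
    (λ (a , b) (c , d) → decide a b c d (a ℕ.+ d ℕ.≟ b ℕ.+ c)) public
    using (solve; _:=_; _:+_; _:*_; _:-_; :-_)

module Sums (R : CommutativeRing 0ℓ 0ℓ) where
  open CommutativeRing R
  open RingSolver R

  ∑ : ℕ → (ℕ → Carrier) → Carrier
  ∑ zero f = 0#
  ∑ (suc n) f = ∑ n f + f n

  ∑-cong : ∀ n {f g} → (∀ i → i < n → f i ≈ g i) → ∑ n f ≈ ∑ n g
  ∑-cong zero e = refl
  ∑-cong (suc n) e = +-cong (∑-cong n λ i i<n → e i (ℕₚ.m<n⇒m<1+n i<n)) (e n (ℕₚ.n<1+n n))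

  ∑-zero : ∀ n {f} → (∀ i → i < n → f i ≈ 0#) → ∑ n f ≈ 0#
  ∑-zero zero e = refl
  ∑-zero (suc n) e = trans (+-cong (∑-zero n λ i i<n → e i (ℕₚ.m<n⇒m<1+n i<n)) (e n (ℕₚ.n<1+n n))) (+-identityˡ 0#)

  ∑-+ : ∀ n f g → ∑ n (λ i → f i + g i) ≈ ∑ n f + ∑ n g
  ∑-+ zero f g = sym (+-identityˡ 0#)
  ∑-+ (suc n) f g = trans (+-congʳ (∑-+ n f g))
    (solve 4 (λ a b c d → (a :+ b) :+ (c :+ d) := (a :+ c) :+ (b :+ d)) refl _ _ _ _)

  *-∑ : ∀ n c f → c * ∑ n f ≈ ∑ n (λ i → c * f i)
  *-∑ zero c f = zeroʳ c
  *-∑ (suc n) c f = trans (distribˡ c _ _) (+-congʳ (*-∑ n c f))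

  ∑-split : ∀ m n f → ∑ (m ℕ.+ n) f ≈ ∑ m f + ∑ n (λ i → f (m ℕ.+ i))
  ∑-split m zero f rewrite ℕₚ.+-identityʳ m = sym (+-identityʳ _)
  ∑-split m (suc n) f rewrite ℕₚ.+-suc m n =
    trans (+-congʳ (∑-split m n f)) (+-assoc _ _ _)

-- Polynomials in one variable over a commutative ring.

module PolynomialRing (K : CommutativeRing 0ℓ 0ℓ) where
  open CommutativeRing K
  open RingSolver K
  open Algebra.Properties.Semiring.Mult semiring using (×-congʳ; ×-homo-+) renaming (_×_ to _·_)

  private
    Seq : Set
    Seq = ℕ → Carrier

    infix 4 _≋_
    _≋_ : Seq → Seq → Set
    a ≋ b = ∀ n → a n ≈ b n

    -- The Cauchy product. The ring axioms are proved for infinite coefficient sequences, where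
    -- lists of different lengths cause no case distinctions, and are then carried over to lists by
    -- `coeff-*`.
    conv : Seq → Seq → Seq
    conv a b zero = a 0 * b 0
    conv a b (suc n) = a 0 * b (suc n) + conv (λ i → a (suc i)) b n

    conv-cong : ∀ {a a′ b b′} → a ≋ a′ → b ≋ b′ → conv a b ≋ conv a′ b′
    conv-cong e e′ zero = *-cong (e 0) (e′ 0)
    conv-cong e e′ (suc n) = +-cong (*-cong (e 0) (e′ (suc n))) (conv-cong (λ i → e (suc i)) e′ n)

    conv-distribʳ : ∀ a b c → conv (λ i → a i + b i) c ≋ λ n → conv a c n + conv b c n
    conv-distribʳ a b c zero = distribʳ _ _ _
    conv-distribʳ a b c (suc n) = trans (+-congˡ (conv-distribʳ _ _ c n))
      (solve 5 (λ a b c x y → (a :+ b) :* c :+ (x :+ y) := (a :* c :+ x) :+ (b :* c :+ y)) refl _ _ _ _ _)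

    conv-scale : ∀ k a b → conv (λ i → k * a i) b ≋ λ n → k * conv a b n
    conv-scale k a b zero = *-assoc _ _ _
    conv-scale k a b (suc n) = trans (+-cong (*-assoc _ _ _) (conv-scale k _ b n)) (sym (distribˡ _ _ _))

    -- The defining recursion read from the other end; with both at hand commutativity is an
    -- induction.
    conv-suc : ∀ a b n → conv a b (suc n) ≈ conv a (λ i → b (suc i)) n + a (suc n) * b 0
    conv-suc a b zero = refl
    conv-suc a b (suc n) = trans (+-congˡ (conv-suc _ b n)) (sym (+-assoc _ _ _))

    conv-comm : ∀ a b → conv a b ≋ conv b a
    conv-comm a b zero = *-comm _ _
    conv-comm a b (suc n) = trans (conv-suc a b n) (trans (+-comm _ _)
      (+-cong (*-comm _ _) (conv-comm a _ n)))

    conv-assoc : ∀ a b c → conv (conv a b) c ≋ conv a (conv b c)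
    conv-assoc a b c zero = *-assoc _ _ _
    conv-assoc a b c (suc n) = begin
      a 0 * b 0 * c (suc n) + conv (λ i → a 0 * b (suc i) + conv (λ j → a (suc j)) b i) c n
        ≈⟨ +-congˡ (trans (conv-distribʳ _ _ c n) (+-cong (conv-scale (a 0) _ c n) (conv-assoc _ b c n))) ⟩
      a 0 * b 0 * c (suc n) + (a 0 * conv (λ i → b (suc i)) c n + conv (λ i → a (suc i)) (conv b c) n)
        ≈⟨ solve 5 (λ a b c x y → a :* b :* c :+ (a :* x :+ y) := a :* (b :* c :+ x) :+ y) refl _ _ _ _ _ ⟩
      a 0 * (b 0 * c (suc n) + conv (λ i → b (suc i)) c n) + conv (λ i → a (suc i)) (conv b c) n ∎
      where open Relation.Binary.Reasoning.Setoid setoid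

    conv-zeroˡ : ∀ a b → a ≋ (λ _ → 0#) → conv a b ≋ λ _ → 0#
    conv-zeroˡ a b e zero = trans (*-congʳ (e 0)) (zeroˡ _)
    conv-zeroˡ a b e (suc n) = trans (+-cong (trans (*-congʳ (e 0)) (zeroˡ _))
        (conv-zeroˡ _ b (λ i → e (suc i)) n)) (+-identityˡ 0#)

    conv-constˡ : ∀ a b → (λ i → a (suc i)) ≋ (λ _ → 0#) → conv a b ≋ λ n → a 0 * b n
    conv-constˡ a b e zero = refl
    conv-constˡ a b e (suc n) = trans (+-congˡ (conv-zeroˡ _ b e n)) (+-identityʳ _)

  Poly : Set
  Poly = List Carrier

  coeff : Poly → ℕ → Carrier
  coeff [] n = 0#
  coeff (a ∷ f) zero = a
  coeff (a ∷ f) (suc n) = coeff f n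

  infix 4 _≈ₚ_
  -- Coefficients are listed from the constant term upwards and trailing zeros are allowed, so
  -- equality must compare coefficients and not lists.
  record _≈ₚ_ (f g : Poly) : Set where
    constructor coeffwise
    field coeff-≈ : ∀ n → coeff f n ≈ coeff g n
  open _≈ₚ_ public

  opaque
    infixl 6 _+ₚ_
    _+ₚ_ : Poly → Poly → Poly
    [] +ₚ g = g
    (a ∷ f) +ₚ [] = a ∷ f
    (a ∷ f) +ₚ (b ∷ g) = (a + b) ∷ (f +ₚ g)

    infix 8 -ₚ_
    -ₚ_ : Poly → Poly
    -ₚ_ = List.map λ a → - a

    infixl 7 _*ₚ_
    _*ₚ_ : Poly → Poly → Poly
    [] *ₚ g = []
    (a ∷ f) *ₚ g = List.map (a *_) g +ₚ (0# ∷ (f *ₚ g))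

    coeff-+ : ∀ f g n → coeff (f +ₚ g) n ≈ coeff f n + coeff g n
    coeff-+ [] g n = sym (+-identityˡ _)
    coeff-+ (a ∷ f) [] n = sym (+-identityʳ _)
    coeff-+ (a ∷ f) (b ∷ g) zero = refl
    coeff-+ (a ∷ f) (b ∷ g) (suc n) = coeff-+ f g n

    coeff-neg : ∀ f n → coeff (-ₚ f) n ≈ - coeff f n
    coeff-neg [] n = sym (Algebra.Properties.Ring.-0#≈0# ring)
    coeff-neg (a ∷ f) zero = refl
    coeff-neg (a ∷ f) (suc n) = coeff-neg f n

    coeff-scale : ∀ c f n → coeff (List.map (c *_) f) n ≈ c * coeff f n
    coeff-scale c [] n = sym (zeroʳ c)
    coeff-scale c (a ∷ f) zero = refl
    coeff-scale c (a ∷ f) (suc n) = coeff-scale c f n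

    private
      coeff-* : ∀ f g n → coeff (f *ₚ g) n ≈ conv (coeff f) (coeff g) n
      coeff-* [] g n = sym (conv-zeroˡ (λ _ → 0#) (coeff g) (λ _ → refl) n)
      coeff-* (a ∷ f) g zero = trans (coeff-+ (List.map (a *_) g) _ 0) (trans (+-identityʳ _) (coeff-scale a g 0))
      coeff-* (a ∷ f) g (suc n) =
          trans (coeff-+ (List.map (a *_) g) _ (suc n)) (+-cong (coeff-scale a g (suc n)) (coeff-* f g n))

  C : Carrier → Poly
  C a = a ∷ []

  polynomialRing : CommutativeRing 0ℓ 0ℓ
  polynomialRing = record
    { Carrier = Poly ; _≈_ = _≈ₚ_ ; _+_ = _+ₚ_ ; _*_ = _*ₚ_ ; -_ = -ₚ_ ; 0# = [] ; 1# = C 1#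
    ; isCommutativeRing = record
      { isRing = record
        { +-isAbelianGroup = record
          { isGroup = record
            { isMonoid = record
              { isSemigroup = record
                { isMagma = record
                  { isEquivalence = record
                    { refl = coeffwise λ n → refl
                    ; sym = λ e → coeffwise λ n → sym (coeff-≈ e n)
                    ; trans = λ e e′ → coeffwise λ n → trans (coeff-≈ e n) (coeff-≈ e′ n) }
                  ; ∙-cong = λ {f} {f′} {g} {g′} e e′ → coeffwise λ n →
                      trans (coeff-+ f g n) (trans (+-cong (coeff-≈ e n) (coeff-≈ e′ n)) (sym (coeff-+ f′ g′ n))) }
                ; assoc = λ f g h → coeffwise λ n → trans (coeff-+ (f +ₚ g) h n) (trans (+-congʳ (coeff-+ f g n))
                    (trans (+-assoc _ _ _) (sym (trans (coeff-+ f (g +ₚ h) n) (+-congˡ (coeff-+ g h n)))))) }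
              ; identity = (λ f → coeffwise λ n → trans (coeff-+ [] f n) (+-identityˡ _))
                  , (λ f → coeffwise λ n → trans (coeff-+ f [] n) (+-identityʳ _)) }
            ; inverse = (λ f → coeffwise λ n → trans (coeff-+ (-ₚ f) f n)
                (trans (+-congʳ (coeff-neg f n)) (-‿inverseˡ _)))
                , (λ f → coeffwise λ n → trans (coeff-+ f (-ₚ f) n) (trans (+-congˡ (coeff-neg f n)) (-‿inverseʳ _)))
            ; ⁻¹-cong = λ {f} {g} e → coeffwise λ n → trans (coeff-neg f n)
                (trans (-‿cong (coeff-≈ e n)) (sym (coeff-neg g n))) }
          ; comm = λ f g → coeffwise λ n → trans (coeff-+ f g n) (trans (+-comm _ _) (sym (coeff-+ g f n))) }
        ; *-cong = λ {f} {f′} {g} {g′} e e′ → coeffwise λ n →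
            trans (coeff-* f g n) (trans (conv-cong (coeff-≈ e) (coeff-≈ e′) n) (sym (coeff-* f′ g′ n)))
        ; *-assoc = λ f g h → coeffwise λ n →
            trans (coeff-* (f *ₚ g) h n) (trans (conv-cong (coeff-* f g) (λ _ → refl) n)
              (trans (conv-assoc (coeff f) (coeff g) (coeff h) n)
                (sym (trans (coeff-* f (g *ₚ h) n) (conv-cong {coeff f} (λ _ → refl) (coeff-* g h) n)))))
        ; *-identity = 1*f , (λ f → coeffwise λ n → trans (coeff-≈ (*ₚ-comm f (C 1#)) n) (coeff-≈ (1*f f) n))
        ; distrib = (λ f g h → coeffwise λ n → trans (coeff-≈ (*ₚ-comm f (g +ₚ h)) n) (trans (coeff-≈ (distr f g h) n)
              (trans (coeff-+ (g *ₚ f) (h *ₚ f) n) (trans (+-cong (coeff-≈ (*ₚ-comm g f) n) (coeff-≈ (*ₚ-comm h f) n))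
                (sym (coeff-+ (f *ₚ g) (f *ₚ h) n))))))
            , distr }
      ; *-comm = *ₚ-comm } }
    where
    *ₚ-comm : ∀ f g → f *ₚ g ≈ₚ g *ₚ f
    *ₚ-comm f g = coeffwise λ n → trans (coeff-* f g n) (trans (conv-comm (coeff f) (coeff g) n) (sym (coeff-* g f n)))
    1*f : ∀ f → C 1# *ₚ f ≈ₚ f
    1*f f = coeffwise λ n → trans (coeff-* (C 1#) f n)
      (trans (conv-constˡ (coeff (C 1#)) (coeff f) (λ _ → refl) n) (*-identityˡ _))
    distr : ∀ f g h → (g +ₚ h) *ₚ f ≈ₚ g *ₚ f +ₚ h *ₚ f
    distr f g h = coeffwise λ n → trans (coeff-* (g +ₚ h) f n)
        (trans (conv-cong {b = coeff f} (coeff-+ g h) (λ _ → refl) n)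
      (trans (conv-distribʳ (coeff g) (coeff h) (coeff f) n)
        (sym (trans (coeff-+ (g *ₚ f) (h *ₚ f) n) (+-cong (coeff-* g f n) (coeff-* h f n))))))

  private
    module P = CommutativeRing polynomialRing
    module PS = RingSolver polynomialRing
    module PE = Algebra.Properties.Semiring.Exp P.semiring
  open PE public using () renaming (_^_ to _^ₚ_)
  open Algebra.Properties.Semiring.Exp semiring using (_^_)

  X : Poly
  X = 0# ∷ 1# ∷ []

  private
    coeff-X*-suc : ∀ f n → coeff (X *ₚ f) (suc n) ≈ coeff f n
    coeff-X*-suc f n = trans (coeff-* X f (suc n))
      (trans (+-cong (zeroˡ _) (conv-constˡ (λ i → coeff X (suc i)) (coeff f) (λ _ → refl) n))
        (trans (+-identityˡ _) (*-identityˡ _)))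

    coeff-X*-zero : ∀ f → coeff (X *ₚ f) 0 ≈ 0#
    coeff-X*-zero f = trans (coeff-* X f 0) (zeroˡ _)

  X*-cancel : ∀ f → X *ₚ f ≈ₚ [] → f ≈ₚ []
  X*-cancel f e = coeffwise λ n → trans (sym (coeff-X*-suc f n)) (coeff-≈ e (suc n))

  coeff-C* : ∀ c f n → coeff (C c *ₚ f) n ≈ c * coeff f n
  coeff-C* c f n = trans (coeff-* (C c) f n) (conv-constˡ (coeff (C c)) (coeff f) (λ _ → refl) n)

  horner : ∀ a f → a ∷ f ≈ₚ C a +ₚ X *ₚ f
  horner a f = coeffwise λ where
    zero → sym (trans (coeff-+ (C a) _ 0) (trans (+-congˡ (coeff-X*-zero f)) (+-identityʳ a)))
    (suc n) → sym (trans (coeff-+ (C a) _ (suc n)) (trans (+-identityˡ _) (coeff-X*-suc f n)))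

  ∷-cong : ∀ {a b f g} → a ≈ b → f ≈ₚ g → a ∷ f ≈ₚ b ∷ g
  ∷-cong e e′ = coeffwise λ where
    zero → e
    (suc n) → coeff-≈ e′ n

  C-cong : ∀ {a b} → a ≈ b → C a ≈ₚ C b
  C-cong e = ∷-cong e P.refl

  C-+ : ∀ a b → C (a + b) ≈ₚ C a +ₚ C b
  C-+ a b = coeffwise λ where
    zero → sym (coeff-+ (C a) (C b) 0)
    (suc n) → sym (trans (coeff-+ (C a) (C b) (suc n)) (+-identityˡ 0#))

  C-* : ∀ a b → C (a * b) ≈ₚ C a *ₚ C b
  C-* a b = coeffwise λ where
    zero → sym (coeff-C* a (C b) 0)
    (suc n) → sym (trans (coeff-C* a (C b) (suc n)) (zeroʳ a))

  C-neg : ∀ a → C (- a) ≈ₚ -ₚ C a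
  C-neg a = coeffwise λ where
    zero → sym (coeff-neg (C a) 0)
    (suc n) → sym (trans (coeff-neg (C a) (suc n)) (Algebra.Properties.Ring.-0#≈0# ring))

  C-0 : C 0# ≈ₚ []
  C-0 = coeffwise λ where
    zero → refl
    (suc n) → refl

  eval : Poly → Carrier → Carrier
  eval [] x = 0#
  eval (a ∷ f) x = a + x * eval f x

  private
    eval-0 : ∀ f x → f ≈ₚ [] → eval f x ≈ 0#
    eval-0 [] x e = refl
    eval-0 (a ∷ f) x e = trans (+-cong (coeff-≈ e 0) (trans
        (*-congˡ (eval-0 f x (coeffwise λ n → coeff-≈ e (suc n)))) (zeroʳ x))) (+-identityˡ 0#)

  eval-cong : ∀ {f g} x → f ≈ₚ g → eval f x ≈ eval g x
  eval-cong {[]} {g} x e = sym (eval-0 g x (P.sym e))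
  eval-cong {a ∷ f} {[]} x e = eval-0 (a ∷ f) x e
  eval-cong {a ∷ f} {b ∷ g} x e =
      +-cong (coeff-≈ e 0) (*-congˡ (eval-cong {f} {g} x (coeffwise λ n → coeff-≈ e (suc n))))

  opaque
    unfolding _+ₚ_
    eval-+ : ∀ f g x → eval (f +ₚ g) x ≈ eval f x + eval g x
    eval-+ [] g x = sym (+-identityˡ _)
    eval-+ (a ∷ f) [] x = sym (+-identityʳ _)
    eval-+ (a ∷ f) (b ∷ g) x = trans (+-congˡ (*-congˡ (eval-+ f g x)))
      (solve 5 (λ a b x u v → (a :+ b) :+ x :* (u :+ v) := (a :+ x :* u) :+ (b :+ x :* v)) refl _ _ _ _ _)

    eval-neg : ∀ f x → eval (-ₚ f) x ≈ - eval f x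
    eval-neg [] x = sym (Algebra.Properties.Ring.-0#≈0# ring)
    eval-neg (a ∷ f) x = trans (+-congˡ (*-congˡ (eval-neg f x)))
      (solve 3 (λ a x u → :- a :+ x :* (:- u) := :- (a :+ x :* u)) refl _ _ _)

    private
      eval-scale : ∀ c f x → eval (List.map (c *_) f) x ≈ c * eval f x
      eval-scale c [] x = sym (zeroʳ c)
      eval-scale c (a ∷ f) x = trans (+-congˡ (*-congˡ (eval-scale c f x)))
        (solve 4 (λ c a x u → c :* a :+ x :* (c :* u) := c :* (a :+ x :* u)) refl _ _ _ _)

    eval-* : ∀ f g x → eval (f *ₚ g) x ≈ eval f x * eval g x
    eval-* [] g x = sym (zeroˡ _)
    eval-* (a ∷ f) g x = trans (eval-+ (List.map (a *_) g) _ x)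
      (trans (+-cong (eval-scale a g x) (trans (+-identityˡ _) (*-congˡ (eval-* f g x))))
        (solve 4 (λ a g x u → a :* g :+ x :* (u :* g) := (a :+ x :* u) :* g) refl _ _ _ _))

  eval-C : ∀ c x → eval (C c) x ≈ c
  eval-C c x = trans (+-congˡ (zeroʳ x)) (+-identityʳ c)

  eval-X : ∀ x → eval X x ≈ x
  eval-X x = trans (+-identityˡ _) (trans (*-congˡ (eval-C 1# x)) (*-identityʳ x))

  eval-^ : ∀ f n x → eval (f ^ₚ n) x ≈ eval f x ^ n
  eval-^ f zero x = eval-C 1# x
  eval-^ f (suc n) x = trans (eval-* f _ x) (*-congˡ (eval-^ f n x))

  -- The derivative of `a + X f` is `f + X f′`; in this form no integer multiples of coefficients
  -- have to be mentioned.
  D : Poly → Poly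
  D [] = []
  D (a ∷ f) = f +ₚ (0# ∷ D f)

  private
    coeff-D : ∀ f n → coeff (D f) n ≈ suc n · coeff f (suc n)
    coeff-D [] n = sym (n·0 (suc n))
      where n·0 : ∀ n → n · 0# ≈ 0#
            n·0 zero = refl
            n·0 (suc n) = trans (+-identityˡ _) (n·0 n)
    coeff-D (a ∷ f) zero = coeff-+ f _ 0
    coeff-D (a ∷ f) (suc n) = trans (coeff-+ f _ (suc n)) (+-congˡ (coeff-D f n))

  D-cong : ∀ {f g} → f ≈ₚ g → D f ≈ₚ D g
  D-cong {f} {g} e = coeffwise λ n → trans (coeff-D f n)
    (trans (×-congʳ (suc n) (coeff-≈ e (suc n))) (sym (coeff-D g n)))

  D-+ : ∀ f g → D (f +ₚ g) ≈ₚ D f +ₚ D g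
  D-+ f g = coeffwise λ n → trans (coeff-D (f +ₚ g) n) (trans (×-congʳ (suc n) (coeff-+ f g (suc n)))
    (trans (·-distrib (suc n) _ _) (sym (trans (coeff-+ (D f) (D g) n) (+-cong (coeff-D f n) (coeff-D g n))))))
    where
    ·-distrib : ∀ n x y → n · (x + y) ≈ n · x + n · y
    ·-distrib zero x y = sym (+-identityˡ 0#)
    ·-distrib (suc n) x y = trans (+-congˡ (·-distrib n x y))
      (solve 4 (λ a b c d → (a :+ b) :+ (c :+ d) := (a :+ c) :+ (b :+ d)) refl _ _ _ _)

  D-C : ∀ c → D (C c) ≈ₚ []
  D-C c = coeffwise λ n → trans (coeff-D (C c) n) (trans (sym (coeff-D [] n)) refl)

  private
    D-X* : ∀ f → D (X *ₚ f) ≈ₚ f +ₚ X *ₚ D f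
    D-X* f = P.trans (D-cong (P.sym (P.trans (horner 0# f) (P.trans (P.+-congʳ C-0) (P.+-identityˡ _)))))
      (P.+-congˡ (P.trans (horner 0# (D f)) (P.trans (P.+-congʳ C-0) (P.+-identityˡ _))))

    D-C* : ∀ c f → D (C c *ₚ f) ≈ₚ C c *ₚ D f
    D-C* c f = coeffwise λ n → trans (coeff-D (C c *ₚ f) n) (trans (×-congʳ (suc n) (coeff-C* c f (suc n)))
      (trans (sym (Algebra.Properties.Semiring.Mult.×-comm-* semiring (suc n) c _))
        (sym (trans (coeff-C* c (D f) n) (*-congˡ (coeff-D f n))))))

  D-X : D X ≈ₚ C 1#
  D-X = coeffwise λ where
      zero → trans (coeff-D X 0) (+-identityʳ 1#)
      (suc n) → trans (coeff-D X (suc n)) (sym (coeff-D [] (suc n)))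

  D-* : ∀ f g → D (f *ₚ g) ≈ₚ D f *ₚ g +ₚ f *ₚ D g
  D-* [] g = P.trans (D-cong {[] *ₚ g} {[]} (P.zeroˡ g)) (P.sym
      (P.trans (P.+-cong (P.zeroˡ g) (P.zeroˡ (D g))) (P.+-identityˡ [])))
  D-* (a ∷ f) g = begin
    D ((a ∷ f) *ₚ g)
        ≈⟨ D-cong (P.trans (P.*-congʳ (horner a f)) (PS.solve 4
            (λ a x f g → (a PS.:+ x PS.:* f) PS.:* g PS.:= a PS.:* g PS.:+ x PS.:* (f PS.:* g)) P.refl _ _ _ _)) ⟩
    D (C a *ₚ g +ₚ X *ₚ (f *ₚ g))
        ≈⟨ P.trans (D-+ _ _) (P.+-cong (D-C* a g) (P.trans (D-X* _) (P.+-congˡ (P.*-congˡ (D-* f g))))) ⟩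
    C a *ₚ D g +ₚ (f *ₚ g +ₚ X *ₚ (D f *ₚ g +ₚ f *ₚ D g))
      ≈⟨ PS.solve 6 (λ a x f g f′ g′ → a PS.:* g′ PS.:+ (f PS.:* g PS.:+ x PS.:* (f′ PS.:* g PS.:+ f PS.:* g′))
            PS.:= (f PS.:+ x PS.:* f′) PS.:* g PS.:+ (a PS.:+ x PS.:* f) PS.:* g′) P.refl _ _ _ _ _ _ ⟩
    (f +ₚ X *ₚ D f) *ₚ g +ₚ (C a +ₚ X *ₚ f) *ₚ D g
      ≈⟨ P.+-cong (P.*-congʳ (P.+-congˡ (P.sym (P.trans (horner 0# (D f))
          (P.trans (P.+-congʳ C-0) (P.+-identityˡ _))))))
            (P.*-congʳ (P.sym (horner a f))) ⟩
    D (a ∷ f) *ₚ g +ₚ (a ∷ f) *ₚ D g ∎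
    where open Relation.Binary.Reasoning.Setoid P.setoid

  Deg≤ : ℕ → Poly → Set
  Deg≤ d f = ∀ n → d ℕ.< n → coeff f n ≈ 0#

  private
    conv-deg : ∀ d e a b → (∀ n → d ℕ.< n → a n ≈ 0#) → (∀ n → e ℕ.< n → b n ≈ 0#) →
      ∀ n → d ℕ.+ e ℕ.< n → conv a b n ≈ 0#
    conv-deg zero e a b da db n lt = trans (conv-constˡ a b (λ i → da (suc i) (s≤s z≤n)) n)
      (trans (*-congˡ (db n lt)) (zeroʳ _))
    conv-deg (suc d) e a b da db (suc n) (s≤s lt) = trans
      (+-cong (trans (*-congˡ (db (suc n) (ℕₚ.≤-trans (s≤s (ℕₚ.m≤n+m e d)) (ℕₚ.m<n⇒m<1+n lt)))) (zeroʳ _))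
        (conv-deg d e _ b (λ n lt → da (suc n) (s≤s lt)) db n lt)) (+-identityˡ 0#)

  Deg≤-cong : ∀ {d f g} → f ≈ₚ g → Deg≤ d f → Deg≤ d g
  Deg≤-cong e df n lt = trans (sym (coeff-≈ e n)) (df n lt)

  Deg≤-mono : ∀ {d e f} → d ℕ.≤ e → Deg≤ d f → Deg≤ e f
  Deg≤-mono d≤e df n lt = df n (ℕₚ.≤-<-trans d≤e lt)

  Deg≤-+ : ∀ {d f g} → Deg≤ d f → Deg≤ d g → Deg≤ d (f +ₚ g)
  Deg≤-+ {_} {f} {g} df dg n lt = trans (coeff-+ f g n) (trans (+-cong (df n lt) (dg n lt)) (+-identityˡ 0#))

  Deg≤-neg : ∀ {d f} → Deg≤ d f → Deg≤ d (-ₚ f)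
  Deg≤-neg {_} {f} df n lt = trans (coeff-neg f n) (trans (-‿cong (df n lt)) (Algebra.Properties.Ring.-0#≈0# ring))

  Deg≤-* : ∀ {d e f g} → Deg≤ d f → Deg≤ e g → Deg≤ (d ℕ.+ e) (f *ₚ g)
  Deg≤-* {d} {e} {f} {g} df dg n lt = trans (coeff-* f g n) (conv-deg d e (coeff f) (coeff g) df dg n lt)

  Deg≤-C : ∀ c → Deg≤ 0 (C c)
  Deg≤-C c (suc n) lt = refl

  Deg≤-[] : ∀ {d} → Deg≤ d []
  Deg≤-[] n lt = refl

  Deg≤-X : Deg≤ 1 X
  Deg≤-X (suc (suc n)) lt = refl
  Deg≤-X (suc zero) (s≤s ())

  Deg≤-^ : ∀ {f} n → Deg≤ 1 f → Deg≤ n (f ^ₚ n)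
  Deg≤-^ zero df = Deg≤-C 1#
  Deg≤-^ {f} (suc n) df = Deg≤-* {1} {n} df (Deg≤-^ n df)

  Deg≤-D : ∀ {d f} → Deg≤ (suc d) f → Deg≤ d (D f)
  Deg≤-D {d} {f} df n lt = trans (coeff-D f n) (trans (×-congʳ (suc n) (df (suc n) (s≤s lt))) (sym (coeff-D [] n)))

  D-const : ∀ {f} → Deg≤ 0 f → D f ≈ₚ []
  D-const {f} df = coeffwise λ n → trans (coeff-D f n) (trans (×-congʳ (suc n) (df (suc n) (s≤s z≤n)))
      (sym (coeff-D [] n)))

  -- Turns a bound on the degree into a bound on the length of the list, which is what `rootBound`
  -- compares with the number of zeros.
  take-≈ : ∀ d f → (∀ n → d ℕ.≤ n → coeff f n ≈ 0#) → List.take d f ≈ₚ f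
  take-≈ zero f df = coeffwise λ n → sym (df n z≤n)
  take-≈ (suc d) [] df = P.refl
  take-≈ (suc d) (a ∷ f) df = ∷-cong refl (take-≈ d f λ n le → df (suc n) (s≤s le))

  -- Synthetic division by `X − x`: the coefficients of the quotient are the values at `x` of the
  -- proper tails of the coefficient list (Horner's scheme).
  quotient : Poly → Carrier → Poly
  quotient [] x = []
  quotient (a ∷ f) x = suffixes f
    where
    suffixes : Poly → Poly
    suffixes [] = []
    suffixes (b ∷ f) = eval (b ∷ f) x ∷ suffixes f

  length-quotient : ∀ a f x → length (quotient (a ∷ f) x) ≡ length f
  length-quotient a [] x = ≡.refl
  length-quotient a (b ∷ f) x = ≡.cong suc (length-quotient b f x)

  quotient-correct : ∀ f x → f ≈ₚ (X +ₚ -ₚ C x) *ₚ quotient f x +ₚ C (eval f x)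
  quotient-correct [] x = P.sym (P.trans (P.+-cong (P.zeroʳ _) C-0) (P.+-identityˡ []))
  quotient-correct (a ∷ []) x = P.sym (P.trans (P.+-cong (P.zeroʳ _) (C-cong (eval-C a x))) (P.+-identityˡ _))
  quotient-correct (a ∷ g@(b ∷ f)) x =
    P.trans (horner a g) (P.trans (P.+-congˡ (P.*-congˡ (quotient-correct g x)))
      (P.trans (PS.solve 5 (λ a X x q e → a PS.:+ X PS.:* ((X PS.:- x) PS.:* q PS.:+ e)
                 PS.:= (X PS.:- x) PS.:* (e PS.:+ X PS.:* q) PS.:+ (a PS.:+ x PS.:* e)) P.refl _ _ _ _ _)
        (P.+-cong (P.*-congˡ (P.sym (horner _ _)))
          (P.sym (P.trans (C-+ a _) (P.+-congˡ (C-* x _)))))))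

-- Fields with decidable equality, and homogeneous linear systems.

record Field : Set₁ where
  field
    commutativeRing : CommutativeRing 0ℓ 0ℓ
  open CommutativeRing commutativeRing public
  infix 4 _≈?_
  field
    _≈?_ : ∀ x y → Dec (x ≈ y)
    1≉0 : ¬ 1# ≈ 0#
    inverse : ∀ {x} → ¬ x ≈ 0# → ∃[ y ] y * x ≈ 1#

  *-cancelˡ-0 : ∀ {x y} → ¬ x ≈ 0# → x * y ≈ 0# → y ≈ 0#
  *-cancelˡ-0 {x} {y} x≉0 xy≈0 with inverse x≉0
  ... | z , zx≈1 = begin
    y ≈⟨ *-identityˡ y ⟨
    1# * y ≈⟨ *-congʳ zx≈1 ⟨
    z * x * y ≈⟨ *-assoc z x y ⟩
    z * (x * y) ≈⟨ *-congˡ xy≈0 ⟩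
    z * 0# ≈⟨ zeroʳ z ⟩
    0# ∎
    where open Relation.Binary.Reasoning.Setoid setoid

  *-nonzero : ∀ {x y} → ¬ x ≈ 0# → ¬ y ≈ 0# → ¬ x * y ≈ 0#
  *-nonzero x≉0 y≉0 xy≈0 = y≉0 (*-cancelˡ-0 x≉0 xy≈0)

  open Algebra.Properties.Semiring.Exp semiring public using (_^_)
  open Algebra.Properties.Semiring.Mult semiring public renaming (_×_ to _·_) using ()

  ^-nonzero : ∀ {x} n → ¬ x ≈ 0# → ¬ x ^ n ≈ 0#
  ^-nonzero zero x≉0 = 1≉0
  ^-nonzero (suc n) x≉0 = *-nonzero x≉0 (^-nonzero n x≉0)

  1^ : ∀ n → 1# ^ n ≈ 1#
  1^ zero = refl
  1^ (suc n) = trans (*-identityˡ _) (1^ n)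

  ι : ℕ → Carrier
  ι n = n · 1#

module LinearAlgebra (F : Field) where
  open Field F
  open RingSolver commutativeRing
  open Sums commutativeRing
  open Relation.Binary.Reasoning.Setoid setoid

  private
    extend : ℕ → Carrier → (ℕ → Carrier) → ℕ → Carrier
    extend n x c j with j ℕ.≟ n
    ... | yes _ = x
    ... | no _ = c j

    extend-at : ∀ n {x c} → extend n x c n ≈ x
    extend-at n with n ℕ.≟ n
    ... | yes _ = refl
    ... | no n≢n = contradiction ≡.refl n≢n

    extend-below : ∀ n {x c j} → j < n → extend n x c j ≈ c j
    extend-below n {j = j} j<n with j ℕ.≟ n
    ... | yes ≡.refl = contradiction j<n (ℕₚ.<-irrefl ≡.refl)
    ... | no _ = refl

    ∑-extend : ∀ n {x c} (r : ℕ → Carrier) → ∑ (suc n) (λ j → r j * extend n x c j) ≈ ∑ n (λ j → r j * c j) + r n * x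
    ∑-extend n {x} {c} r = +-cong (∑-cong n λ j j<n → *-congˡ (extend-below n {x} {c} j<n))
        (*-congˡ (extend-at n {x} {c}))

  -- Gaussian elimination on the last unknown. If no row involves it, the last unit vector is a
  -- solution. Otherwise a pivot row clears it from the other rows, which form a system with one row
  -- and one unknown fewer, and the pivot equation then fixes the last coordinate.
  nullVector : ∀ n (rows : List (ℕ → Carrier)) → length rows < n →
    ∃[ c ] (∃[ j ] j < n × ¬ c j ≈ 0#) × (∀ {r} → r ∈ rows → ∑ n (λ j → r j * c j) ≈ 0#)
  nullVector (suc n) rows lt with Any.any? (λ r → ¬? (r n ≈? 0#)) rows
  ... | no allZero = extend n 1# (λ _ → 0#)
      , (n , ℕₚ.n<1+n n , λ e → 1≉0 (trans (sym (extend-at n {1#} {λ _ → 0#})) e))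
      , λ {r} r∈ → begin
          ∑ (suc n) (λ j → r j * extend n 1# (λ _ → 0#) j) ≈⟨ ∑-extend n r ⟩
          ∑ n (λ j → r j * 0#) + r n * 1#
            ≈⟨ +-cong (∑-zero n λ j _ → zeroʳ (r j)) (*-congʳ
                (decidable-stable (r n ≈? 0#) λ rn≉0 → allZero (Any.map (λ { ≡.refl → rn≉0 }) r∈))) ⟩
          0# + 0# * 1# ≈⟨ trans (+-identityˡ _) (zeroˡ _) ⟩
          0# ∎
  ... | yes found with find found
  ...   | pivot , pivot∈ , pn≉0 with ∈-∃++ pivot∈ | inverse pn≉0
  ...     | as , bs , ≡.refl | q , qp≈1
    with nullVector n (List.map eliminate (as ++ bs)) smaller
    where
    eliminate : (ℕ → Carrier) → ℕ → Carrier
    eliminate r j = r j - r n * q * pivot j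
    smaller : length (List.map eliminate (as ++ bs)) < n
    smaller = ≡.subst (_< n) (≡.sym (Listₚ.length-map eliminate (as ++ bs)))
      (ℕₚ.≤-pred (≡.subst (_< suc n) (≡.trans (Listₚ.length-++ as)
          (≡.trans (ℕₚ.+-suc _ _) (≡.cong suc (≡.sym (Listₚ.length-++ as))))) lt))
  ...       | c , (j , j<n , cj≉0) , null = extend n x c
      , (j , ℕₚ.m<n⇒m<1+n j<n , λ e → cj≉0 (trans (sym (extend-below n j<n)) e))
      , λ r∈ → trans (∑-extend n _) (kill (∈-++⁻ as r∈))
    where
    s : Carrier
    s = ∑ n (λ j → pivot j * c j)
    -- The value that solves the pivot equation, `q` being the inverse of `pivot n`.
    x : Carrier
    x = - (q * s)
    killPivot : s + pivot n * x ≈ 0#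
    killPivot = begin
      s + pivot n * - (q * s) ≈⟨ solve 3 (λ s q p → s :+ p :* (:- (q :* s)) := s :- q :* p :* s) refl _ _ _ ⟩
      s - q * pivot n * s ≈⟨ +-congˡ (-‿cong (trans (*-congʳ qp≈1) (*-identityˡ s))) ⟩
      s - s ≈⟨ -‿inverseʳ s ⟩
      0# ∎
    killOther : ∀ {r} → r ∈ as ++ bs → ∑ n (λ j → r j * c j) + r n * x ≈ 0#
    killOther {r} r∈ = begin
      ∑ n (λ j → r j * c j) + r n * - (q * s)
        ≈⟨ solve 4 (λ a r q s → a :+ r :* (:- (q :* s)) := a :+ (:- (r :* q)) :* s) refl _ _ _ _ ⟩
      ∑ n (λ j → r j * c j) + - (r n * q) * s ≈⟨ +-congˡ (*-∑ n _ _) ⟩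
      ∑ n (λ j → r j * c j) + ∑ n (λ j → - (r n * q) * (pivot j * c j)) ≈⟨ ∑-+ n _ _ ⟨
      ∑ n (λ j → r j * c j + - (r n * q) * (pivot j * c j))
        ≈⟨ ∑-cong n (λ j _ → solve 4 (λ r k p c → r :* c :+ (:- k) :* (p :* c) := (r :- k :* p) :* c) refl _ _ _ _) ⟩
      ∑ n (λ j → (r j - r n * q * pivot j) * c j) ≈⟨ null (∈-map⁺ _ r∈) ⟩
      0# ∎
    kill : ∀ {r} → r ∈ as ⊎ r ∈ pivot ∷ bs → ∑ n (λ j → r j * c j) + r n * x ≈ 0#
    kill (inj₁ r∈as) = killOther (∈-++⁺ˡ r∈as)
    kill (inj₂ (here ≡.refl)) = killPivot
    kill (inj₂ (there r∈bs)) = killOther (∈-++⁺ʳ as r∈bs)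

-- Order of vanishing, and the bound for the number of zeros.

module VanishingOrder (F : Field) where
  open Field F
  open PolynomialRing commutativeRing
  open CommutativeRing polynomialRing using () renaming
    (refl to reflₚ; sym to symₚ; trans to transₚ; +-congˡ to +ₚ-congˡ; +-congʳ to +ₚ-congʳ; +-cong to +ₚ-cong;
     *-congˡ to *ₚ-congˡ; *-congʳ to *ₚ-congʳ; *-cong to *ₚ-cong; zeroʳ to zeroʳₚ; *-identityˡ to *ₚ-identityˡ;
     +-identityʳ to +ₚ-identityʳ; -‿cong to -ₚ-cong)
  open RingSolver polynomialRing

  -- Only meaningful for m at most the characteristic, since derivatives are not divided by factorials.
  Ord : ℕ → Carrier → Poly → Set
  Ord zero x f = ⊤
  Ord (suc m) x f = eval f x ≈ 0# × Ord m x (D f)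

  Ord-cong : ∀ m {x f g} → f ≈ₚ g → Ord m x f → Ord m x g
  Ord-cong zero e o = tt
  Ord-cong (suc m) {x} e (z , o) = trans (eval-cong x (symₚ e)) z , Ord-cong m (D-cong e) o

  Ord-pred : ∀ m {x f} → Ord (suc m) x f → Ord m x f
  Ord-pred zero o = tt
  Ord-pred (suc m) (z , o) = z , Ord-pred m o

  Ord-≤ : ∀ {m n x f} → m ≤ n → Ord n x f → Ord m x f
  Ord-≤ z≤n o = tt
  Ord-≤ (s≤s m≤n) (z , o) = z , Ord-≤ m≤n o

  Ord-+ : ∀ m {x f g} → Ord m x f → Ord m x g → Ord m x (f +ₚ g)
  Ord-+ zero o o′ = tt
  Ord-+ (suc m) {x} {f} {g} (z , o) (z′ , o′) =
    trans (eval-+ f g x) (trans (+-cong z z′) (+-identityˡ 0#)) , Ord-cong m (symₚ (D-+ f g)) (Ord-+ m o o′)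

  Ord-* : ∀ m {x} h {f} → Ord m x f → Ord m x (h *ₚ f)
  Ord-* zero h o = tt
  Ord-* (suc m) {x} h {f} o@(z , o′) = trans (eval-* h f x) (trans (*-congˡ z) (zeroʳ _))
    , Ord-cong m (symₚ (D-* h f)) (Ord-+ m (Ord-* m (D h) (Ord-pred m o)) (Ord-* m h o′))

  private
    Ord-cancel-+ : ∀ m {x f g} → Ord m x f → Ord m x (f +ₚ g) → Ord m x g
    Ord-cancel-+ m {_} {f} {g} o o′ = Ord-cong m
      (transₚ (+ₚ-congˡ (transₚ (solve 2 (λ o f → (:- o) :* f := :- (o :* f)) reflₚ (C 1#) f)
          (-ₚ-cong (*ₚ-identityˡ f))))
        (solve 2 (λ f g → (f :+ g) :- f := g) reflₚ f g))
      (Ord-+ m o′ (Ord-* m (-ₚ C 1#) o))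

  -- In `(w f)′ = w′ f + w f′` the left side vanishes to order `m`, and so does `w′ f` by induction
  -- applied to `f`. Hence so does `w f′`, and a second use of the induction removes `w` from it.
  Ord-cancel-* : ∀ m {x w f} → ¬ eval w x ≈ 0# → Ord m x (w *ₚ f) → Ord m x f
  Ord-cancel-* zero w≉0 o = tt
  Ord-cancel-* (suc m) {x} {w} {f} w≉0 o@(z , o′) =
    *-cancelˡ-0 w≉0 (trans (sym (eval-* w f x)) z) ,
    Ord-cancel-* m w≉0 (Ord-cancel-+ m (Ord-* m (D w) (Ord-cancel-* m w≉0 (Ord-pred m o)))
      (Ord-cong m (D-* w f) o′))

  D-X-x : ∀ x → D (X +ₚ -ₚ C x) ≈ₚ C 1#
  D-X-x x = transₚ (D-+ X (-ₚ C x)) (transₚ (+ₚ-cong D-X (D-const { -ₚ C x} (Deg≤-neg {0} {C x} (Deg≤-C x))))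
      (+ₚ-identityʳ (C 1#)))

  eval-X-x : ∀ x y → eval (X +ₚ -ₚ C x) y ≈ y - x
  eval-X-x x y = trans (eval-+ X _ y) (+-cong (eval-X y) (trans (eval-neg (C x) y) (-‿cong (eval-C x y))))

  private
    -- The derivative of `c q + (X − y) q′` is `(c + 1) q′ + (X − y) q″`, which has the same shape;
    -- hence the general `c`. At `y` the expression is `c q(y)`, and dividing by `c` is where the
    -- characteristic enters.
    Ord-divide : ∀ m {y q} c → (∀ k → k < m → ¬ ι (c ℕ.+ k) ≈ 0#) →
      Ord m y (C (ι c) *ₚ q +ₚ (X +ₚ -ₚ C y) *ₚ D q) → Ord m y q
    Ord-divide zero c c≉0 o = tt
    Ord-divide (suc m) {y} {q} c c≉0 (z , o) =
      *-cancelˡ-0 (≡.subst (λ k → ¬ ι k ≈ 0#) (ℕₚ.+-identityʳ c) (c≉0 0 (s≤s z≤n))) cq≈0 ,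
      Ord-divide m (suc c) (λ k k<m → ≡.subst (λ k → ¬ ι k ≈ 0#) (ℕₚ.+-suc c k) (c≉0 (suc k) (s≤s k<m)))
        (Ord-cong m derived o)
      where
      cq≈0 : ι c * eval q y ≈ 0#
      cq≈0 = trans (sym (trans (eval-+ (C (ι c) *ₚ q) _ y) (trans
          (+-cong (trans (eval-* (C (ι c)) q y) (*-congʳ (eval-C (ι c) y)))
        (trans (eval-* (X +ₚ -ₚ C y) (D q) y) (trans (*-congʳ (trans (eval-X-x y y) (-‿inverseʳ y))) (zeroˡ _))))
            (+-identityʳ _)))) z
      derived : D (C (ι c) *ₚ q +ₚ (X +ₚ -ₚ C y) *ₚ D q) ≈ₚ C (ι (suc c)) *ₚ D q +ₚ (X +ₚ -ₚ C y) *ₚ D (D q)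
      derived = transₚ (D-+ _ _) (transₚ (+ₚ-cong (transₚ (D-* (C (ι c)) q) (+ₚ-congʳ (*ₚ-congʳ (D-C (ι c)))))
          (transₚ (D-* (X +ₚ -ₚ C y) (D q)) (+ₚ-congʳ (*ₚ-congʳ (D-X-x y)))))
        (transₚ (transₚ (+ₚ-congʳ (transₚ (+ₚ-congʳ (zeroˡₚ q)) (+ₚ-identityˡ _)))
           (solve 4 (λ c o q x → c :* q :+ (o :* q :+ x) := (o :+ c) :* q :+ x) reflₚ (C (ι c)) (C 1#) (D q) _))
          (+ₚ-congʳ (*ₚ-congʳ (symₚ (C-+ 1# (ι c)))))))
        where open CommutativeRing polynomialRing using () renaming (zeroˡ to zeroˡₚ; +-identityˡ to +ₚ-identityˡ)

  -- The derivative of `(X − y) q` is `q + (X − y) q′`, the case `c = 1` of `Ord-divide`.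
  Ord-quotient : ∀ m {y q} → (∀ k → 0 < k → k ≤ m → ¬ ι k ≈ 0#) →
    Ord (suc m) y ((X +ₚ -ₚ C y) *ₚ q) → Ord m y q
  Ord-quotient m {y} {q} char (_ , o) = Ord-divide m 1 (λ k k<m → char (suc k) (s≤s z≤n) k<m)
    (Ord-cong m (transₚ (D-* (X +ₚ -ₚ C y) q) (+ₚ-congʳ (*ₚ-congʳ
        (transₚ (D-X-x y) (C-cong (sym (+-identityʳ 1#))))))) o)

  -- Linear factors are split off one at a time. Each division shortens the list by one, lowers the
  -- order at its own root by one, and keeps the orders at the other points, where `X − x` does not
  -- vanish. When all prescribed zeros are used up no coefficient is left.
  rootBound : ∀ M → (∀ k → 0 < k → k < M → ¬ ι k ≈ 0#) →
    ∀ xs → AllPairs (λ x y → ¬ x ≈ y) xs → ∀ f → All (λ x → Ord M x f) xs → length f ≤ length xs ℕ.* M → f ≈ₚ []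
  rootBound M char [] distinct [] o len = reflₚ
  rootBound M char (x ∷ xs) (x≉ ∷ distinct) f (o ∷ os) len = peel M ℕₚ.≤-refl f o os len
    where
    peel : ∀ m → m ≤ M → ∀ f → Ord m x f → All (λ x → Ord M x f) xs → length f ≤ m ℕ.+ length xs ℕ.* M → f ≈ₚ []
    peel zero m≤M f o os len = rootBound M char xs distinct f os len
    peel (suc m) m≤M [] o os len = reflₚ
    peel (suc m) m≤M (a ∷ f) o@(z , _) os (s≤s len) = transₚ factor (transₚ (*ₚ-congˡ q≈0) (zeroʳₚ _))
      where
      q : Poly
      q = quotient (a ∷ f) x
      factor : a ∷ f ≈ₚ (X +ₚ -ₚ C x) *ₚ q
      factor = transₚ (quotient-correct (a ∷ f) x) (transₚ (+ₚ-congˡ (transₚ (C-cong z) C-0)) (+ₚ-identityʳ _))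
      q≈0 : q ≈ₚ []
      q≈0 = peel m (ℕₚ.<⇒≤ m≤M) q
        (Ord-quotient m (λ k 0<k k≤m → char k 0<k (ℕₚ.≤-<-trans k≤m m≤M)) (Ord-cong (suc m) factor o))
        (All.zipWith (λ {y} (x≉y , o) → Ord-cancel-* M
           (λ e → x≉y (sym (x∙y⁻¹≈ε⇒x≈y y x (trans (sym (eval-X-x x y)) e)))) (Ord-cong M factor o)) (x≉ , os))
        (≡.subst (_≤ m ℕ.+ length xs ℕ.* M) (≡.sym (length-quotient a f x)) len)
        where open Algebra.Properties.Ring ring using (x∙y⁻¹≈ε⇒x≈y)

  iterate : (Poly → Poly) → ℕ → Poly → Poly
  iterate L zero f = f
  iterate L (suc k) f = iterate L k (L f)

  -- The operator `w D` will replace `D`, because for `w = X f g` it maps each product of powers of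
  -- `X`, `f` and `g` to a polynomial multiple of itself. Where `w` does not vanish its iterates
  -- still detect the order of vanishing, `w` being cancelled at every step.
  Ord-iterate : ∀ m {x} w f → ¬ eval w x ≈ 0# →
    (∀ k → k < m → eval (iterate (λ h → w *ₚ D h) k f) x ≈ 0#) → Ord m x f
  Ord-iterate zero w f w≉0 e = tt
  Ord-iterate (suc m) w f w≉0 e = e 0 (s≤s z≤n) ,
    Ord-cancel-* m w≉0 (Ord-iterate m w (w *ₚ D f) w≉0 λ k k<m → e (suc k) (s≤s k<m))

-- Linear independence of products of powers of two polynomials, to finite order at a point.

module PolynomialSums (F : Field) where
  open Field F
  open Sums commutativeRing
  open PolynomialRing commutativeRing
  private
    module P = CommutativeRing polynomialRing
    module KS = RingSolver commutativeRing
  open RingSolver polynomialRing renaming (solve to solveₚ)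
  open Sums polynomialRing public renaming
    (∑ to ∑ₚ; ∑-cong to ∑ₚ-cong; ∑-zero to ∑ₚ-zero; *-∑ to *-∑ₚ; ∑-split to ∑ₚ-split; ∑-+ to ∑ₚ-+)

  eval-∑ : ∀ n f x → eval (∑ₚ n f) x ≈ ∑ n (λ i → eval (f i) x)
  eval-∑ zero f x = refl
  eval-∑ (suc n) f x = trans (eval-+ (∑ₚ n f) (f n) x) (+-congʳ (eval-∑ n f x))

  coeff-∑ : ∀ n f k → coeff (∑ₚ n f) k ≈ ∑ n (λ i → coeff (f i) k)
  coeff-∑ zero f k = refl
  coeff-∑ (suc n) f k = trans (coeff-+ (∑ₚ n f) (f n) k) (+-congʳ (coeff-∑ n f k))

  D-∑ : ∀ n f → D (∑ₚ n f) ≈ₚ ∑ₚ n (λ i → D (f i))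
  D-∑ zero f = P.refl
  D-∑ (suc n) f = P.trans (D-+ (∑ₚ n f) (f n)) (P.+-congʳ (D-∑ n f))

  Deg≤-∑ : ∀ {d} n f → (∀ i → i < n → Deg≤ d (f i)) → Deg≤ d (∑ₚ n f)
  Deg≤-∑ zero f df = Deg≤-[]
  Deg≤-∑ (suc n) f df = Deg≤-+ (Deg≤-∑ n f λ i i<n → df i (ℕₚ.m<n⇒m<1+n i<n)) (df n (ℕₚ.n<1+n n))

  D-C*-* : ∀ c f g → D (C c *ₚ (f *ₚ g)) ≈ₚ C c *ₚ (D f *ₚ g +ₚ f *ₚ D g)
  D-C*-* c f g = P.trans (D-* (C c) _) (P.trans (P.+-cong (P.trans (P.*-congʳ (D-C c)) (P.zeroˡ _))
      (P.*-congˡ (D-* f g))) (P.+-identityˡ _))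

  -- The logarithmic derivative of a power, multiplied out by `f` so that the exponent `n − 1` never
  -- appears.
  D-^ : ∀ f n → f *ₚ D (f ^ₚ n) ≈ₚ C (ι n) *ₚ (D f *ₚ f ^ₚ n)
  D-^ f zero = P.trans (P.*-congˡ (D-C 1#)) (P.trans (P.zeroʳ f) (P.sym (P.trans (P.*-congʳ C-0) (P.zeroˡ _))))
  D-^ f (suc n) = P.trans (P.*-congˡ (D-* f (f ^ₚ n)))
    (P.trans (solveₚ 4 (λ f f′ g g′ → f :* (f′ :* g :+ f :* g′) := f′ :* (f :* g) :+ f :* (f :* g′)) P.refl _ _ _ _)
    (P.trans (P.+-cong (P.sym (P.*-identityˡ _)) (P.*-congˡ (D-^ f n)))
    (P.trans (solveₚ 5 (λ f o f′ g c → o :* (f′ :* (f :* g)) :+ f :* (c :* (f′ :* g))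
        := (o :+ c) :* (f′ :* (f :* g))) P.refl f (C 1#) (D f) (f ^ₚ n) (C (ι n)))
      (P.*-congʳ (P.sym (C-+ 1# (ι n)))))))

  -- With w = f′g − fg′ constant, the operator S ↦ fgS′ − (Nfg′ + eₙw) S multiplies f^e g^(N−e) by (e − eₙ) w.
  -- It lowers the order of vanishing by at most one and removes the last term of a sum.
  module Sparse (f g : Poly) (w : Carrier) (wronskian : D f *ₚ g ≈ₚ C w +ₚ f *ₚ D g) (w≉0 : ¬ w ≈ 0#)
      (x : Carrier) (f≉0 : ¬ eval f x ≈ 0#) (g≉0 : ¬ eval g x ≈ 0#) where
    open VanishingOrder F

    private
      term : ℕ → ℕ → Poly
      term e h = f ^ₚ e *ₚ g ^ₚ h

      -- The logarithmic derivative `e f′/f + h g′/g` with denominators cleared. After substituting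
      -- `w + f g′` for `f′ g`, the exponents enter only through the total `e + h` and the constant
      -- `e w`.
      term-D : ∀ e h → f *ₚ g *ₚ D (term e h) ≈ₚ (C (ι (e ℕ.+ h)) *ₚ (f *ₚ D g) +ₚ C (ι e * w)) *ₚ term e h
      term-D e h = begin
        f *ₚ g *ₚ D (term e h) ≈⟨ P.*-congˡ (D-* (f ^ₚ e) (g ^ₚ h)) ⟩
        f *ₚ g *ₚ (D (f ^ₚ e) *ₚ g ^ₚ h +ₚ f ^ₚ e *ₚ D (g ^ₚ h))
          ≈⟨ solveₚ 6 (λ f g F F′ G G′ → f :* g :* (F′ :* G :+ F :* G′)
               := g :* G :* (f :* F′) :+ f :* F :* (g :* G′)) P.refl _ _ _ _ _ _ ⟩
        g *ₚ g ^ₚ h *ₚ (f *ₚ D (f ^ₚ e)) +ₚ f *ₚ f ^ₚ e *ₚ (g *ₚ D (g ^ₚ h))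
          ≈⟨ P.+-cong (P.*-congˡ (D-^ f e)) (P.*-congˡ (D-^ g h)) ⟩
        g *ₚ g ^ₚ h *ₚ (C (ι e) *ₚ (D f *ₚ f ^ₚ e)) +ₚ f *ₚ f ^ₚ e *ₚ (C (ι h) *ₚ (D g *ₚ g ^ₚ h))
          ≈⟨ solveₚ 8 (λ f g F G f′ g′ e h → g :* G :* (e :* (f′ :* F)) :+ f :* F :* (h :* (g′ :* G))
               := (e :* (f′ :* g) :+ h :* (f :* g′)) :* (F :* G)) P.refl _ _ _ _ _ _ _ _ ⟩
        (C (ι e) *ₚ (D f *ₚ g) +ₚ C (ι h) *ₚ (f *ₚ D g)) *ₚ term e h
          ≈⟨ P.*-congʳ (P.+-congʳ (P.*-congˡ wronskian)) ⟩
        (C (ι e) *ₚ (C w +ₚ f *ₚ D g) +ₚ C (ι h) *ₚ (f *ₚ D g)) *ₚ term e h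
          ≈⟨ P.*-congʳ (solveₚ 4 (λ e w z h → e :* (w :+ z) :+ h :* z := (e :+ h) :* z :+ e :* w) P.refl _ _ _ _) ⟩
        ((C (ι e) +ₚ C (ι h)) *ₚ (f *ₚ D g) +ₚ C (ι e) *ₚ C w) *ₚ term e h
          ≈⟨ P.*-congʳ (P.+-cong (P.*-congʳ (P.trans (P.sym (C-+ (ι e) (ι h))) (C-cong (sym (×-homo-+ 1# e h)))))
              (P.sym (C-* (ι e) w))) ⟩
        (C (ι (e ℕ.+ h)) *ₚ (f *ₚ D g) +ₚ C (ι e * w)) *ₚ term e h ∎
        where
        open Relation.Binary.Reasoning.Setoid P.setoid
        open Algebra.Properties.Semiring.Mult semiring using (×-homo-+)

    -- In terms of `t = f/g` the sum is `g^N` times a combination of the powers `t^e`, and the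
    -- operator becomes `w` times `t d/dt` minus its eigenvalue `e n`. The eigenvalues live in the
    -- field, so the exponents must be distinct there and not only as integers.
    sparse : ∀ N (e h : ℕ → ℕ) n → (∀ {r} → r < n → e r ℕ.+ h r ≡ N) →
      (∀ {r s} → r < s → s < n → ¬ ι (e r) ≈ ι (e s)) →
      ∀ c → Ord n x (∑ₚ n (λ r → C (c r) *ₚ term (e r) (h r))) → ∀ r → r < n → c r ≈ 0#
    sparse N e h (suc n) e+h distinct c o = result
      where
      open import Algebra.Properties.Ring ring using (x∙y⁻¹≈ε⇒x≈y)
      S z₀ z₁ : Poly
      S = ∑ₚ (suc n) (λ r → C (c r) *ₚ term (e r) (h r))
      z₀ = f *ₚ g
      z₁ = -ₚ (C (ι N) *ₚ (f *ₚ D g) +ₚ C (ι (e n) * w))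
      c′ : ℕ → Carrier
      c′ r = c r * ((ι (e r) - ι (e n)) * w)

      one : ∀ r → r < suc n → z₀ *ₚ D (C (c r) *ₚ term (e r) (h r)) +ₚ z₁ *ₚ (C (c r) *ₚ term (e r) (h r)) ≈ₚ C
          (c′ r) *ₚ term (e r) (h r)
      one r r<n = begin
        z₀ *ₚ D (C (c r) *ₚ t) +ₚ z₁ *ₚ (C (c r) *ₚ t)
          ≈⟨ P.+-congʳ (P.*-congˡ (P.trans (D-* (C (c r)) t)
              (P.trans (P.+-congʳ (P.trans (P.*-congʳ (D-C (c r))) (P.zeroˡ _))) (P.+-identityˡ _)))) ⟩
        z₀ *ₚ (C (c r) *ₚ D t) +ₚ z₁ *ₚ (C (c r) *ₚ t)
          ≈⟨ solveₚ 5 (λ z₀ z₁ c t t′ → z₀ :* (c :* t′) :+ z₁ :* (c :* t)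
              := c :* (z₀ :* t′ :+ z₁ :* t)) P.refl _ _ _ _ _ ⟩
        C (c r) *ₚ (z₀ *ₚ D t +ₚ z₁ *ₚ t)
          ≈⟨ P.*-congˡ (P.+-congʳ (P.trans (term-D (e r) (h r))
              (P.*-congʳ (P.+-congʳ (P.*-congʳ (P.reflexive (≡.cong (λ k → C (ι k)) (e+h r<n)))))))) ⟩
        C (c r) *ₚ ((C (ι N) *ₚ (f *ₚ D g) +ₚ C (ι (e r) * w)) *ₚ t +ₚ z₁ *ₚ t)
          ≈⟨ P.*-congˡ (solveₚ 4 (λ a b d t → (a :+ b) :* t :+ (:- (a :+ d)) :* t := (b :- d) :* t) P.refl _ _ _ _) ⟩
        C (c r) *ₚ ((C (ι (e r) * w) P.- C (ι (e n) * w)) *ₚ t)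
          ≈⟨ P.*-congˡ (P.*-congʳ (P.trans (P.+-congˡ (P.sym (C-neg _)))
              (P.trans (P.sym (C-+ _ _)) (C-cong (KS.solve 3
                  (λ a b w → a KS.:* w KS.:- b KS.:* w KS.:= (a KS.:- b) KS.:* w) refl _ _ _))))) ⟩
        C (c r) *ₚ (C ((ι (e r) - ι (e n)) * w) *ₚ t) ≈⟨ P.sym (P.*-assoc _ _ _) ⟩
        C (c r) *ₚ C ((ι (e r) - ι (e n)) * w) *ₚ t ≈⟨ P.*-congʳ (P.sym (C-* _ _)) ⟩
        C (c′ r) *ₚ t ∎
        where
        open Relation.Binary.Reasoning.Setoid P.setoid
        t : Poly
        t = term (e r) (h r)

      reduced : z₀ *ₚ D S +ₚ z₁ *ₚ S ≈ₚ ∑ₚ n (λ r → C (c′ r) *ₚ term (e r) (h r))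
      reduced = begin
        z₀ *ₚ D S +ₚ z₁ *ₚ S ≈⟨ P.+-cong (P.trans (P.*-congˡ (D-∑ (suc n) _)) (*-∑ₚ (suc n) z₀ _)) (*-∑ₚ (suc n) z₁ _) ⟩
        ∑ₚ (suc n) _ +ₚ ∑ₚ (suc n) _ ≈⟨ ∑ₚ-+ (suc n) _ _ ⟨
        ∑ₚ (suc n) _ ≈⟨ ∑ₚ-cong (suc n) one ⟩
        ∑ₚ n (λ r → C (c′ r) *ₚ term (e r) (h r)) +ₚ C (c′ n) *ₚ term (e n) (h n)
          ≈⟨ P.+-congˡ (P.trans (P.*-congʳ (P.trans (C-cong
              (trans (*-congˡ (trans (*-congʳ (-‿inverseʳ _)) (zeroˡ w))) (zeroʳ _))) C-0)) (P.zeroˡ _)) ⟩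
        _ +ₚ [] ≈⟨ P.+-identityʳ _ ⟩
        _ ∎
        where open Relation.Binary.Reasoning.Setoid P.setoid

      below : ∀ r → r < n → c r ≈ 0#
      below r r<n = *-cancelˡ-0 (*-nonzero (λ eq → distinct r<n (ℕₚ.n<1+n n) (x∙y⁻¹≈ε⇒x≈y _ _ eq)) w≉0)
        (trans (*-comm _ _) (sparse N e h n (λ r<n → e+h (ℕₚ.m<n⇒m<1+n r<n))
            (λ r<s s<n → distinct r<s (ℕₚ.m<n⇒m<1+n s<n)) c′
          (Ord-cong n reduced (Ord-+ n (Ord-* n z₀ (proj₂ o)) (Ord-* n z₁ (Ord-pred n o)))) r r<n))

      -- With the other coefficients gone, `S` is a single term, and the zeroth-order condition
      -- `S(x) = 0` suffices.
      last : c n ≈ 0#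
      last = *-cancelˡ-0 (*-nonzero (^-nonzero (e n) f≉0) (^-nonzero (h n) g≉0)) (begin
        eval f x ^ e n * eval g x ^ h n * c n ≈⟨ *-comm _ _ ⟩
        c n * (eval f x ^ e n * eval g x ^ h n)
          ≈⟨ *-congˡ (trans (eval-* (f ^ₚ e n) _ x) (*-cong (eval-^ f (e n) x) (eval-^ g (h n) x))) ⟨
        c n * eval (term (e n) (h n)) x ≈⟨ trans (eval-* (C (c n)) _ x) (*-congʳ (eval-C (c n) x)) ⟨
        eval (C (c n) *ₚ term (e n) (h n)) x ≈⟨ eval-cong x (P.trans (P.+-congʳ (∑ₚ-zero n λ r r<n →
            P.trans (P.*-congʳ (P.trans (C-cong (below r r<n)) C-0)) (P.zeroˡ _))) (P.+-identityˡ _)) ⟨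
        eval S x ≈⟨ proj₁ o ⟩
        0# ∎)
        where open Relation.Binary.Reasoning.Setoid setoid

      result : ∀ r → r < suc n → c r ≈ 0#
      result r (s≤s r≤n) with ℕₚ.m≤n⇒m<n∨m≡n r≤n
      ... | inj₁ r<n = below r r<n
      ... | inj₂ ≡.refl = last

-- Stepanov's method for the equations `x^τ = 1` and `(u − x)^τ = (v x − 1)^τ`.

module Stepanov (F : Field) where
  open Field F
  open Sums commutativeRing
  open PolynomialRing commutativeRing
  open PolynomialSums F
  open VanishingOrder F
  open LinearAlgebra F
  private
    module P = CommutativeRing polynomialRing
    module PE = Algebra.Properties.Semiring.Exp P.semiring
  open RingSolver polynomialRing renaming (solve to solveₚ)
  open Algebra.Properties.Semiring.Exp semiring using (^-homo-*; ^-assocʳ; ^-congˡ)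

  X^-cancel : ∀ n f → X ^ₚ n *ₚ f ≈ₚ [] → f ≈ₚ []
  X^-cancel zero f e = P.trans (P.sym (P.*-identityˡ f)) e
  X^-cancel (suc n) f e = X^-cancel n f (X*-cancel _ (P.trans (P.sym (P.*-assoc X _ f)) e))

  Ord-X^ : ∀ n f → Ord n 0# (X ^ₚ n *ₚ f)
  Ord-X^ zero f = tt
  Ord-X^ (suc n) f = trans (eval-* _ f 0#) (trans (*-congʳ (trans (eval-* X _ 0#)
      (trans (*-congʳ (eval-X 0#)) (zeroˡ _)))) (zeroˡ _))
    , Ord-cong n (P.sym derivative) (Ord-X^ n _)
    where
    open Relation.Binary.Reasoning.Setoid P.setoid
    derivative : D (X ^ₚ suc n *ₚ f) ≈ₚ X ^ₚ n *ₚ ((f +ₚ C (ι n) *ₚ f) +ₚ X *ₚ D f)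
    derivative = begin
      D (X ^ₚ suc n *ₚ f) ≈⟨ D-* _ f ⟩
      D (X *ₚ X ^ₚ n) *ₚ f +ₚ X ^ₚ suc n *ₚ D f
          ≈⟨ P.+-congʳ (P.*-congʳ (P.trans (D-* X _) (P.+-cong (P.trans (P.*-congʳ D-X) (P.*-identityˡ _))
          (P.trans (D-^ X n) (P.*-congˡ (P.trans (P.*-congʳ D-X) (P.*-identityˡ _))))))) ⟩
      (X ^ₚ n +ₚ C (ι n) *ₚ X ^ₚ n) *ₚ f +ₚ X ^ₚ suc n *ₚ D f
        ≈⟨ solveₚ 5 (λ y c f x f′ → (y :+ c :* y) :* f :+ x :* y :* f′
            := y :* ((f :+ c :* f) :+ x :* f′)) P.refl _ _ _ _ _ ⟩
      X ^ₚ n *ₚ ((f +ₚ C (ι n) *ₚ f) +ₚ X *ₚ D f) ∎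

  -- The lowest block of a vanishing combination is divisible by X^τ.
  blocks-independent : ∀ τ n .{{_ : NonZero n}} (base : ℕ → Poly) →
    (∀ (c : ℕ → Carrier) → Ord τ 0# (∑ₚ n (λ r → C (c r) *ₚ base r)) → ∀ r → r < n → c r ≈ 0#) →
    ∀ B (c : ℕ → Carrier) → ∑ₚ (B ℕ.* n) (λ j → C (c j) *ₚ (base (j % n) *ₚ X ^ₚ (τ ℕ.* (j / n)))) ≈ₚ [] → ∀ j →
        j < B ℕ.* n → c j ≈ 0#
  blocks-independent τ n base independent (suc B) c vanish = result
    where
    term : ℕ → Poly
    term j = base (j % n) *ₚ X ^ₚ (τ ℕ.* (j / n))
    low rest : Poly
    low = ∑ₚ n (λ r → C (c r) *ₚ base r)
    rest = ∑ₚ (B ℕ.* n) (λ j → C (c (n ℕ.+ j)) *ₚ term j)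

    term-low : ∀ r → r < n → term r ≈ₚ base r
    term-low r r<n rewrite m<n⇒m%n≡m r<n | m<n⇒m/n≡0 r<n | ℕₚ.*-zeroʳ τ = P.trans (P.*-comm _ _) (P.*-identityˡ _)

    term-shift : ∀ j → term (n ℕ.+ j) ≈ₚ X ^ₚ τ *ₚ term j
    term-shift j rewrite ≡.trans (≡.cong (_% n) (ℕₚ.+-comm n j)) ([m+n]%n≡m%n j n)
      | ≡.trans (+-distrib-/-∣ˡ {n} j {n} ∣-refl) (≡.cong (ℕ._+ j / n) (n/n≡1 n)) | ℕₚ.*-suc τ (j / n) =
      P.trans (P.*-congˡ (PE.^-homo-* X τ _)) (solveₚ 3 (λ a b c → a :* (b :* c) := b :* (a :* c)) P.refl _ _ _)

    decompose : low +ₚ X ^ₚ τ *ₚ rest ≈ₚ []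
    decompose = P.trans (P.+-cong
        (∑ₚ-cong n λ r r<n → P.*-congˡ (P.sym (term-low r r<n)))
        (P.trans (*-∑ₚ (B ℕ.* n) _ _) (∑ₚ-cong (B ℕ.* n) λ j _ →
          P.trans (solveₚ 3 (λ a b c → a :* (b :* c) := b :* (a :* c)) P.refl _ _ _)
              (P.*-congˡ (P.sym (term-shift j))))))
      (P.trans (P.sym (∑ₚ-split n (B ℕ.* n) _)) vanish)

    low-zero : ∀ r → r < n → c r ≈ 0#
    low-zero = independent c (Ord-cong τ lemma (Ord-* τ (-ₚ C 1#) (Ord-X^ τ rest)))
      where
      lemma : -ₚ C 1# *ₚ (X ^ₚ τ *ₚ rest) ≈ₚ low
      lemma = P.trans (P.sym (P.+-identityˡ _)) (P.trans (P.+-congʳ (P.sym decompose))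
        (P.trans (P.+-congˡ (P.trans (solveₚ 2 (λ o z → (:- o) :* z := :- (o :* z)) P.refl (C 1#) _)
            (P.-‿cong (P.*-identityˡ _))))
          (solveₚ 2 (λ a b → (a :+ b) :- b := a) P.refl _ _)))

    rest-vanish : rest ≈ₚ []
    rest-vanish = X^-cancel τ rest (P.trans (P.sym (P.+-identityˡ _)) (P.trans (P.+-congʳ (P.sym
      (∑ₚ-zero n λ r r<n → P.trans (P.*-congʳ (P.trans (C-cong (low-zero r r<n)) C-0)) (P.zeroˡ _)))) decompose))

    result : ∀ j → j < n ℕ.+ B ℕ.* n → c j ≈ 0#
    result j lt with j ℕ.<? n
    ... | yes j<n = low-zero j j<n
    ... | no j≮n = ≡.subst (λ k → c k ≈ 0#) (ℕₚ.m+[n∸m]≡n n≤j)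
        (blocks-independent τ n base independent B (λ j → c (n ℕ.+ j)) rest-vanish (j ℕ.∸ n)
          (ℕₚ.+-cancelˡ-< n _ _ (≡.subst (_< n ℕ.+ B ℕ.* n) (≡.sym (ℕₚ.m+[n∸m]≡n n≤j)) lt)))
      where
      n≤j : n ≤ j
      n≤j = ℕₚ.≮⇒≥ j≮n

  length-cartesianProductWith : ∀ {X Y Z : Set} (h : X → Y → Z) xs ys →
    length (cartesianProductWith h xs ys) ≡ length xs ℕ.* length ys
  length-cartesianProductWith h [] ys = ≡.refl
  length-cartesianProductWith h (x ∷ xs) ys = ≡.trans (Listₚ.length-++ (List.map (h x) ys))
    (≡.cong₂ ℕ._+_ (Listₚ.length-map (h x) ys) (length-cartesianProductWith h xs ys))

  -- In the application `v` is `σ u`. `A`, `suc C′` and `B` count the values of the exponent `i`, of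
  -- the multiple `k′` of `τ`, and of the power of `X^τ`, so that there are `B * n` unknown
  -- coefficients; `M` is the order of vanishing aimed at.
  module _ (u v : Carrier) (u≉0 : ¬ u ≈ 0#) (uv≉1 : ¬ u * v ≈ 1#) (τ A′ B C′ M : ℕ) where
    private
      A = suc A′
      n = suc C′ ℕ.* A

      f g w : Poly
      f = C u +ₚ -ₚ X
      g = C v *ₚ X +ₚ -ₚ C 1#
      w = X *ₚ (f *ₚ g)

      D-f : D f ≈ₚ -ₚ C 1#
      D-f = begin
        D (C u +ₚ -ₚ X)
            ≈⟨ D-cong (P.+-congˡ (P.trans (P.-‿cong (P.sym (P.*-identityˡ X)))
                (solveₚ 2 (λ o x → :- (o :* x) := (:- o) :* x) P.refl (C 1#) X))) ⟩
        D (C u +ₚ -ₚ C 1# *ₚ X) ≈⟨ P.trans (D-+ _ _) (P.+-cong (D-C u) (P.trans (D-* _ X) (P.+-cong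
           (P.trans (P.*-congʳ (P.trans (D-cong (P.sym (C-neg 1#))) (D-C (- 1#)))) (P.zeroˡ X))
               (P.trans (P.*-congˡ D-X) (P.trans (P.*-comm _ _) (P.*-identityˡ _)))))) ⟩
        [] +ₚ ([] +ₚ -ₚ C 1#) ≈⟨ P.trans (P.+-identityˡ _) (P.+-identityˡ _) ⟩
        -ₚ C 1# ∎
        where open Relation.Binary.Reasoning.Setoid P.setoid

      D-g : D g ≈ₚ C v
      D-g = P.trans (D-+ _ _) (P.trans (P.+-cong
          (P.trans (D-* (C v) X) (P.trans (P.+-cong (P.trans (P.*-congʳ (D-C v)) (P.zeroˡ X))
              (P.trans (P.*-congˡ D-X) (P.trans (P.*-comm _ _) (P.*-identityˡ _)))) (P.+-identityˡ _)))
          (P.trans (D-cong (P.sym (C-neg 1#))) (D-C (- 1#)))) (P.+-identityʳ _))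

      -- For two linear polynomials `f′ g − f g′` is a constant. Here it is `1 − u v`, and `uv≉1`
      -- makes it the nonzero constant that `Sparse` asks for.
      wronskian : D f *ₚ g ≈ₚ C (1# - u * v) +ₚ f *ₚ D g
      wronskian = begin
        D f *ₚ g ≈⟨ P.*-congʳ D-f ⟩
        -ₚ C 1# *ₚ g
            ≈⟨ solveₚ 4 (λ o u v x → (:- o) :* (v :* x :- o)
                := (o :* o :- u :* v) :+ (u :* v :- (o :* x) :* v)) P.refl (C 1#) (C u) (C v) X ⟩
        (C 1# *ₚ C 1# P.- C u *ₚ C v) +ₚ (C u *ₚ C v P.- C 1# *ₚ X *ₚ C v)
          ≈⟨ P.+-cong (P.trans (P.+-cong (P.*-identityˡ _) (P.trans (P.-‿cong (P.sym (C-* u v)))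
              (P.sym (C-neg _)))) (P.sym (C-+ _ _)))
             (P.+-congˡ (P.-‿cong (P.*-congʳ (P.*-identityˡ X)))) ⟩
        C (1# - u * v) +ₚ (C u *ₚ C v P.- X *ₚ C v)
            ≈⟨ P.+-congˡ (P.trans (solveₚ 3 (λ u v x → u :* v :- x :* v := (u :- x) :* v) P.refl _ _ _)
                (P.*-congˡ (P.sym D-g))) ⟩
        C (1# - u * v) +ₚ f *ₚ D g ∎
        where open Relation.Binary.Reasoning.Setoid P.setoid

      eval-f : ∀ x → eval f x ≈ u - x
      eval-f x = trans (eval-+ (C u) _ x) (+-cong (eval-C u x) (trans (eval-neg X x) (-‿cong (eval-X x))))

      eval-g : ∀ x → eval g x ≈ v * x - 1#
      eval-g x = trans (eval-+ (C v *ₚ X) _ x) (+-cong (trans (eval-* (C v) X x) (*-cong (eval-C v x) (eval-X x)))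
        (trans (eval-neg (C 1#) x) (-‿cong (eval-C 1# x))))

      eval-w : ∀ x → eval w x ≈ x * (eval f x * eval g x)
      eval-w x = trans (eval-* X _ x) (*-cong (eval-X x) (eval-* f g x))

      Deg≤-f : Deg≤ 1 f
      Deg≤-f = Deg≤-+ (Deg≤-mono {f = C u} z≤n (Deg≤-C u)) (Deg≤-neg {1} {X} Deg≤-X)
      Deg≤-g : Deg≤ 1 g
      Deg≤-g = Deg≤-+ (Deg≤-* {0} {1} {C v} {X} (Deg≤-C v) Deg≤-X)
          (Deg≤-neg {1} {C 1#} (Deg≤-mono {f = C 1#} z≤n (Deg≤-C 1#)))
      Deg≤-w : Deg≤ 3 w
      Deg≤-w = Deg≤-* {1} {2} {X} Deg≤-X (Deg≤-* {1} {1} {f} {g} Deg≤-f Deg≤-g)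

      L : Poly → Poly
      L h = w *ₚ D h

      L-cong : ∀ {h h′} → h ≈ₚ h′ → L h ≈ₚ L h′
      L-cong e = P.*-congˡ (D-cong e)

      iterate-L-cong : ∀ k {h h′} → h ≈ₚ h′ → iterate L k h ≈ₚ iterate L k h′
      iterate-L-cong zero e = e
      iterate-L-cong (suc k) e = iterate-L-cong k (L-cong e)

      product : ℕ → ℕ → ℕ → Poly
      product e h m = f ^ₚ e *ₚ g ^ₚ h *ₚ X ^ₚ m

      -- `w` times the logarithmic derivative of `product e h m`. It is a polynomial of degree at
      -- most 2, however large the exponents, because `w = X f g` contains each base once.
      ρ : ℕ → ℕ → ℕ → Poly
      ρ e h m = (X *ₚ g *ₚ (C (ι e) *ₚ D f) +ₚ X *ₚ f *ₚ (C (ι h) *ₚ D g)) +ₚ f *ₚ g *ₚ (C (ι m) *ₚ D X)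

      L-product : ∀ e h m → L (product e h m) ≈ₚ ρ e h m *ₚ product e h m
      L-product e h m = begin
        w *ₚ D (f ^ₚ e *ₚ g ^ₚ h *ₚ X ^ₚ m) ≈⟨ P.*-congˡ (P.trans (D-* _ _) (P.+-congʳ (P.*-congʳ (D-* _ _)))) ⟩
        w *ₚ ((D (f ^ₚ e) *ₚ g ^ₚ h +ₚ f ^ₚ e *ₚ D (g ^ₚ h)) *ₚ X ^ₚ m +ₚ f ^ₚ e *ₚ g ^ₚ h *ₚ D (X ^ₚ m))
          ≈⟨ solveₚ 9 (λ x f g X X′ F F′ G G′ → x :* (f :* g) :* ((F′ :* G :+ F :* G′) :* X :+ F :* G :* X′)
               := (x :* g :* (G :* X) :* (f :* F′) :+ x :* f :* (F :* X) :* (g :* G′)) :+ f :* g :* (F :* G) :*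
                   (x :* X′))
               P.refl X f g (X ^ₚ m) (D (X ^ₚ m)) (f ^ₚ e) (D (f ^ₚ e)) (g ^ₚ h) (D (g ^ₚ h)) ⟩
        (X *ₚ g *ₚ (g ^ₚ h *ₚ X ^ₚ m) *ₚ (f *ₚ D (f ^ₚ e)) +ₚ X *ₚ f *ₚ (f ^ₚ e *ₚ X ^ₚ m) *ₚ
            (g *ₚ D (g ^ₚ h))) +ₚ f *ₚ g *ₚ (f ^ₚ e *ₚ g ^ₚ h) *ₚ (X *ₚ D (X ^ₚ m))
          ≈⟨ P.+-cong (P.+-cong (P.*-congˡ (D-^ f e)) (P.*-congˡ (D-^ g h))) (P.*-congˡ (D-^ X m)) ⟩
        _ ≈⟨ solveₚ 12 (λ x f g X F G f′ g′ x′ e h m →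
               (x :* g :* (G :* X) :* (e :* (f′ :* F)) :+ x :* f :* (F :* X) :* (h :* (g′ :* G))) :+ f :* g :*
                   (F :* G) :* (m :* (x′ :* X))
               := ((x :* g :* (e :* f′) :+ x :* f :* (h :* g′)) :+ f :* g :* (m :* x′)) :* (F :* G :* X))
               P.refl X f g (X ^ₚ m) (f ^ₚ e) (g ^ₚ h) (D f) (D g) (D X) (C (ι e)) (C (ι h)) (C (ι m)) ⟩
        ρ e h m *ₚ product e h m ∎
        where open Relation.Binary.Reasoning.Setoid P.setoid

      Deg≤-ρ : ∀ e h m → Deg≤ 2 (ρ e h m)
      Deg≤-ρ e h m = Deg≤-+ (Deg≤-+
        (Deg≤-* {2} {0} (Deg≤-* {1} {1} {X} Deg≤-X Deg≤-g) (Deg≤-* {0} {0} {C (ι e)} (Deg≤-C _)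
            (Deg≤-D {0} {f} Deg≤-f)))
        (Deg≤-* {2} {0} (Deg≤-* {1} {1} {X} Deg≤-X Deg≤-f) (Deg≤-* {0} {0} {C (ι h)} (Deg≤-C _)
            (Deg≤-D {0} {g} Deg≤-g))))
        (Deg≤-* {2} {0} (Deg≤-* {1} {1} {f} {g} Deg≤-f Deg≤-g)
            (Deg≤-* {0} {0} {C (ι m)} (Deg≤-C _) (Deg≤-D {0} {X} Deg≤-X)))

      step : Poly → Poly → Poly
      step r q = w *ₚ D q +ₚ r *ₚ q

      -- `w` has degree 3, but differentiating `q` takes one back. A constant `q` is treated apart,
      -- since its derivative is zero and no degree is left to lower.
      Deg≤-step : ∀ {d r q} → Deg≤ 2 r → Deg≤ d q → Deg≤ (2 ℕ.+ d) (step r q)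
      Deg≤-step {zero} {r} {q} dr dq = Deg≤-+ {2} {w *ₚ D q} {r *ₚ q}
        (Deg≤-cong {2} {[]} {w *ₚ D q} (P.sym (P.trans (P.*-congˡ (D-const {q} dq)) (P.zeroʳ w))) Deg≤-[])
            (Deg≤-* {2} {0} {r} {q} dr dq)
      Deg≤-step {suc d} {r} {q} dr dq =
          Deg≤-+ {3 ℕ.+ d} {w *ₚ D q} {r *ₚ q} (Deg≤-* {3} {d} {w} {D q} Deg≤-w (Deg≤-D {d} {q} dq))
              (Deg≤-* {2} {suc d} {r} {q} dr dq)

      Deg≤-iterate : ∀ k {d r q} → Deg≤ 2 r → Deg≤ d q → Deg≤ (k ℕ.* 2 ℕ.+ d) (iterate (step r) k q)
      Deg≤-iterate zero dr dq = dq
      Deg≤-iterate (suc k) {d} {r} {q} dr dq = ≡.subst (λ e → Deg≤ e (iterate (step r) k (step r q))) (arith k d)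
        (Deg≤-iterate k {2 ℕ.+ d} {r} {step r q} dr (Deg≤-step {d} {r} {q} dr dq))
        where
        arith : ∀ k d → k ℕ.* 2 ℕ.+ (2 ℕ.+ d) ≡ suc k ℕ.* 2 ℕ.+ d
        arith = solve-∀

      L-step : ∀ c q e h m → L (C c *ₚ (q *ₚ product e h m)) ≈ₚ C c *ₚ (step (ρ e h m) q *ₚ product e h m)
      L-step c q e h m = begin
        w *ₚ D (C c *ₚ (q *ₚ t)) ≈⟨ P.*-congˡ (D-C*-* c q t) ⟩
        w *ₚ (C c *ₚ (D q *ₚ t +ₚ q *ₚ D t))
            ≈⟨ solveₚ 6 (λ w c q q′ t t′ → w :* (c :* (q′ :* t :+ q :* t′))
                := c :* (w :* q′ :* t :+ q :* (w :* t′))) P.refl _ _ _ _ _ _ ⟩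
        C c *ₚ (w *ₚ D q *ₚ t +ₚ q *ₚ L t) ≈⟨ P.*-congˡ (P.+-congˡ (P.*-congˡ (L-product e h m))) ⟩
        C c *ₚ (w *ₚ D q *ₚ t +ₚ q *ₚ (ρ e h m *ₚ t))
            ≈⟨ solveₚ 5 (λ c a q r t → c :* (a :* t :+ q :* (r :* t)) := c :* ((a :+ r :* q) :* t)) P.refl _ _ _ _ _ ⟩
        C c *ₚ (step (ρ e h m) q *ₚ t) ∎
        where
        open Relation.Binary.Reasoning.Setoid P.setoid
        t : Poly
        t = product e h m

      iterate-L-∑ : ∀ J (c : ℕ → Carrier) (e h m : ℕ → ℕ) k (q : ℕ → Poly) →
        iterate L k (∑ₚ J (λ j → C (c j) *ₚ (q j *ₚ product (e j) (h j) (m j))))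
          ≈ₚ ∑ₚ J (λ j → C (c j) *ₚ (iterate (step (ρ (e j) (h j) (m j))) k (q j) *ₚ product (e j) (h j) (m j)))
      iterate-L-∑ J c e h m zero q = P.refl
      iterate-L-∑ J c e h m (suc k) q = P.trans
        (iterate-L-cong k (P.trans (P.trans (P.*-congˡ (D-∑ J _)) (*-∑ₚ J w _))
            (∑ₚ-cong J λ j _ → L-step (c j) (q j) (e j) (h j) (m j))))
        (iterate-L-∑ J c e h m k λ j → step (ρ (e j) (h j) (m j)) (q j))

      -- The auxiliary polynomial is Φ = Σ c_j t_j with t_j = f^e g^h X^(τ⌊j/n⌋), where e = i + τk′ and e + h is constant.
      -- Where X^τ = 1 and f^τ = g^τ, each t_j agrees with s_j = f^i g^(A′−i) up to the common factor g^(τC′), so that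
      -- the vanishing of L^k Φ at all these points follows from linear conditions on the coefficients c_j.
      i k′ e h : ℕ → ℕ
      i r = r % A
      k′ r = r / A
      e r = i r ℕ.+ τ ℕ.* k′ r
      h r = (A′ ℕ.∸ i r) ℕ.+ τ ℕ.* (C′ ℕ.∸ k′ r)

      i≤A′ : ∀ r → i r ≤ A′
      i≤A′ r = ℕₚ.≤-pred (m%n<n r A)

      k′≤C′ : ∀ {r} → r < n → k′ r ≤ C′
      k′≤C′ r<n = ℕₚ.≤-pred (m<n*o⇒m/o<n r<n)

      e+h : ∀ {r} → r < n → e r ℕ.+ h r ≡ A′ ℕ.+ τ ℕ.* C′
      e+h {r} r<n = ≡.trans (arith (i r) (A′ ℕ.∸ i r) (k′ r) (C′ ℕ.∸ k′ r) τ)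
        (≡.cong₂ (λ a c → a ℕ.+ τ ℕ.* c) (ℕₚ.m+[n∸m]≡n (i≤A′ r)) (ℕₚ.m+[n∸m]≡n (k′≤C′ r<n)))
        where
        arith : ∀ a a′ c c′ t → (a ℕ.+ t ℕ.* c) ℕ.+ (a′ ℕ.+ t ℕ.* c′) ≡ (a ℕ.+ a′) ℕ.+ t ℕ.* (c ℕ.+ c′)
        arith = solve-∀

      t : ℕ → Poly
      t j = product (e (j % n)) (h (j % n)) (τ ℕ.* (j / n))
      s : ℕ → Poly
      s j = f ^ₚ i (j % n) *ₚ g ^ₚ (A′ ℕ.∸ i (j % n))
      q : ℕ → ℕ → Poly
      q k j = iterate (step (ρ (e (j % n)) (h (j % n)) (τ ℕ.* (j / n)))) k (C 1#)

      -- The equations demand that the combination of the `q k j *ₚ s j` with the unknown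
      -- coefficients be zero as a polynomial, and not merely at the given points. Their number is
      -- therefore independent of the number of points.
      row : ℕ → ℕ → ℕ → Carrier
      row k d j = coeff (q k j *ₚ s j) d

      -- Larger than the degree bound `2 k + A′` of `q k j *ₚ s j` for every `k < M`. The large
      -- exponent `τ` does not enter, and this is why the unknowns can outnumber the equations.
      width : ℕ
      width = M ℕ.* 2 ℕ.+ A

      rows : List (ℕ → Carrier)
      rows = cartesianProductWith row (upTo M) (upTo width)

      length-rows : length rows ≡ M ℕ.* width
      length-rows = ≡.trans (length-cartesianProductWith row (upTo M) (upTo width))
          (≡.cong₂ ℕ._*_ (Listₚ.length-upTo M) (Listₚ.length-upTo width))

      Deg≤-s : ∀ j → Deg≤ A′ (s j)
      Deg≤-s j = ≡.subst (λ d → Deg≤ d (s j)) (ℕₚ.m+[n∸m]≡n (i≤A′ (j % n)))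
        (Deg≤-* {i (j % n)} {A′ ℕ.∸ i (j % n)} (Deg≤-^ (i (j % n)) Deg≤-f) (Deg≤-^ (A′ ℕ.∸ i (j % n)) Deg≤-g))

      Deg≤-qs : ∀ {k} j → k < M → ∀ d → width ≤ d → row k d j ≈ 0#
      Deg≤-qs {k} j k<M d le = Deg≤-* {k ℕ.* 2 ℕ.+ 0} {A′} {q k j} {s j}
          (Deg≤-iterate k {0} {_} {C 1#} (Deg≤-ρ (e (j % n)) (h (j % n)) (τ ℕ.* (j / n))) (Deg≤-C 1#)) (Deg≤-s j) d
        (ℕₚ.<-≤-trans (≡.subst (_< width) (≡.cong (ℕ._+ A′) (≡.sym (ℕₚ.+-identityʳ (k ℕ.* 2))))
          (ℕₚ.+-mono-≤-< (ℕₚ.*-monoˡ-≤ 2 (ℕₚ.<⇒≤ k<M)) (ℕₚ.n<1+n A′))) le)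

    -- The first condition lets order `τ` at 0 force a block of `n` products to be trivial; the
    -- second gives a nontrivial solution of the linear system. The last two keep the exponents
    -- `e r` distinct in the field and make vanishing to order `M` count as multiplicity `M`.
    module _ (A*C≤τ : n ≤ τ) (unknowns : M ℕ.* width < B ℕ.* n)
        (char : ∀ k → 0 < k → k < τ ℕ.* suc C′ → ¬ ι k ≈ 0#) (M≤ : M ≤ τ ℕ.* suc C′) where

      -- The polynomial `Φ` built from a null vector has degree below the right-hand side and
      -- vanishes to order `M` at every point. Were there too many points, `Φ` would be zero, and
      -- independence of the blocks would make the null vector trivial.
      stepanov : ∀ xs → AllPairs (λ x y → ¬ x ≈ y) xs →
        All (λ x → x ^ τ ≈ 1# × (u - x) ^ τ ≈ (v * x - 1#) ^ τ × ¬ x ≈ 0# × ¬ u - x ≈ 0# × ¬ v * x - 1# ≈ 0#) xs →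
        length xs ℕ.* M < τ ℕ.* suc C′ ℕ.+ τ ℕ.* B
      stepanov xs distinct hyps with nullVector (B ℕ.* n) rows (≡.subst (_< B ℕ.* n) (≡.sym length-rows) unknowns)
      ... | c , (j₀ , j₀<J , cj₀≉0) , null = ℕₚ.≰⇒> λ long → cj₀≉0
          (blocks-independent τ n (λ r → f ^ₚ e r *ₚ g ^ₚ h r) independent B c (P-zero long) j₀ j₀<J)
        where
        J = B ℕ.* n
        bound = τ ℕ.* suc C′ ℕ.+ τ ℕ.* B
        Φ : Poly
        Φ = ∑ₚ J (λ j → C (c j) *ₚ t j)

        A≤τ : A ≤ τ
        A≤τ = ℕₚ.≤-trans (ℕₚ.m≤m+n A (C′ ℕ.* A)) A*C≤τ

        N<τC : A′ ℕ.+ τ ℕ.* C′ < τ ℕ.* suc C′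
        N<τC = ≡.subst (A′ ℕ.+ τ ℕ.* C′ <_) (≡.sym (ℕₚ.*-suc τ C′)) (ℕₚ.+-monoˡ-< (τ ℕ.* C′) A≤τ)

        -- Since `i r < A ≤ τ`, the pair `i r`, `k′ r` consists of the remainder and the quotient of
        -- `e r` by `τ`; it is also that of `r` by `A`.
        e-injective : ∀ {r r′} → e r ≡ e r′ → r ≡ r′
        e-injective {r} {r′} eq =
            ≡.trans (m≡m%n+[m/n]*n r A) (≡.trans (≡.cong₂ (λ a b → a ℕ.+ b ℕ.* A) i≡ k≡) (≡.sym (m≡m%n+[m/n]*n r′ A)))
          where
          instance
            τ≢0 : NonZero τ
            τ≢0 = ℕ.>-nonZero (ℕₚ.≤-trans (s≤s z≤n) A≤τ)
          e≡ : ∀ r → e r ≡ i r ℕ.+ k′ r ℕ.* τ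
          e≡ r = ≡.cong (i r ℕ.+_) (ℕₚ.*-comm τ (k′ r))
          i<τ : ∀ r → i r < τ
          i<τ r = ℕₚ.<-≤-trans (m%n<n r A) A≤τ
          e%τ : ∀ r → e r % τ ≡ i r
          e%τ r = ≡.trans (≡.cong (_% τ) (e≡ r)) (≡.trans ([m+kn]%n≡m%n (i r) (k′ r) τ) (m<n⇒m%n≡m (i<τ r)))
          e/τ : ∀ r → e r / τ ≡ k′ r
          e/τ r = ≡.trans (≡.cong (_/ τ) (e≡ r)) (≡.trans (+-distrib-/-∣ʳ (i r) {k′ r ℕ.* τ} {τ} (n∣m*n (k′ r)))
            (≡.cong₂ ℕ._+_ (m<n⇒m/n≡0 (i<τ r)) (m*n/n≡m (k′ r) τ)))
          i≡ : i r ≡ i r′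
          i≡ = ≡.trans (≡.sym (e%τ r)) (≡.trans (≡.cong (_% τ) eq) (e%τ r′))
          k≡ : k′ r ≡ k′ r′
          k≡ = ≡.trans (≡.sym (e/τ r)) (≡.trans (≡.cong (_/ τ) eq) (e/τ r′))

        ι-injective : ∀ {a b} → a < b → b < τ ℕ.* suc C′ → ¬ ι a ≈ ι b
        ι-injective {a} {b} a<b b< eq = char (b ℕ.∸ a) (ℕₚ.m<n⇒0<n∸m a<b) (ℕₚ.≤-<-trans (ℕₚ.m∸n≤m b a) b<)
          (+-cancelˡ (ι a) _ _ (trans (sym (×-homo-+ 1# a (b ℕ.∸ a)))
              (trans (reflexive (≡.cong ι (ℕₚ.m+[n∸m]≡n (ℕₚ.<⇒≤ a<b)))) (trans (sym eq) (sym (+-identityʳ _))))))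
          where
          open Algebra.Properties.Semiring.Mult semiring using (×-homo-+)
          open Algebra.Properties.Ring ring using (+-cancelˡ)

        e-distinct : ∀ {r r′} → r < r′ → r′ < n → ¬ ι (e r) ≈ ι (e r′)
        e-distinct {r} {r′} r<r′ r′<n eq with ℕₚ.<-cmp (e r) (e r′)
        ... | tri< lt _ _ = ι-injective lt (e< r′<n) eq
          where
          e< : ∀ {r} → r < n → e r < τ ℕ.* suc C′
          e< {r} r<n = ℕₚ.≤-<-trans (≡.subst (e r ≤_) (e+h r<n) (ℕₚ.m≤m+n _ _)) N<τC
        ... | tri≈ _ er≡ _ = ℕₚ.<⇒≢ r<r′ (e-injective er≡)
        ... | tri> _ _ gt = ι-injective gt (ℕₚ.≤-<-trans (≡.subst (e r ≤_) (e+h (ℕₚ.<-trans r<r′ r′<n))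
            (ℕₚ.m≤m+n _ _)) N<τC) (sym eq)

        -- `sparse` is applied at the point 0, where `f` and `g` take the values `u` and `−1`; this
        -- is the purpose of `u≉0`.
        independent : ∀ c → Ord τ 0# (∑ₚ n (λ r → C (c r) *ₚ (f ^ₚ e r *ₚ g ^ₚ h r))) → ∀ r → r < n → c r ≈ 0#
        independent c o = Sparse.sparse f g (1# - u * v) wronskian (λ eq → uv≉1 (sym (x∙y⁻¹≈ε⇒x≈y _ _ eq))) 0#
          (λ eq → u≉0 (trans (sym (trans (eval-f 0#) (trans (+-congˡ -0#≈0#) (+-identityʳ u)))) eq))
          (λ eq → 1≉0 (-‿injective (trans (trans (sym (trans (eval-g 0#)
              (trans (+-congʳ (zeroʳ v)) (+-identityˡ _)))) eq) (sym -0#≈0#))))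
          (A′ ℕ.+ τ ℕ.* C′) e h n e+h e-distinct c (Ord-≤ A*C≤τ o)
          where open Algebra.Properties.Ring ring using (x∙y⁻¹≈ε⇒x≈y; -0#≈0#; -‿injective)

        conditions : ∀ k → k < M → ∑ₚ J (λ j → C (c j) *ₚ (q k j *ₚ s j)) ≈ₚ []
        conditions k k<M = coeffwise λ d → trans (coeff-∑ J _ d)
            (trans (∑-cong J λ j _ → trans (coeff-C* (c j) _ d) (*-comm _ _)) (rowZero d))
          where
          rowZero : ∀ d → ∑ J (λ j → row k d j * c j) ≈ 0#
          rowZero d with d ℕ.<? width
          ... | yes d<width = null (∈-cartesianProductWith⁺ row (∈-upTo⁺ k<M) (∈-upTo⁺ d<width))
          ... | no d≮width = ∑-zero J λ j _ → trans (*-congʳ (Deg≤-qs j k<M d (ℕₚ.≮⇒≥ d≮width))) (zeroˡ _)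

        vanishing : ∀ {x} → x ^ τ ≈ 1# × (u - x) ^ τ ≈ (v * x - 1#) ^ τ × ¬ x ≈ 0# × ¬ u - x ≈ 0# × ¬ v * x - 1# ≈ 0# → Ord M x Φ
        vanishing {x} (xτ , fg , x≉0 , fx≉0 , gx≉0) = Ord-iterate M w Φ
          (λ eq → *-nonzero x≉0 (*-nonzero (λ z → fx≉0 (trans (sym (eval-f x)) z))
              (λ z → gx≉0 (trans (sym (eval-g x)) z))) (trans (sym (eval-w x)) eq))
          λ k k<M → begin
            eval (iterate L k Φ) x
                ≈⟨ eval-cong x (iterate-L-cong k (∑ₚ-cong J λ j _ → P.*-congˡ (P.*-identityˡ (t j)))) ⟨
            eval (iterate L k (∑ₚ J (λ j → C (c j) *ₚ (C 1# *ₚ t j)))) x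
              ≈⟨ eval-cong x (iterate-L-∑ J c (λ j → e (j % n)) (λ j → h (j % n)) (λ j → τ ℕ.* (j / n)) k
                  (λ _ → C 1#)) ⟩
            eval (∑ₚ J (λ j → C (c j) *ₚ (q k j *ₚ t j))) x ≈⟨ eval-∑ J _ x ⟩
            ∑ J (λ j → eval (C (c j) *ₚ (q k j *ₚ t j)) x) ≈⟨ ∑-cong J (λ j j<J → pointwise k j) ⟩
            ∑ J (λ j → G * eval (C (c j) *ₚ (q k j *ₚ s j)) x) ≈⟨ *-∑ J G _ ⟨
            G * ∑ J (λ j → eval (C (c j) *ₚ (q k j *ₚ s j)) x) ≈⟨ *-congˡ (eval-∑ J _ x) ⟨
            G * eval (∑ₚ J (λ j → C (c j) *ₚ (q k j *ₚ s j))) x ≈⟨ *-congˡ (eval-cong x (conditions k k<M)) ⟩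
            G * 0# ≈⟨ zeroʳ G ⟩
            0# ∎
          where
          open Relation.Binary.Reasoning.Setoid setoid
          module KS = RingSolver commutativeRing
          fx gx G : Carrier
          fx = eval f x
          gx = eval g x
          G = (gx ^ τ) ^ C′
          fxτ : fx ^ τ ≈ gx ^ τ
          fxτ = trans (^-congˡ τ (eval-f x)) (trans fg (^-congˡ τ (sym (eval-g x))))
          split : ∀ y a k → y ^ (a ℕ.+ τ ℕ.* k) ≈ y ^ a * (y ^ τ) ^ k
          split y a k = trans (^-homo-* y a (τ ℕ.* k)) (*-congˡ (sym (^-assocʳ y τ k)))
          eval-t : ∀ j → eval (t j) x ≈ G * eval (s j) x
          eval-t j = begin
            eval (t j) x ≈⟨ trans (eval-* _ (X ^ₚ (τ ℕ.* (j / n))) x) (*-congʳ (eval-* (f ^ₚ e r) (g ^ₚ h r) x)) ⟩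
            eval (f ^ₚ e r) x * eval (g ^ₚ h r) x * eval (X ^ₚ (τ ℕ.* (j / n))) x
              ≈⟨ *-cong (*-cong (trans (eval-^ f (e r) x) (trans (split fx (i r) (k′ r))
                  (*-congˡ (^-congˡ (k′ r) fxτ))))
                   (trans (eval-^ g (h r) x) (split gx (A′ ℕ.∸ i r) (C′ ℕ.∸ k′ r))))
                 (trans (eval-^ X (τ ℕ.* (j / n)) x) (trans (^-congˡ (τ ℕ.* (j / n)) (eval-X x))
                     (trans (sym (^-assocʳ x τ (j / n))) (trans (^-congˡ (j / n) xτ) (1^ (j / n)))))) ⟩
            (fx ^ i r * (gx ^ τ) ^ k′ r) * (gx ^ (A′ ℕ.∸ i r) * (gx ^ τ) ^ (C′ ℕ.∸ k′ r)) * 1#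
              ≈⟨ *-identityʳ _ ⟩
            (fx ^ i r * (gx ^ τ) ^ k′ r) * (gx ^ (A′ ℕ.∸ i r) * (gx ^ τ) ^ (C′ ℕ.∸ k′ r))
              ≈⟨ KS.solve 4 (λ a b c d → (a KS.:* b) KS.:* (c KS.:* d) KS.:= (b KS.:* d) KS.:*
                  (a KS.:* c)) refl _ _ _ _ ⟩
            (gx ^ τ) ^ k′ r * (gx ^ τ) ^ (C′ ℕ.∸ k′ r) * (fx ^ i r * gx ^ (A′ ℕ.∸ i r))
              ≈⟨ *-cong (trans (sym (^-homo-* (gx ^ τ) (k′ r) _))
                  (reflexive (≡.cong ((gx ^ τ) ^_) (ℕₚ.m+[n∸m]≡n (k′≤C′ (m%n<n j n))))))
                   (sym (trans (eval-* (f ^ₚ i r) _ x) (*-cong (eval-^ f (i r) x) (eval-^ g (A′ ℕ.∸ i r) x)))) ⟩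
            G * eval (s j) x ∎
            where
            r : ℕ
            r = j % n
          pointwise : ∀ k j → eval (C (c j) *ₚ (q k j *ₚ t j)) x ≈ G * eval (C (c j) *ₚ (q k j *ₚ s j)) x
          pointwise k j = begin
            eval (C (c j) *ₚ (q k j *ₚ t j)) x
                ≈⟨ trans (eval-* (C (c j)) _ x) (*-congˡ (trans (eval-* (q k j) (t j) x) (*-congˡ (eval-t j)))) ⟩
            eval (C (c j)) x * (eval (q k j) x * (G * eval (s j) x))
              ≈⟨ KS.solve 4 (λ c q G s → c KS.:* (q KS.:* (G KS.:* s)) KS.:= G KS.:*
                  (c KS.:* (q KS.:* s))) refl _ _ _ _ ⟩
            G * (eval (C (c j)) x * (eval (q k j) x * eval (s j) x))
              ≈⟨ *-congˡ (trans (eval-* (C (c j)) _ x) (*-congˡ (eval-* (q k j) (s j) x))) ⟨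
            G * eval (C (c j) *ₚ (q k j *ₚ s j)) x ∎

        Deg≤-Φ : ∀ d → bound ≤ d → coeff Φ d ≈ 0#
        Deg≤-Φ d le = Deg≤-∑ {A′ ℕ.+ τ ℕ.* C′ ℕ.+ τ ℕ.* B} J _ one d
          (ℕₚ.<-≤-trans (ℕₚ.+-monoˡ-< (τ ℕ.* B) N<τC) le)
          where
          one : ∀ j → j < J → Deg≤ (A′ ℕ.+ τ ℕ.* C′ ℕ.+ τ ℕ.* B) (C (c j) *ₚ t j)
          one j j<J = Deg≤-* {0} {_} {C (c j)} {t j} (Deg≤-C (c j))
            (Deg≤-mono {f = t j} (ℕₚ.+-mono-≤ (ℕₚ.≤-reflexive (e+h (m%n<n j n)))
                (ℕₚ.*-monoʳ-≤ τ (ℕₚ.<⇒≤ (m<n*o⇒m/o<n j<J))))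
              (Deg≤-* {e (j % n) ℕ.+ h (j % n)} {τ ℕ.* (j / n)}
                  (Deg≤-* {e (j % n)} {h (j % n)} (Deg≤-^ (e (j % n)) Deg≤-f) (Deg≤-^ (h (j % n)) Deg≤-g))
                      (Deg≤-^ (τ ℕ.* (j / n)) Deg≤-X)))

        P-zero : bound ≤ length xs ℕ.* M → Φ ≈ₚ []
        P-zero long = P.trans (P.sym taken) (rootBound M (λ k 0<k k<M →
            char k 0<k (ℕₚ.<-≤-trans k<M M≤)) xs distinct (take bound Φ)
          (All.map (λ hyp → Ord-cong M (P.sym taken) (vanishing hyp)) hyps)
          (ℕₚ.≤-trans (≡.subst (_≤ bound) (≡.sym (Listₚ.length-take bound Φ)) (ℕₚ.m⊓n≤m bound _)) long))
          where
          taken : take bound Φ ≈ₚ Φ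
          taken = take-≈ bound Φ Deg≤-Φ

-- Counting by sums of indicators over lists.

𝟙 : ∀ {ℓ} {P : Set ℓ} → Dec P → ℕ
𝟙 (yes _) = 1
𝟙 (no _) = 0

𝟙-false : ∀ {ℓ} {P : Set ℓ} (d : Dec P) → ¬ P → 𝟙 d ≡ 0
𝟙-false (yes x) ¬x = contradiction x ¬x
𝟙-false (no _) _ = ≡.refl

𝟙-true : ∀ {ℓ} {P : Set ℓ} (d : Dec P) → P → 𝟙 d ≡ 1
𝟙-true (yes _) _ = ≡.refl
𝟙-true (no ¬x) x = contradiction x ¬x

𝟙-≤ : ∀ {ℓ} {P : Set ℓ} (d : Dec P) {n} → (P → 1 ≤ n) → 𝟙 d ≤ n
𝟙-≤ (yes x) f = f x
𝟙-≤ (no _) f = z≤n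

𝟙-mono : ∀ {ℓ ℓ′} {P : Set ℓ} {Q : Set ℓ′} (d : Dec P) (d′ : Dec Q) → (P → Q) → 𝟙 d ≤ 𝟙 d′
𝟙-mono d d′ f = 𝟙-≤ d λ x → ℕₚ.≤-reflexive (≡.sym (𝟙-true d′ (f x)))

module ListSums {A : Set} where
  open import Data.Nat using (_+_; _*_)

  infix 5 ∑ₗ
  ∑ₗ : List A → (A → ℕ) → ℕ
  ∑ₗ xs f = sum (map f xs)

  ∑ₗ-mono : ∀ xs {f g} → (∀ {x} → x ∈ xs → f x ≤ g x) → ∑ₗ xs f ≤ ∑ₗ xs g
  ∑ₗ-mono [] h = z≤n
  ∑ₗ-mono (x ∷ xs) h = ℕₚ.+-mono-≤ (h (here ≡.refl)) (∑ₗ-mono xs λ x∈ → h (there x∈))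

  ∑ₗ-const : ∀ xs c → ∑ₗ xs (λ _ → c) ≡ length xs * c
  ∑ₗ-const [] c = ≡.refl
  ∑ₗ-const (x ∷ xs) c = ≡.cong (c +_) (∑ₗ-const xs c)

  ∑ₗ-≤ : ∀ xs {f} c → (∀ {x} → x ∈ xs → f x ≤ c) → ∑ₗ xs f ≤ length xs * c
  ∑ₗ-≤ xs {f} c h = ≡.subst (∑ₗ xs f ≤_) (∑ₗ-const xs c) (∑ₗ-mono xs h)

  ∑ₗ-cong : ∀ xs {f g} → (∀ x → f x ≡ g x) → ∑ₗ xs f ≡ ∑ₗ xs g
  ∑ₗ-cong xs h = ≡.cong sum (Listₚ.map-cong h xs)

  ∑ₗ-zero : ∀ xs {f} → (∀ {x} → x ∈ xs → f x ≡ 0) → ∑ₗ xs f ≡ 0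
  ∑ₗ-zero [] h = ≡.refl
  ∑ₗ-zero (x ∷ xs) h = ≡.cong₂ _+_ (h (here ≡.refl)) (∑ₗ-zero xs λ x∈ → h (there x∈))

  ∑ₗ-+ : ∀ xs f g → ∑ₗ xs (λ x → f x + g x) ≡ ∑ₗ xs f + ∑ₗ xs g
  ∑ₗ-+ [] f g = ≡.refl
  ∑ₗ-+ (x ∷ xs) f g = ≡.trans (≡.cong (f x + g x +_) (∑ₗ-+ xs f g)) (arith (f x) (g x) _ _)
    where arith : ∀ a b c d → a + b + (c + d) ≡ a + c + (b + d)
          arith = solve-∀

  ∑ₗ-* : ∀ xs c f → ∑ₗ xs (λ x → c * f x) ≡ c * ∑ₗ xs f
  ∑ₗ-* [] c f = ≡.sym (ℕₚ.*-zeroʳ c)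
  ∑ₗ-* (x ∷ xs) c f = ≡.trans (≡.cong (c * f x +_) (∑ₗ-* xs c f)) (≡.sym (ℕₚ.*-distribˡ-+ c (f x) _))

  ∑ₗ-filter : ∀ xs {ℓ} {P : A → Set ℓ} (P? : ∀ x → Dec (P x)) → ∑ₗ xs (λ x → 𝟙 (P? x)) ≡ length (filter P? xs)
  ∑ₗ-filter [] P? = ≡.refl
  ∑ₗ-filter (x ∷ xs) P? with P? x
  ... | yes _ = ≡.cong suc (∑ₗ-filter xs P?)
  ... | no _ = ∑ₗ-filter xs P?

  ∑ₗ-unique : ∀ {xs} → Unique xs → ∀ {ℓ} {P : A → Set ℓ} (P? : ∀ x → Dec (P x)) →
    (∀ {x y} → x ∈ xs → y ∈ xs → P x → P y → x ≡ y) → ∑ₗ xs (λ x → 𝟙 (P? x)) ≤ 1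
  ∑ₗ-unique [] P? atMostOne = z≤n
  ∑ₗ-unique {x ∷ xs} (x≢ ∷ unique) P? atMostOne with P? x
  ... | no _ = ∑ₗ-unique unique P? λ x∈ y∈ → atMostOne (there x∈) (there y∈)
  ... | yes Px = s≤s (ℕₚ.≤-reflexive (∑ₗ-zero xs λ y∈ →
      𝟙-false (P? _) λ Py → All.lookup x≢ y∈ (atMostOne (here ≡.refl) (there y∈) Px Py)))

  module Triple (xs : List A) where
    ∑³ : (A → A → A → ℕ) → ℕ
    ∑³ f = ∑ₗ xs λ x → ∑ₗ xs λ y → ∑ₗ xs λ z → f x y z

    ∑³-mono : ∀ {f g} → (∀ x y z → f x y z ≤ g x y z) → ∑³ f ≤ ∑³ g
    ∑³-mono h = ∑ₗ-mono xs λ _ → ∑ₗ-mono xs λ _ → ∑ₗ-mono xs λ _ → h _ _ _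

    ∑³-+ : ∀ f g → ∑³ (λ x y z → f x y z + g x y z) ≡ ∑³ f + ∑³ g
    ∑³-+ f g = ≡.trans (∑ₗ-cong xs λ x → ≡.trans (∑ₗ-cong xs λ y → ∑ₗ-+ xs (f x y) (g x y)) (∑ₗ-+ xs _ _)) (∑ₗ-+ xs _ _)

    ∑³-* : ∀ c f → ∑³ (λ x y z → c * f x y z) ≡ c * ∑³ f
    ∑³-* c f = ≡.trans (∑ₗ-cong xs λ x → ≡.trans (∑ₗ-cong xs λ y → ∑ₗ-* xs c (f x y)) (∑ₗ-* xs c _)) (∑ₗ-* xs c _)

open ListSums

-- Representations as sums of two and of three elements of a group of norm one.

module _ (F : Field) where
  open Field F

  -- γ enumerates a group of order τ of norm-one elements, and σ plays the role of conjugation.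
  module TripleEnergy (τ : ℕ) (indices : List ℕ) (unique : Unique indices) (card : length indices ≡ τ)
      (γ : ℕ → Carrier) (γ-injective : ∀ {i j} → i ∈ indices → j ∈ indices → γ i ≈ γ j → i ≡ j)
      (γ^τ : ∀ i → γ i ^ τ ≈ 1#)
      (σ : Carrier → Carrier) (σ-cong : ∀ {x y} → x ≈ y → σ x ≈ σ y) (σ-+ : ∀ x y → σ (x + y) ≈ σ x + σ y)
      (σγγ≈1 : ∀ i → σ (γ i) * γ i ≈ 1#) (1≤τ : 1 ≤ τ) where
    open RingSolver commutativeRing
    open Relation.Binary.Reasoning.Setoid setoid using (begin_; step-≈-⟩; step-≈-⟨; _∎)
    open Algebra.Properties.Ring ring using (x∙y⁻¹≈ε⇒x≈y; -0#≈0#; +-cancelˡ)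
    open Algebra.Properties.Semiring.Exp semiring using (^-congˡ)
    open Algebra.Properties.CommutativeSemiring.Exp commutativeSemiring using (^-distrib-*)

    private
      x-y≈0⇒x≈y : ∀ x y → x - y ≈ 0# → x ≈ y
      x-y≈0⇒x≈y = x∙y⁻¹≈ε⇒x≈y

      γ≉0 : ∀ i → ¬ γ i ≈ 0#
      γ≉0 i e = 1≉0 (trans (sym (σγγ≈1 i)) (trans (*-congˡ e) (zeroʳ _)))

      ∑-γ : ∀ {f : ℕ → ℕ} c → (∀ {i} → i ∈ indices → f i ≤ c) → ∑ₗ indices f ≤ τ ℕ.* c
      ∑-γ {f} c h = ≡.subst (λ k → ∑ₗ indices f ≤ k ℕ.* c) card (∑ₗ-≤ indices c h)

      atMostOne : ∀ {ℓ} {P : ℕ → Set ℓ} (P? : ∀ i → Dec (P i)) (x : Carrier) → (∀ {i} → P i → γ i ≈ x) →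
          ∑ₗ indices (λ i → 𝟙 (P? i)) ≤ 1
      atMostOne P? x P⇒ = ∑ₗ-unique unique P? λ i∈ j∈ Pi Pj → γ-injective i∈ j∈ (trans (P⇒ Pi) (sym (P⇒ Pj)))

      +-solve : ∀ {x y z} → x ≈ y + z → z ≈ x - y
      +-solve {x} {y} {z} e = trans (solve 2 (λ y z → z := (y :+ z) :- y) refl y z) (+-congʳ (sym e))

    pairs : Carrier → ℕ
    pairs s = ∑ₗ indices λ b → ∑ₗ indices λ c → 𝟙 (s ≈? γ b + γ c)

    triples : Carrier → ℕ
    triples u = ∑ₗ indices λ a → ∑ₗ indices λ b → ∑ₗ indices λ c → 𝟙 (u ≈? γ a + (γ b + γ c))

    triples≤pairs : ∀ u → triples u ≤ ∑ₗ indices (λ a → pairs (u - γ a))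
    triples≤pairs u = ∑ₗ-mono indices λ {a} _ → ∑ₗ-mono indices λ {b} _ → ∑ₗ-mono indices λ {c} _ →
      𝟙-mono (u ≈? _) (u - γ a ≈? _) λ e → sym (+-solve e)

    pairs≤τ : ∀ s → pairs s ≤ τ
    pairs≤τ s = ≡.subst (pairs s ≤_) (ℕₚ.*-identityʳ τ) (∑-γ 1 λ {b} _ →
        atMostOne (λ c → s ≈? γ b + γ c) (s - γ b) λ e → +-solve e)

    -- x + y determines xy, since σ (x + y) = (x + y) / xy.
    product-σ : ∀ {s b c} → s ≈ γ b + γ c → γ b * γ c * σ s ≈ s
    product-σ {s} {b} {c} e = begin
      γ b * γ c * σ s ≈⟨ *-congˡ (trans (σ-cong e) (σ-+ _ _)) ⟩
      γ b * γ c * (σ (γ b) + σ (γ c))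
          ≈⟨ solve 4 (λ b c b′ c′ → b :* c :* (b′ :+ c′) := (b′ :* b) :* c :+ (c′ :* c) :* b) refl _ _ _ _ ⟩
      σ (γ b) * γ b * γ c + σ (γ c) * γ c * γ b
          ≈⟨ +-cong (trans (*-congʳ (σγγ≈1 b)) (*-identityˡ _)) (trans (*-congʳ (σγγ≈1 c)) (*-identityˡ _)) ⟩
      γ c + γ b ≈⟨ trans (+-comm _ _) (sym e) ⟩
      s ∎

    private
      -- `σ` is only known to be additive and to invert the `γ i`, so this is drawn from
      -- `product-σ`, which exhibits `s` as a multiple of `σ s`.
      σ≉0 : ∀ {s b c} → s ≈ γ b + γ c → ¬ s ≈ 0# → ¬ σ s ≈ 0#
      σ≉0 e s≉0 σs≈0 = s≉0 (trans (sym (product-σ e)) (trans (*-congˡ σs≈0) (zeroʳ _)))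

    -- Both pairs have the sum `s` and, after division by the nonzero `σ s` in `product-σ`, the same
    -- product. So `γ b` is a root of `(T − γ b₀)(T − γ c₀)`.
    pairs-determined : ∀ {s} → ¬ s ≈ 0# → ∀ {b c b₀ c₀} → s ≈ γ b₀ + γ c₀ → s ≈ γ b + γ c →
      (γ b ≈ γ b₀ × γ c ≈ γ c₀) ⊎ (γ b ≈ γ c₀ × γ c ≈ γ b₀)
    pairs-determined {s} s≉0 {b} {c} {b₀} {c₀} e₀ e with γ b ≈? γ b₀
    ... | yes b≈b₀ = inj₁ (b≈b₀ , +-cancelˡ (γ b) _ _ (trans (sym e) (trans e₀ (+-congʳ (sym b≈b₀)))))
    ... | no b≉b₀ = inj₂ (b≈c₀ , +-cancelˡ (γ b) _ _ (trans (sym e)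
        (trans e₀ (trans (+-comm _ _) (+-congʳ (sym b≈c₀))))))
      where
      same-product : γ b * γ c ≈ γ b₀ * γ c₀
      same-product = x-y≈0⇒x≈y _ _ (*-cancelˡ-0 (σ≉0 e₀ s≉0) (begin
        σ s * (γ b * γ c - γ b₀ * γ c₀) ≈⟨ solve 3 (λ s x y → s :* (x :- y) := x :* s :- y :* s) refl _ _ _ ⟩
        γ b * γ c * σ s - γ b₀ * γ c₀ * σ s ≈⟨ +-cong (product-σ e) (-‿cong (product-σ e₀)) ⟩
        s - s ≈⟨ -‿inverseʳ s ⟩
        0# ∎))
      b≈c₀ : γ b ≈ γ c₀
      b≈c₀ = x-y≈0⇒x≈y _ _ (*-cancelˡ-0 (λ z → b≉b₀ (x-y≈0⇒x≈y _ _ z)) (begin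
        (γ b - γ b₀) * (γ b - γ c₀)
            ≈⟨ solve 3 (λ b b₀ c₀ → (b :- b₀) :* (b :- c₀) := b :* b :- b :* (b₀ :+ c₀) :+ b₀ :* c₀) refl _ _ _ ⟩
        γ b * γ b - γ b * (γ b₀ + γ c₀) + γ b₀ * γ c₀
            ≈⟨ +-cong (+-congˡ (-‿cong (*-congˡ (trans (sym e₀) e)))) (sym same-product) ⟩
        γ b * γ b - γ b * (γ b + γ c) + γ b * γ c
            ≈⟨ solve 2 (λ b c → b :* b :- b :* (b :+ c) :+ b :* c := b :- b) refl _ _ ⟩
        γ b - γ b ≈⟨ -‿inverseʳ _ ⟩
        0# ∎))

    private
      solvable? : ∀ s → Dec (Any (λ b → Any (λ c → s ≈ γ b + γ c) indices) indices)
      solvable? s = Any.any? (λ b → Any.any? (λ c → s ≈? γ b + γ c) indices) indices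

      pairs-insoluble : ∀ {s} → (∀ {b c} → b ∈ indices → c ∈ indices → ¬ s ≈ γ b + γ c) → pairs s ≡ 0
      pairs-insoluble {s} none = ∑ₗ-zero indices λ b∈ → ∑ₗ-zero indices λ c∈ → 𝟙-false (s ≈? _) (none b∈ c∈)

      single : ∀ b₀ c₀ → ∑ₗ indices (λ b → ∑ₗ indices λ c → 𝟙 (b ℕ.≟ b₀) ℕ.* 𝟙 (c ℕ.≟ c₀)) ≤ 1
      single b₀ c₀ = ℕₚ.≤-trans (∑ₗ-mono indices λ {b} _ →
          ℕₚ.≤-trans (ℕₚ.≤-reflexive (∑ₗ-* indices (𝟙 (b ℕ.≟ b₀)) _))
            (≡.subst (𝟙 (b ℕ.≟ b₀) ℕ.* _ ≤_) (ℕₚ.*-identityʳ _) (ℕₚ.*-monoʳ-≤ (𝟙 (b ℕ.≟ b₀)) (once c₀)))) (once b₀)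
        where
        once : ∀ k → ∑ₗ indices (λ i → 𝟙 (i ℕ.≟ k)) ≤ 1
        once k = ∑ₗ-unique unique (λ i → i ℕ.≟ k) λ _ _ e e′ → ≡.trans e (≡.sym e′)

    -- If there is a representation, one is fixed. Every indicator is then dominated by the sum of
    -- two point indicators, one for this pair and one for its swap.
    pairs≤2 : ∀ {s} → ¬ s ≈ 0# → pairs s ≤ 2
    pairs≤2 {s} s≉0 with solvable? s
    ... | no none = ℕₚ.≤-trans (ℕₚ.≤-reflexive (pairs-insoluble λ b∈ c∈ e →
        none (Any.map (λ { ≡.refl → Any.map (λ { ≡.refl → e }) c∈ }) b∈))) z≤n
    ... | yes some with find some
    ...   | b₀ , b₀∈ , some′ with find some′
    ...     | c₀ , c₀∈ , e₀ = ℕₚ.≤-trans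
        (∑ₗ-mono indices λ {b} b∈ → ∑ₗ-mono indices λ {c} c∈ → 𝟙-≤ (s ≈? γ b + γ c) λ e →
            cover b∈ c∈ (pairs-determined s≉0 e₀ e))
        (≡.subst (_≤ 2) (≡.sym sum-split) (ℕₚ.+-mono-≤ (single b₀ c₀) (single c₀ b₀)))
      where
      δ : ℕ → ℕ → ℕ → ℕ → ℕ
      δ b₀ c₀ b c = 𝟙 (b ℕ.≟ b₀) ℕ.* 𝟙 (c ℕ.≟ c₀)
      δ-diagonal : ∀ b c → δ b c b c ≡ 1
      δ-diagonal b c = ≡.cong₂ ℕ._*_ (𝟙-true (b ℕ.≟ b) ≡.refl) (𝟙-true (c ℕ.≟ c) ≡.refl)
      cover : ∀ {b c} → b ∈ indices → c ∈ indices → (γ b ≈ γ b₀ × γ c ≈ γ c₀) ⊎ (γ b ≈ γ c₀ × γ c ≈ γ b₀) →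
        1 ≤ δ b₀ c₀ b c ℕ.+ δ c₀ b₀ b c
      cover {b} {c} b∈ c∈ (inj₁ (e , e′)) with γ-injective b∈ b₀∈ e | γ-injective c∈ c₀∈ e′
      ... | ≡.refl | ≡.refl = ℕₚ.≤-trans (ℕₚ.≤-reflexive (≡.sym (δ-diagonal b c))) (ℕₚ.m≤m+n _ _)
      cover {b} {c} b∈ c∈ (inj₂ (e , e′)) with γ-injective b∈ c₀∈ e | γ-injective c∈ b₀∈ e′
      ... | ≡.refl | ≡.refl = ℕₚ.≤-trans (ℕₚ.≤-reflexive (≡.sym (δ-diagonal b c))) (ℕₚ.m≤n+m _ _)
      sum-split : ∑ₗ indices (λ b → ∑ₗ indices λ c → δ b₀ c₀ b c ℕ.+ δ c₀ b₀ b c)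
        ≡ ∑ₗ indices (λ b → ∑ₗ indices (δ b₀ c₀ b)) ℕ.+ ∑ₗ indices (λ b → ∑ₗ indices (δ c₀ b₀ b))
      sum-split = ≡.trans (∑ₗ-cong indices λ b → ∑ₗ-+ indices (δ b₀ c₀ b) (δ c₀ b₀ b)) (∑ₗ-+ indices _ _)

    -- Each first element leaves at most two pairs, except the one with `γ a = u`, if it exists:
    -- there the remaining sum is zero and only the trivial bound `τ` is available. This gives
    -- `2 τ + τ`.
    triples≤3τ : ∀ u → triples u ≤ 3 ℕ.* τ
    triples≤3τ u = ℕₚ.≤-trans (triples≤pairs u) (ℕₚ.≤-trans (∑ₗ-mono indices bound)
      (≡.subst (_≤ 3 ℕ.* τ) (≡.sym (∑ₗ-+ indices (λ _ → 2) _))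
        (ℕₚ.≤-trans (ℕₚ.+-mono-≤ (∑-γ 2 λ _ → ℕₚ.≤-refl) (≡.subst (_≤ τ) (≡.sym (∑ₗ-* indices τ _))
          (≡.subst (τ ℕ.* _ ≤_) (ℕₚ.*-identityʳ τ) (ℕₚ.*-monoʳ-≤ τ (atMostOne (λ a → u ≈? γ a) u sym)))))
              (ℕₚ.≤-reflexive (arith τ)))))
      where
      arith : ∀ t → t ℕ.* 2 ℕ.+ t ≡ 3 ℕ.* t
      arith = solve-∀
      bound : ∀ {a} → a ∈ indices → pairs (u - γ a) ≤ 2 ℕ.+ τ ℕ.* 𝟙 (u ≈? γ a)
      bound {a} _ with u ≈? γ a
      ... | yes _ = ℕₚ.≤-trans (pairs≤τ _) (≡.subst (λ k → τ ≤ 2 ℕ.+ k) (≡.sym (ℕₚ.*-identityʳ τ)) (ℕₚ.m≤n+m τ 2))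
      ... | no u≉γa = ℕₚ.≤-trans (pairs≤2 λ z → u≉γa (x-y≈0⇒x≈y _ _ z)) (ℕₚ.m≤m+n 2 _)

    -- Serves twice: it bounds the representations of 0, and it bounds the number of triples in the
    -- outer sum whose sum is 0, which is the same count.
    triples-zero : ∀ {u} → u ≈ 0# → triples u ≤ τ ℕ.* 2
    triples-zero {u} u≈0 = ℕₚ.≤-trans (triples≤pairs u) (∑-γ 2 λ {a} _ → pairs≤2 λ z →
        γ≉0 a (trans (sym (x-y≈0⇒x≈y _ _ z)) u≈0))

    private
      -- What remains of the equation `u = γ a + γ b + γ c` once `b` and `c` are eliminated. As
      -- `σ u` is a constant, the condition is polynomial in `γ a`, in the form that `stepanov`
      -- expects.
      Good : Carrier → ℕ → Set
      Good u a = (u - γ a) ^ τ ≈ (σ u * γ a - 1#) ^ τ × (¬ u - γ a ≈ 0#) × (¬ σ u * γ a - 1# ≈ 0#)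

      good? : ∀ u a → Dec (Good u a)
      good? u a = (_ ≈? _) ×-dec ¬? (_ ≈? _) ×-dec ¬? (_ ≈? _)

    σ-γ-unit : ∀ {u a} → u ≈ γ a → u * σ u ≈ 1#
    σ-γ-unit {u} {a} e = trans (*-cong e (σ-cong e)) (trans (*-comm _ _) (σγγ≈1 a))

    private
      -- With `s = u − γ a`, `product-σ` gives `s = γ b γ c σ(s)`, while `σ(u) γ a − 1 = γ a σ(s)`.
      -- The two differ by factors from the group, which disappear in the `τ`-th power. That `s` is
      -- nonzero follows from `σ-γ-unit`.
      good : ∀ {u} → ¬ u * σ u ≈ 1# → ∀ {a b c} → u - γ a ≈ γ b + γ c → Good u a
      good {u} uσu≉1 {a} {b} {c} e = powers , s≉0 , λ z → *-nonzero (γ≉0 a) (σ≉0 e s≉0) (trans (sym g≈) z)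
        where
        s = u - γ a
        s≉0 : ¬ s ≈ 0#
        s≉0 z = uσu≉1 (σ-γ-unit (x-y≈0⇒x≈y _ _ z))
        u≈ : u ≈ γ a + s
        u≈ = solve 2 (λ u a → u := a :+ (u :- a)) refl u (γ a)
        g≈ : σ u * γ a - 1# ≈ γ a * σ s
        g≈ = begin
          σ u * γ a - 1# ≈⟨ +-cong (*-congʳ (trans (σ-cong u≈) (σ-+ _ _))) (-‿cong (sym (σγγ≈1 a))) ⟩
          (σ (γ a) + σ s) * γ a - σ (γ a) * γ a ≈⟨ solve 3 (λ a′ a s → (a′ :+ s) :* a :- a′ :* a := a :* s) refl _ _ _ ⟩
          γ a * σ s ∎
        powers : s ^ τ ≈ (σ u * γ a - 1#) ^ τ
        powers = begin
          s ^ τ ≈⟨ ^-congˡ τ (product-σ e) ⟨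
          (γ b * γ c * σ s) ^ τ
              ≈⟨ trans (^-distrib-* _ _ τ) (*-congʳ (trans (^-distrib-* _ _ τ) (*-cong (γ^τ b) (γ^τ c)))) ⟩
          1# * 1# * σ s ^ τ ≈⟨ *-congʳ (trans (*-identityˡ 1#) (sym (γ^τ a))) ⟩
          γ a ^ τ * σ s ^ τ ≈⟨ ^-distrib-* _ _ τ ⟨
          (γ a * σ s) ^ τ ≈⟨ ^-congˡ τ g≈ ⟨
          (σ u * γ a - 1#) ^ τ ∎

    triples≤good : ∀ {u} → ¬ u * σ u ≈ 1# → triples u ≤ 2 ℕ.* length (filter (good? u) indices)
    triples≤good {u} uσu≉1 = ℕₚ.≤-trans (triples≤pairs u) (ℕₚ.≤-trans (∑ₗ-mono indices bound)
      (ℕₚ.≤-reflexive (≡.trans (∑ₗ-* indices 2 _) (≡.cong (2 ℕ.*_) (∑ₗ-filter indices (good? u))))))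
      where
      bound : ∀ {a} → a ∈ indices → pairs (u - γ a) ≤ 2 ℕ.* 𝟙 (good? u a)
      bound {a} _ with good? u a
      ... | yes (_ , s≉0 , _) = pairs≤2 s≉0
      ... | no bad = ℕₚ.≤-reflexive (pairs-insoluble λ _ _ e → bad (good uσu≉1 e))

    -- For `β` at most 1 it is enough that there are `τ` indices. Otherwise Stepanov's method bounds
    -- the count times `β²` by `4 τ β`, and one factor `β` cancels. The conditions are asked from
    -- `β = 2` on, so that `β = 1` remains available for every `τ` and `p`.
    good-bound : ∀ β → (2 ≤ β → β ℕ.* β ℕ.* β ℕ.* 2 ≤ τ) → (2 ≤ β → ∀ k → 0 < k → k < τ ℕ.* (β ℕ.+ β) → ¬ ι k ≈ 0#) →
      ∀ {u} → ¬ u ≈ 0# → ¬ u * σ u ≈ 1# → length (filter (good? u) indices) ℕ.* β ≤ 4 ℕ.* τ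
    good-bound zero _ _ {u} _ _ = ≡.subst (_≤ 4 ℕ.* τ) (≡.sym (ℕₚ.*-zeroʳ (length (filter (good? u) indices)))) z≤n
    good-bound (suc zero) _ _ {u} _ _ =
        ≡.subst (_≤ 4 ℕ.* τ) (≡.sym (ℕₚ.*-identityʳ _)) (ℕₚ.≤-trans (Listₚ.length-filter (good? u) indices)
        (≡.subst (_≤ 4 ℕ.* τ) (≡.sym card) (ℕₚ.m≤m+n τ _)))
    -- A = M = β² and B = C = 2β give 3β⁴ conditions on 4β⁴ coefficients.
    good-bound β@(suc β′@(suc β″)) small char {u} u≉0 uσu≉1 =
      ℕₚ.<⇒≤ (ℕₚ.*-cancelʳ-< β _ _ (≡.subst₂ _<_ (≡.trans (≡.cong (ℕ._* (β ℕ.* β)) length-map)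
          (≡.sym (ℕₚ.*-assoc (length (filter (good? u) indices)) β β)))
          (arith₁ τ β)
          -- `stepanov` takes predecessors: `β′ + β′ * β` is that of `β²` and `β′ + β` that of
          -- `2 β`.
          (stepanov u (σ u) u≉0 uσu≉1 τ (β′ ℕ.+ β′ ℕ.* β) (β ℕ.+ β) (β′ ℕ.+ β) (β ℕ.* β) small′ unknowns
              (char 2≤β) M≤ points distinct hyps)))
        where
        open Stepanov F
        2≤β : 2 ≤ β
        2≤β = s≤s (s≤s z≤n)
        points : List Carrier
        points = map γ (filter (good? u) indices)
        length-map : length points ≡ length (filter (good? u) indices)
        length-map = Listₚ.length-map γ (filter (good? u) indices)
        arith₁ : ∀ t b → t ℕ.* (b ℕ.+ b) ℕ.+ t ℕ.* (b ℕ.+ b) ≡ 4 ℕ.* t ℕ.* b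
        arith₁ = solve-∀
        arith₂ : ∀ b → b ℕ.* b ℕ.* b ℕ.* 2 ≡ (b ℕ.+ b) ℕ.* (b ℕ.* b)
        arith₂ = solve-∀
        small′ : (β ℕ.+ β) ℕ.* (β ℕ.* β) ≤ τ
        small′ = ≡.subst (_≤ τ) (arith₂ β) (small 2≤β)
        unknowns : β ℕ.* β ℕ.* (β ℕ.* β ℕ.* 2 ℕ.+ β ℕ.* β) < (β ℕ.+ β) ℕ.* ((β ℕ.+ β) ℕ.* (β ℕ.* β))
        unknowns = ≡.subst (rows <_) (arith₃ (β ℕ.* β) β) (ℕₚ.m<m+n rows {β ℕ.* β ℕ.* (β ℕ.* β)} (s≤s z≤n))
          where
          rows : ℕ
          rows = β ℕ.* β ℕ.* (β ℕ.* β ℕ.* 2 ℕ.+ β ℕ.* β)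
          arith₃ : ∀ m b → b ℕ.* b ℕ.* (m ℕ.* 2 ℕ.+ m) ℕ.+ b ℕ.* b ℕ.* m ≡ (b ℕ.+ b) ℕ.* ((b ℕ.+ b) ℕ.* m)
          arith₃ = solve-∀
        M≤ : β ℕ.* β ≤ τ ℕ.* (β ℕ.+ β)
        M≤ = ℕₚ.≤-trans (ℕₚ.m≤m+n (β ℕ.* β) _) (ℕₚ.≤-trans small′ (ℕₚ.m≤m*n τ (β ℕ.+ β)))
        distinct : AllPairs (λ x y → ¬ x ≈ y) points
        distinct = AllPairsₚ.map⁺ (distinct′ (filter (good? u) indices) (λ i∈ → proj₁ (∈-filter⁻ (good? u) i∈))
            (AllPairsₚ.filter⁺ (good? u) unique))
          where
          distinct′ : ∀ is → (∀ {i} → i ∈ is → i ∈ indices) → Unique is → AllPairs (λ i j → ¬ γ i ≈ γ j) is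
          distinct′ [] _ [] = []
          distinct′ (i ∷ is) sub (i≢ ∷ un) =
            All.tabulate (λ j∈ e → All.lookup i≢ j∈ (γ-injective (sub (here ≡.refl))
                (sub (there j∈)) e)) ∷ distinct′ is (λ j∈ → sub (there j∈)) un
        hyps : All _ points
        hyps = Allₚ.map⁺ (All.tabulate λ {i} i∈ →
          let (_ , e , s≉0 , g≉0) = ∈-filter⁻ (good? u) {xs = indices} i∈
          in γ^τ i , e , γ≉0 i , s≉0 , g≉0)

    triples-bound : ∀ β → (2 ≤ β → β ℕ.* β ℕ.* β ℕ.* 2 ≤ τ) → (2 ≤ β → ∀ k → 0 < k → k < τ ℕ.* (β ℕ.+ β) → ¬ ι k ≈ 0#) →
      ∀ {u} → ¬ u ≈ 0# → ¬ u * σ u ≈ 1# → triples u ℕ.* β ≤ 8 ℕ.* τ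
    triples-bound β small char {u} u≉0 uσu≉1 = ℕₚ.≤-trans (ℕₚ.*-monoˡ-≤ β (triples≤good uσu≉1))
      (ℕₚ.≤-trans (ℕₚ.≤-reflexive (ℕₚ.*-assoc 2 (length (filter (good? u) indices)) β))
          (ℕₚ.≤-trans (ℕₚ.*-monoʳ-≤ 2 (good-bound β small char u≉0 uσu≉1)) (ℕₚ.≤-reflexive (arith τ))))
      where
      arith : ∀ t → 2 ℕ.* (4 ℕ.* t) ≡ 8 ℕ.* t
      arith = solve-∀

    open Triple indices

    sumOf : ℕ → ℕ → ℕ → Carrier
    sumOf x y z = γ x + (γ y + γ z)

    energy : ℕ
    energy = ∑³ λ x y z → triples (sumOf x y z)

    -- Since `σ` inverts each `γ i`, multiplying by all three produces their second elementary
    -- symmetric function.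
    σ-sumOf : ∀ x y z → γ x * γ y * γ z * σ (sumOf x y z) ≈ γ y * γ z + γ x * γ z + γ x * γ y
    σ-sumOf x y z = begin
      γ x * γ y * γ z * σ (sumOf x y z) ≈⟨ *-congˡ (trans (σ-+ _ _) (+-congˡ (σ-+ _ _))) ⟩
      γ x * γ y * γ z * (σ (γ x) + (σ (γ y) + σ (γ z)))
        ≈⟨ solve 6 (λ x y z x′ y′ z′ → x :* y :* z :* (x′ :+ (y′ :+ z′))
            := (x′ :* x) :* (y :* z) :+ (y′ :* y) :* (x :* z) :+ (z′ :* z) :* (x :* y)) refl _ _ _ _ _ _ ⟩
      σ (γ x) * γ x * (γ y * γ z) + σ (γ y) * γ y * (γ x * γ z) + σ (γ z) * γ z * (γ x * γ y)
        ≈⟨ +-cong (+-cong (unit x _) (unit y _)) (unit z _) ⟩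
      γ y * γ z + γ x * γ z + γ x * γ y ∎
      where
      unit : ∀ i w → σ (γ i) * γ i * w ≈ w
      unit i w = trans (*-congʳ (σγγ≈1 i)) (*-identityˡ w)

    -- (x + y)(y + z)(z + x) = xyz (u σu − 1) for u = x + y + z
    degenerate : ∀ x y z → sumOf x y z * σ (sumOf x y z) ≈ 1# → γ x + γ y ≈ 0# ⊎ γ y + γ z ≈ 0# ⊎ γ z + γ x ≈ 0#
    degenerate x y z uσu≈1 with γ x + γ y ≈? 0# | γ y + γ z ≈? 0#
    ... | yes e | _ = inj₁ e
    ... | no _ | yes e = inj₂ (inj₁ e)
    ... | no x+y≉0 | no y+z≉0 = inj₂ (inj₂ (*-cancelˡ-0 (*-nonzero x+y≉0 y+z≉0) (begin
      (γ x + γ y) * (γ y + γ z) * (γ z + γ x)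
        ≈⟨ solve 3 (λ x y z → (x :+ y) :* (y :+ z) :* (z :+ x)
            := (x :+ (y :+ z)) :* (y :* z :+ x :* z :+ x :* y) :- x :* y :* z) refl _ _ _ ⟩
      sumOf x y z * (γ y * γ z + γ x * γ z + γ x * γ y) - γ x * γ y * γ z ≈⟨ +-congʳ (*-congˡ (σ-sumOf x y z)) ⟨
      sumOf x y z * (γ x * γ y * γ z * σ (sumOf x y z)) - γ x * γ y * γ z
        ≈⟨ +-congʳ (solve 3 (λ u m v → u :* (m :* v) := m :* (u :* v)) refl _ _ _) ⟩
      γ x * γ y * γ z * (sumOf x y z * σ (sumOf x y z)) - γ x * γ y * γ z
          ≈⟨ +-congʳ (trans (*-congˡ uσu≈1) (*-identityʳ _)) ⟩
      γ x * γ y * γ z - γ x * γ y * γ z ≈⟨ -‿inverseʳ _ ⟩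
      0# ∎)))

    private
      opposite : ℕ → ℕ → ℕ
      opposite i j = 𝟙 (γ i + γ j ≈? 0#)

      opposite-once : ∀ i → ∑ₗ indices (opposite i) ≤ 1
      opposite-once i = atMostOne (λ j → γ i + γ j ≈? 0#) (0# - γ i) λ e → +-solve (sym e)

      opposite-once′ : ∀ j → ∑ₗ indices (λ i → opposite i j) ≤ 1
      opposite-once′ j = atMostOne (λ i → γ i + γ j ≈? 0#) (0# - γ j) λ e → +-solve (trans (sym e) (+-comm _ _))

      vanishing-triples : ∑³ (λ x y z → 𝟙 (sumOf x y z ≈? 0#)) ≤ τ ℕ.* 2
      vanishing-triples = ℕₚ.≤-trans (∑³-mono λ x y z → 𝟙-mono (sumOf x y z ≈? 0#) (0# ≈? sumOf x y z) sym)
          (triples-zero refl)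

      -- Each of the three relations determines one index from another and leaves two free, hence at
      -- most `τ²` triples for each relation.
      opposite-triples : ∑³ (λ x y z → opposite x y ℕ.+ opposite y z ℕ.+ opposite z x) ≤ τ ℕ.* (τ ℕ.* 3)
      opposite-triples = ∑-γ (τ ℕ.* 3) λ {x} _ →
        ℕₚ.≤-trans (ℕₚ.≤-reflexive (≡.trans (∑ₗ-cong indices λ y →
            ≡.trans (∑ₗ-+ indices (λ z → opposite x y ℕ.+ opposite y z) (λ z → opposite z x))
            (≡.cong (ℕ._+ _) (≡.trans (∑ₗ-+ indices (λ _ → opposite x y) (opposite y))
                (≡.cong (ℕ._+ ∑ₗ indices (opposite y)) (≡.trans (∑ₗ-const indices (opposite x y))
                    (≡.cong (ℕ._* opposite x y) card))))))
            (≡.trans (∑ₗ-+ indices _ (λ _ → ∑ₗ indices (λ z → opposite z x)))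
                (≡.cong (ℕ._+ ∑ₗ indices (λ _ → ∑ₗ indices (λ z → opposite z x))) (∑ₗ-+ indices _ _)))))
          (ℕₚ.≤-trans (ℕₚ.+-mono-≤ (ℕₚ.+-mono-≤
              (ℕₚ.≤-trans (ℕₚ.≤-reflexive (∑ₗ-* indices τ (opposite x))) (ℕₚ.*-monoʳ-≤ τ (opposite-once x)))
              (∑-γ 1 λ {y} _ → opposite-once y))
              (∑-γ 1 λ _ → opposite-once′ x))
            (ℕₚ.≤-reflexive (arith τ)))
        where
        arith : ∀ t → t ℕ.* 1 ℕ.+ t ℕ.* 1 ℕ.+ t ℕ.* 1 ≡ t ℕ.* 3
        arith = solve-∀

    -- The constant is 21 = 4 + 9 + 8. Triples with sum 0 are at most `2 τ` in number with `2 τ`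
    -- representations each; those with an opposite pair at most `3 τ²` with `3 τ` each; the others
    -- contribute `8 τ` each, already multiplied by `β`. In the first two terms the factor `β` is
    -- absorbed by `β ≤ τ`.
    energy-bound : ∀ β → β ≤ τ → (2 ≤ β → β ℕ.* β ℕ.* β ℕ.* 2 ≤ τ) →
        (2 ≤ β → ∀ k → 0 < k → k < τ ℕ.* (β ℕ.+ β) → ¬ ι k ≈ 0#) →
      energy ℕ.* β ≤ 21 ℕ.* (τ ℕ.* τ ℕ.* τ ℕ.* τ)
    energy-bound β β≤τ small char = begin′
      energy ℕ.* β ≡⟨ ≡.trans (ℕₚ.*-comm energy β) (≡.sym (∑³-* β _)) ⟩
      ∑³ (λ x y z → β ℕ.* triples (sumOf x y z)) ≤⟨ ∑³-mono pointwise ⟩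
      ∑³ (λ x y z → V ℕ.* 𝟙 (sumOf x y z ≈? 0#) ℕ.+ W ℕ.* opposites x y z ℕ.+ 8 ℕ.* τ)
        ≡⟨ ≡.trans (∑³-+ _ (λ _ _ _ → 8 ℕ.* τ)) (≡.cong (ℕ._+ _)
            (≡.trans (∑³-+ _ _) (≡.cong₂ ℕ._+_ (∑³-* V _) (∑³-* W _)))) ⟩
      V ℕ.* ∑³ (λ x y z → 𝟙 (sumOf x y z ≈? 0#)) ℕ.+ W ℕ.* ∑³ opposites ℕ.+ ∑³ (λ _ _ _ → 8 ℕ.* τ)
        ≤⟨ ℕₚ.+-mono-≤ (ℕₚ.+-mono-≤ (ℕₚ.*-monoʳ-≤ V vanishing-triples) (ℕₚ.*-monoʳ-≤ W opposite-triples))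
            (∑-γ _ λ _ → ∑-γ _ λ _ → ∑-γ _ λ _ → ℕₚ.≤-refl) ⟩
      V ℕ.* (τ ℕ.* 2) ℕ.+ W ℕ.* (τ ℕ.* (τ ℕ.* 3)) ℕ.+ τ ℕ.* (τ ℕ.* (τ ℕ.* (8 ℕ.* τ)))
        ≡⟨ arith₁ β τ ⟩
      β ℕ.* (τ ℕ.* τ) ℕ.* 4 ℕ.+ β ℕ.* (τ ℕ.* τ ℕ.* τ) ℕ.* 9 ℕ.+ 8 ℕ.* (τ ℕ.* τ ℕ.* τ ℕ.* τ)
        ≤⟨ ℕₚ.+-monoˡ-≤ (8 ℕ.* (τ ℕ.* τ ℕ.* τ ℕ.* τ)) (ℕₚ.+-mono-≤
             (ℕₚ.*-monoˡ-≤ 4 (ℕₚ.*-mono-≤ β≤τ (ℕₚ.m≤m*n (τ ℕ.* τ) τ {{ℕ.>-nonZero 1≤τ}})))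
             (ℕₚ.*-monoˡ-≤ 9 (ℕₚ.*-monoˡ-≤ (τ ℕ.* τ ℕ.* τ) β≤τ))) ⟩
      τ ℕ.* (τ ℕ.* τ ℕ.* τ) ℕ.* 4 ℕ.+ τ ℕ.* (τ ℕ.* τ ℕ.* τ) ℕ.* 9 ℕ.+ 8 ℕ.* (τ ℕ.* τ ℕ.* τ ℕ.* τ)
        ≡⟨ arith₂ τ ⟩
      21 ℕ.* (τ ℕ.* τ ℕ.* τ ℕ.* τ) ∎′
      where
      open ℕₚ.≤-Reasoning using (step-≤; step-≡-⟩) renaming (begin_ to begin′_; _∎ to _∎′)
      V W : ℕ
      V = β ℕ.* (τ ℕ.* 2)
      W = β ℕ.* (3 ℕ.* τ)
      opposites : ℕ → ℕ → ℕ → ℕ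
      opposites x y z = opposite x y ℕ.+ opposite y z ℕ.+ opposite z x
      arith₁ : ∀ b t → b ℕ.* (t ℕ.* 2) ℕ.* (t ℕ.* 2) ℕ.+ b ℕ.* (3 ℕ.* t) ℕ.* (t ℕ.* (t ℕ.* 3)) ℕ.+ t ℕ.*
          (t ℕ.* (t ℕ.* (8 ℕ.* t)))
        ≡ b ℕ.* (t ℕ.* t) ℕ.* 4 ℕ.+ b ℕ.* (t ℕ.* t ℕ.* t) ℕ.* 9 ℕ.+ 8 ℕ.* (t ℕ.* t ℕ.* t ℕ.* t)
      arith₁ = solve-∀
      arith₂ : ∀ t → t ℕ.* (t ℕ.* t ℕ.* t) ℕ.* 4 ℕ.+ t ℕ.* (t ℕ.* t ℕ.* t) ℕ.* 9 ℕ.+ 8 ℕ.*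
          (t ℕ.* t ℕ.* t ℕ.* t) ≡ 21 ℕ.* (t ℕ.* t ℕ.* t ℕ.* t)
      arith₂ = solve-∀
      1≤opposites : ∀ x y z → γ x + γ y ≈ 0# ⊎ γ y + γ z ≈ 0# ⊎ γ z + γ x ≈ 0# → 1 ≤ opposites x y z
      1≤opposites x y z (inj₁ e) =
          ℕₚ.≤-trans (ℕₚ.≤-reflexive (≡.sym (𝟙-true (γ x + γ y ≈? 0#) e)))
              (ℕₚ.≤-trans (ℕₚ.m≤m+n (opposite x y) (opposite y z)) (ℕₚ.m≤m+n _ (opposite z x)))
      1≤opposites x y z (inj₂ (inj₁ e)) =
          ℕₚ.≤-trans (ℕₚ.≤-reflexive (≡.sym (𝟙-true (γ y + γ z ≈? 0#) e)))
              (ℕₚ.≤-trans (ℕₚ.m≤n+m (opposite y z) (opposite x y)) (ℕₚ.m≤m+n _ (opposite z x)))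
      1≤opposites x y z (inj₂ (inj₂ e)) =
          ℕₚ.≤-trans (ℕₚ.≤-reflexive (≡.sym (𝟙-true (γ z + γ x ≈? 0#) e))) (ℕₚ.m≤n+m (opposite z x) _)
      pointwise : ∀ x y z → β ℕ.* triples (sumOf x y z) ≤ V ℕ.* 𝟙
          (sumOf x y z ≈? 0#) ℕ.+ W ℕ.* opposites x y z ℕ.+ 8 ℕ.* τ
      pointwise x y z with sumOf x y z ≈? 0#
      ... | yes u≈0 = ℕₚ.≤-trans (ℕₚ.*-monoʳ-≤ β (triples-zero u≈0))
          (ℕₚ.≤-trans (ℕₚ.≤-reflexive (≡.sym (ℕₚ.*-identityʳ V)))
              (ℕₚ.≤-trans (ℕₚ.m≤m+n (V ℕ.* 1) (W ℕ.* opposites x y z)) (ℕₚ.m≤m+n _ (8 ℕ.* τ))))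
      ... | no u≉0 with sumOf x y z * σ (sumOf x y z) ≈? 1#
      ...   | yes uσu≈1 = ℕₚ.≤-trans (ℕₚ.*-monoʳ-≤ β (triples≤3τ (sumOf x y z)))
          (ℕₚ.≤-trans (ℕₚ.≤-trans (ℕₚ.≤-reflexive (≡.sym (ℕₚ.*-identityʳ W)))
              (ℕₚ.*-monoʳ-≤ W (1≤opposites x y z (degenerate x y z uσu≈1))))
            (ℕₚ.≤-trans (ℕₚ.m≤n+m (W ℕ.* opposites x y z) (V ℕ.* 0)) (ℕₚ.m≤m+n _ (8 ℕ.* τ))))
      ...   | no uσu≉1 = ℕₚ.≤-trans (ℕₚ.≤-reflexive (ℕₚ.*-comm β _))
          (ℕₚ.≤-trans (triples-bound β small char u≉0 uσu≉1) (ℕₚ.m≤n+m (8 ℕ.* τ) (V ℕ.* 0 ℕ.+ W ℕ.* opposites x y z)))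

-- The prime field.

open import Data.Integer as ℤ using (ℤ; +_; _%ℕ_; _/ℕ_)
open import Data.Integer.DivMod using (n%ℕd<d; a≡a%ℕn+[a/ℕn]*n)
open import Data.Integer.Divisibility.Signed
  using (_∣_; divides; ∣m∣n⇒∣m+n; ∣m⇒∣-m; ∣n⇒∣m*n; ∣m⇒∣m*n; ∣⇒∣ᵤ; _∣?_)
import Data.Integer.Properties as ℤₚ
import Data.Integer.Tactic.RingSolver as ℤ-Solver

module PrimeField (p : ℕ) (isPrime : Prime p) where
  open import Data.Integer using (_+_; _*_; -_; _-_)

  private instance
    p≢0 : NonZero p
    p≢0 = prime⇒nonZero isPrime

  infix 4 _≈_
  -- Elements of the prime field are arbitrary integers compared modulo `p`, so that the ring axioms
  -- are inherited from the integers.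
  record _≈_ (i j : ℤ) : Set where
    constructor congruent
    field ∣difference : + p ∣ i - j
  open _≈_ public

  private
    via : ∀ {i j k} → k ≡ i - j → + p ∣ k → i ≈ j
    via ≡.refl d = congruent d

    ≈-reflexive : ∀ {i j} → i ≡ j → i ≈ j
    ≈-reflexive {i} ≡.refl = congruent (divides (+ 0) (ℤₚ.+-inverseʳ i))

    ≈-sym : ∀ {i j} → i ≈ j → j ≈ i
    ≈-sym {i} {j} e = via (lemma i j) (∣m⇒∣-m (∣difference e))
      where lemma : ∀ i j → - (i - j) ≡ j - i
            lemma = ℤ-Solver.solve-∀

    ≈-trans : ∀ {i j k} → i ≈ j → j ≈ k → i ≈ k
    ≈-trans {i} {j} {k} e e′ = via (lemma i j k) (∣m∣n⇒∣m+n (∣difference e) (∣difference e′))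
      where lemma : ∀ i j k → (i - j) + (j - k) ≡ i - k
            lemma = ℤ-Solver.solve-∀

    +-cong : ∀ {i i′ j j′} → i ≈ i′ → j ≈ j′ → i + j ≈ i′ + j′
    +-cong {i} {i′} {j} {j′} e e′ = via (lemma i i′ j j′) (∣m∣n⇒∣m+n (∣difference e) (∣difference e′))
      where lemma : ∀ i i′ j j′ → (i - i′) + (j - j′) ≡ (i + j) - (i′ + j′)
            lemma = ℤ-Solver.solve-∀

    *-cong : ∀ {i i′ j j′} → i ≈ i′ → j ≈ j′ → i * j ≈ i′ * j′
    *-cong {i} {i′} {j} {j′} e e′ =
        via (lemma i i′ j j′) (∣m∣n⇒∣m+n (∣m⇒∣m*n j (∣difference e)) (∣n⇒∣m*n i′ (∣difference e′)))
      where lemma : ∀ i i′ j j′ → (i - i′) * j + i′ * (j - j′) ≡ i * j - i′ * j′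
            lemma = ℤ-Solver.solve-∀

    -‿cong : ∀ {i j} → i ≈ j → - i ≈ - j
    -‿cong {i} {j} e = via (lemma i j) (∣m⇒∣-m (∣difference e))
      where lemma : ∀ i j → - (i - j) ≡ - i - - j
            lemma = ℤ-Solver.solve-∀

  ring : CommutativeRing 0ℓ 0ℓ
  ring = record
    { Carrier = ℤ ; _≈_ = _≈_ ; _+_ = _+_ ; _*_ = _*_ ; -_ = -_ ; 0# = + 0 ; 1# = + 1
    ; isCommutativeRing = record
      { isRing = record
        { +-isAbelianGroup = record
          { isGroup = record
            { isMonoid = record
              { isSemigroup = record
                { isMagma = record
                  { isEquivalence = record { refl = ≈-reflexive ≡.refl ; sym = ≈-sym ; trans = ≈-trans }
                  ; ∙-cong = +-cong }
                ; assoc = λ i j k → ≈-reflexive (ℤₚ.+-assoc i j k) }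
              ; identity = (λ i → ≈-reflexive (ℤₚ.+-identityˡ i)) , (λ i → ≈-reflexive (ℤₚ.+-identityʳ i)) }
            ; inverse = (λ i → ≈-reflexive (ℤₚ.+-inverseˡ i)) , (λ i → ≈-reflexive (ℤₚ.+-inverseʳ i))
            ; ⁻¹-cong = -‿cong }
          ; comm = λ i j → ≈-reflexive (ℤₚ.+-comm i j) }
        ; *-cong = *-cong
        ; *-assoc = λ i j k → ≈-reflexive (ℤₚ.*-assoc i j k)
        ; *-identity = (λ i → ≈-reflexive (ℤₚ.*-identityˡ i)) , (λ i → ≈-reflexive (ℤₚ.*-identityʳ i))
        ; distrib = (λ i j k → ≈-reflexive (ℤₚ.*-distribˡ-+ i j k)) , (λ i j k → ≈-reflexive (ℤₚ.*-distribʳ-+ i j k)) }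
      ; *-comm = λ i j → ≈-reflexive (ℤₚ.*-comm i j) } }

  ≈-+multiple : ∀ {i} q {j} → i ≡ j + q * + p → i ≈ j
  ≈-+multiple q {j} ≡.refl = congruent (divides q (lemma j (q * + p)))
    where lemma : ∀ j k → (j + k) - j ≡ k
          lemma = ℤ-Solver.solve-∀

  ≈-%ℕ : ∀ i → i ≈ + (i %ℕ p)
  ≈-%ℕ i = ≈-+multiple (i /ℕ p) (a≡a%ℕn+[a/ℕn]*n i p)

  below-p-nonzero : ∀ {k} → 0 ℕ.< k → k ℕ.< p → ¬ + k ≈ + 0
  below-p-nonzero {suc k} _ k<p e =
      ℕₚ.<⇒≱ k<p (∣⇒≤ (∣⇒∣ᵤ (≡.subst (+ p ∣_) (ℤₚ.+-identityʳ (+ suc k)) (∣difference e))))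

  private
    incongruent : ∀ {m n} → m ℕ.< n → n ℕ.< p → ¬ + m ≈ + n
    incongruent {m} {n} m<n n<p e = below-p-nonzero (ℕₚ.m<n⇒0<n∸m m<n) (ℕₚ.≤-<-trans (ℕₚ.m∸n≤m n m) n<p)
      (≈-trans (≈-reflexive (≡.trans (≡.sym (ℤₚ.⊖-≥ (ℕₚ.<⇒≤ m<n))) (≡.sym (ℤₚ.m-n≡m⊖n n m))))
        (≈-trans (+-cong (≈-sym e) (≈-reflexive { - (+ m)} ≡.refl)) (≈-reflexive (ℤₚ.+-inverseʳ (+ m)))))

  ≈⇒≡ : ∀ {m n} → m ℕ.< p → n ℕ.< p → + m ≈ + n → m ≡ n
  ≈⇒≡ {m} {n} m<p n<p e with ℕₚ.<-cmp m n
  ... | tri< m<n _ _ = contradiction e (incongruent m<n n<p)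
  ... | tri≈ _ m≡n _ = m≡n
  ... | tri> _ _ n<m = contradiction (≈-sym e) (incongruent n<m m<p)

  primeField : Field
  primeField = record
    { commutativeRing = ring
    ; _≈?_ = λ i j → map′ congruent ∣difference (+ p ∣? (i - j))
    ; 1≉0 = below-p-nonzero (s≤s z≤n) 1<p
    ; inverse = inverse }
    where
    1<p : 1 ℕ.< p
    1<p = ℕ.nonTrivial⇒n>1 p {{prime⇒nonTrivial isPrime}}
    inverse : ∀ {i} → ¬ i ≈ + 0 → ∃[ j ] j * i ≈ + 1
    inverse {i} i≉0 with i %ℕ p in eq
    ... | zero = contradiction (≈-trans (≈-%ℕ i) (≈-reflexive (≡.cong +_ eq))) i≉0
    ... | r@(suc _) with coprime-Bézout (prime⇒coprime isPrime (≡.subst (ℕ._< p) eq (n%ℕd<d i p)))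
    -- Over the natural numbers Bézout's identity takes one of two forms, `1 + y r = x p` or
    -- `1 + x p = y r`; the inverse of `r` is `−y` in the first and `y` in the second.
    ...   | Bézout.+- x y e = - + y , ≈-trans (*-cong (≈-reflexive { - + y} ≡.refl) i≈r)
            (≈-+multiple (- + x) (lemma₁ (+ r) (+ x) (+ y) (+ p)
              (≡.trans (≡.cong (ℤ._+_ (+ 1)) (≡.sym (ℤₚ.pos-* y r))) (≡.trans (≡.cong +_ e) (ℤₚ.pos-* x p)))))
      where
      i≈r : i ≈ + r
      i≈r = ≈-trans (≈-%ℕ i) (≈-reflexive (≡.cong +_ eq))
      lemma₁ : ∀ r x y p → + 1 + y * r ≡ x * p → - y * r ≡ + 1 + - x * p
      lemma₁ r x y p e = ≡.trans (lemma₂ r y) (≡.trans (≡.cong (λ z → + 1 - z) e)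
          (≡.cong (λ z → + 1 + z) (ℤₚ.neg-distribˡ-* x p)))
        where lemma₂ : ∀ r y → - y * r ≡ + 1 - (+ 1 + y * r)
              lemma₂ = ℤ-Solver.solve-∀
    ...   | Bézout.-+ x y e = + y , ≈-trans (*-cong (≈-reflexive {+ y} ≡.refl) i≈r)
            (≈-+multiple (+ x) (≡.trans (≡.sym (ℤₚ.pos-* y r))
                (≡.trans (≡.cong +_ (≡.sym e)) (≡.cong (ℤ._+_ (+ 1)) (ℤₚ.pos-* x p)))))
      where
      i≈r : i ≈ + r
      i≈r = ≈-trans (≈-%ℕ i) (≈-reflexive (≡.cong +_ eq))

-- The quadratic extension, its conjugation and its norm.

-- F[λ] with λ² = cλ − 1, where (s , t) stands for s + tλ
module QuadraticExtension (F : Field) (c : Field.Carrier F) where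
  open Field F
  open RingSolver commutativeRing

  infix 4 _≈₂_
  record _≈₂_ (x y : Carrier × Carrier) : Set where
    constructor componentwise
    field
      fst≈ : proj₁ x ≈ proj₁ y
      snd≈ : proj₂ x ≈ proj₂ y
  open _≈₂_ public

  private
    mul : Carrier × Carrier → Carrier × Carrier → Carrier × Carrier
    mul (s , t) (s′ , t′) = s * s′ - t * t′ , s * t′ + t * s′ + c * (t * t′)

  quadraticRing : CommutativeRing 0ℓ 0ℓ
  quadraticRing = record
    { Carrier = Carrier × Carrier ; _≈_ = _≈₂_
    ; _+_ = λ (s , t) (s′ , t′) → s + s′ , t + t′ ; _*_ = mul ; -_ = λ (s , t) → - s , - t ; 0# = 0# , 0# ; 1# = 1# , 0#
    ; isCommutativeRing = record
      { isRing = record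
        { +-isAbelianGroup = record
          { isGroup = record
            { isMonoid = record
              { isSemigroup = record
                { isMagma = record
                  { isEquivalence = record
                    { refl = componentwise refl refl
                    ; sym = λ (componentwise e e′) → componentwise (sym e) (sym e′)
                    ; trans = λ (componentwise e e′) (componentwise f f′) → componentwise (trans e f) (trans e′ f′) }
                  ; ∙-cong = λ (componentwise e e′) (componentwise f f′) → componentwise (+-cong e f) (+-cong e′ f′) }
                ; assoc = λ _ _ _ → componentwise (+-assoc _ _ _) (+-assoc _ _ _) }
              ; identity = (λ _ → componentwise (+-identityˡ _) (+-identityˡ _)) ,
                  (λ _ → componentwise (+-identityʳ _) (+-identityʳ _)) }
            ; inverse = (λ _ → componentwise (-‿inverseˡ _) (-‿inverseˡ _)) ,
                (λ _ → componentwise (-‿inverseʳ _) (-‿inverseʳ _))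
            ; ⁻¹-cong = λ (componentwise e e′) → componentwise (-‿cong e) (-‿cong e′) }
          ; comm = λ _ _ → componentwise (+-comm _ _) (+-comm _ _) }
        ; *-cong = λ (componentwise e e′) (componentwise f f′) → componentwise
            (+-cong (*-cong e f) (-‿cong (*-cong e′ f′)))
            (+-cong (+-cong (*-cong e f′) (*-cong e′ f)) (*-congˡ (*-cong e′ f′)))
        ; *-assoc = λ (s , t) (s′ , t′) (s″ , t″) → componentwise
            (solve 7 (λ c s t s′ t′ s″ t″ →
              (s :* s′ :- t :* t′) :* s″ :- (s :* t′ :+ t :* s′ :+ c :* (t :* t′)) :* t″
              := s :* (s′ :* s″ :- t′ :* t″) :- t :* (s′ :* t″ :+ t′ :* s″ :+ c :* (t′ :* t″))) refl c s t s′ t′ s″ t″)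
            (solve 7 (λ c s t s′ t′ s″ t″ →
              (s :* s′ :- t :* t′) :* t″ :+ (s :* t′ :+ t :* s′ :+ c :* (t :* t′)) :* s″ :+ c :*
                  ((s :* t′ :+ t :* s′ :+ c :* (t :* t′)) :* t″)
              := s :* (s′ :* t″ :+ t′ :* s″ :+ c :* (t′ :* t″)) :+ t :* (s′ :* s″ :- t′ :* t″) :+ c :*
                  (t :* (s′ :* t″ :+ t′ :* s″ :+ c :* (t′ :* t″)))) refl c s t s′ t′ s″ t″)
        ; *-identity = identityˡ , (λ x → ≈₂-trans (comm x (1# , 0#)) (identityˡ x))
        ; distrib = (λ x y z → ≈₂-trans (comm x _) (≈₂-trans (distribʳ′ x y z)
            (componentwise (+-cong (fst≈ (comm y x)) (fst≈ (comm z x))) (+-cong (snd≈ (comm y x)) (snd≈ (comm z x))))))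
            , distribʳ′ }
      ; *-comm = comm } }
    where
    ≈₂-trans : ∀ {x y z} → x ≈₂ y → y ≈₂ z → x ≈₂ z
    ≈₂-trans (componentwise e e′) (componentwise f f′) = componentwise (trans e f) (trans e′ f′)
    comm : ∀ x y → mul x y ≈₂ mul y x
    comm (s , t) (s′ , t′) = componentwise
      (solve 4 (λ s t s′ t′ → s :* s′ :- t :* t′ := s′ :* s :- t′ :* t) refl s t s′ t′)
      (solve 5 (λ c s t s′ t′ → s :* t′ :+ t :* s′ :+ c :* (t :* t′)
          := s′ :* t :+ t′ :* s :+ c :* (t′ :* t)) refl c s t s′ t′)
    identityˡ : ∀ x → mul (1# , 0#) x ≈₂ x
    identityˡ (s , t) = componentwise
      (trans (+-cong (*-identityˡ s) (trans (-‿cong (zeroˡ t)) -0#≈0#)) (+-identityʳ s))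
      (trans (+-cong (trans (+-cong (*-identityˡ t) (zeroˡ s)) (+-identityʳ t))
          (trans (*-congˡ (zeroˡ t)) (zeroʳ c))) (+-identityʳ t))
      where open Algebra.Properties.Ring ring using (-0#≈0#)
    distribʳ′ : ∀ x y z → mul (proj₁ y + proj₁ z , proj₂ y + proj₂ z) x ≈₂
        (proj₁ (mul y x) + proj₁ (mul z x) , proj₂ (mul y x) + proj₂ (mul z x))
    distribʳ′ (s , t) (s′ , t′) (s″ , t″) = componentwise
      (solve 6 (λ s t s′ t′ s″ t″ → (s′ :+ s″) :* s :- (t′ :+ t″) :* t
          := (s′ :* s :- t′ :* t) :+ (s″ :* s :- t″ :* t)) refl s t s′ t′ s″ t″)
      (solve 7 (λ c s t s′ t′ s″ t″ → (s′ :+ s″) :* t :+ (t′ :+ t″) :* s :+ c :* ((t′ :+ t″) :* t)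
         := (s′ :* t :+ t′ :* s :+ c :* (t′ :* t)) :+ (s″ :* t :+ t″ :* s :+ c :* (t″ :* t))) refl c s t s′ t′ s″ t″)

  generator : Carrier × Carrier
  generator = 0# , 1#

  -- The roots of `T² − c T + 1` have sum `c` and product 1. The conjugate of `λ` is thus `c − λ`,
  -- and it is also the inverse of `λ`.
  conjugate : Carrier × Carrier → Carrier × Carrier
  conjugate (s , t) = s + c * t , - t

  norm : Carrier × Carrier → Carrier
  norm (s , t) = s * s + c * (s * t) + t * t

  private module Q = CommutativeRing quadraticRing

  conjugate-cong : ∀ {x y} → x ≈₂ y → conjugate x ≈₂ conjugate y
  conjugate-cong (componentwise e e′) = componentwise (+-cong e (*-congˡ e′)) (-‿cong e′)

  conjugate-+ : ∀ x y → conjugate (x Q.+ y) ≈₂ conjugate x Q.+ conjugate y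
  conjugate-+ (s , t) (s′ , t′) = componentwise
    (solve 5 (λ c s t s′ t′ → (s :+ s′) :+ c :* (t :+ t′) := (s :+ c :* t) :+ (s′ :+ c :* t′)) refl c s t s′ t′)
    (solve 2 (λ t t′ → :- (t :+ t′) := :- t :+ :- t′) refl t t′)

  conjugate-* : ∀ x y → conjugate (x Q.* y) ≈₂ conjugate x Q.* conjugate y
  conjugate-* (s , t) (s′ , t′) = componentwise
    (solve 5 (λ c s t s′ t′ → (s :* s′ :- t :* t′) :+ c :* (s :* t′ :+ t :* s′ :+ c :* (t :* t′))
      := (s :+ c :* t) :* (s′ :+ c :* t′) :- (:- t) :* (:- t′)) refl c s t s′ t′)
    (solve 5 (λ c s t s′ t′ → :- (s :* t′ :+ t :* s′ :+ c :* (t :* t′))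
      := (s :+ c :* t) :* (:- t′) :+ (:- t) :* (s′ :+ c :* t′) :+ c :* ((:- t) :* (:- t′))) refl c s t s′ t′)

  conjugate-norm : ∀ x → conjugate x Q.* x ≈₂ (norm x , 0#)
  conjugate-norm (s , t) = componentwise
    (solve 3 (λ c s t → (s :+ c :* t) :* s :- (:- t) :* t := s :* s :+ c :* (s :* t) :+ t :* t) refl c s t)
    (trans (+-cong (+-congˡ (trans (sym (-‿distribˡ-* t s)) (-‿cong (*-comm t s))))
        (trans (*-congˡ (sym (-‿distribˡ-* t t))) (sym (-‿distribʳ-* c _))))
      (trans (solve 4 (λ c s t u → (s :+ c :* t) :* t :- s :* t :- u := c :* (t :* t) :- u) refl c s t _)
          (-‿inverseʳ _)))
    where open Algebra.Properties.Ring ring using (-‿distribˡ-*; -‿distribʳ-*)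

  norm-generator : norm generator ≈ 1#
  norm-generator = trans (+-cong (trans (+-cong (zeroˡ 0#) (trans (*-congˡ (zeroˡ 1#)) (zeroʳ c)))
      (+-identityˡ 0#)) (*-identityˡ 1#)) (+-identityˡ 1#)

  open Algebra.Properties.Semiring.Mult Q.semiring using () renaming (_×_ to _·₂_)

  proj₁-ι : ∀ n → proj₁ (n ·₂ (1# , 0#)) ≈ ι n
  proj₁-ι zero = refl
  proj₁-ι (suc n) = +-congˡ (proj₁-ι n)

  module _ (irreducible : ∀ m → ¬ m * m - c * m + 1# ≈ 0#) where

    -- For nonzero `t` the norm of `s + t λ` is `t² (m² − c m + 1)` with `m = −s/t`, so norm zero
    -- would produce a root of the irreducible polynomial. For `t = 0` the norm is `s²`.
    norm-nonzero : ∀ x → ¬ x ≈₂ (0# , 0#) → ¬ norm x ≈ 0#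
    norm-nonzero (s , t) x≉0 n≈0 with t ≈? 0#
    ... | yes t≈0 = x≉0 (componentwise s≈0 t≈0)
      where
      s*s≈0 : s * s ≈ 0#
      s*s≈0 = trans (sym (trans (+-cong (trans (+-congˡ (trans (*-congˡ (trans (*-congˡ t≈0) (zeroʳ s)))
          (zeroʳ c))) (+-identityʳ _)) (trans (*-congʳ t≈0) (zeroˡ t))) (+-identityʳ _))) n≈0
      s≈0 : s ≈ 0#
      s≈0 with s ≈? 0#
      ... | yes s≈0 = s≈0
      ... | no s≉0 = *-cancelˡ-0 s≉0 s*s≈0
    ... | no t≉0 with inverse t≉0
    ...   | t⁻¹ , t⁻¹t≈1 = irreducible (- (s * t⁻¹)) (begin
      - (s * t⁻¹) * - (s * t⁻¹) - c * - (s * t⁻¹) + 1#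
        ≈⟨ +-cong (+-congˡ (-‿cong (*-congˡ (-‿cong (trans (sym (*-identityʳ _)) (*-congˡ (sym t⁻¹t≈1)))))))
            (trans (sym (*-identityˡ 1#)) (*-cong (sym t⁻¹t≈1) (sym t⁻¹t≈1))) ⟩
      - (s * t⁻¹) * - (s * t⁻¹) - c * - (s * t⁻¹ * (t⁻¹ * t)) + t⁻¹ * t * (t⁻¹ * t)
        ≈⟨ solve 4 (λ c s t i → (:- (s :* i)) :* (:- (s :* i)) :- c :* (:- (s :* i :* (i :* t))) :+ i :* t :* (i :* t)
             := (s :* s :+ c :* (s :* t) :+ t :* t) :* (i :* i)) refl c s t t⁻¹ ⟩
      norm (s , t) * (t⁻¹ * t⁻¹) ≈⟨ trans (*-congʳ n≈0) (zeroˡ _) ⟩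
      0# ∎)
      where open Relation.Binary.Reasoning.Setoid setoid

    quadraticField : Field
    quadraticField = record
      { commutativeRing = quadraticRing
      ; _≈?_ = λ (s , t) (s′ , t′) → map′ (λ (e , e′) → componentwise e e′) (λ e → fst≈ e , snd≈ e)
          ((s ≈? s′) ×-dec (t ≈? t′))
      ; 1≉0 = λ e → 1≉0 (fst≈ e)
      ; inverse = inverse₂ }
      where
      inverse₂ : ∀ {x} → ¬ x ≈₂ (0# , 0#) → ∃[ y ] y Q.* x ≈₂ (1# , 0#)
      inverse₂ {x} x≉0 with inverse (norm-nonzero x x≉0)
      ... | i , in≈1 = (i , 0#) Q.* conjugate x , Q.trans (Q.*-assoc (i , 0#) (conjugate x) x)
          (Q.trans (Q.*-congˡ {i , 0#} (conjugate-norm x)) (componentwise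
          (trans (+-cong in≈1 (trans (-‿cong (zeroˡ 0#)) -0#≈0#)) (+-identityʳ 1#))
          (trans (+-cong (trans (+-cong (zeroʳ i) (zeroˡ _)) (+-identityˡ 0#))
              (trans (*-congˡ (zeroˡ 0#)) (zeroʳ c))) (+-identityˡ 0#))))
        where open Algebra.Properties.Ring ring using (-0#≈0#)

-- The powers of `A` as elements of the quadratic extension.

open import Defs
open import Data.Nat using (_+_; _*_; _^_)

mod≡% : ∀ x q .{{_ : NonZero q}} → x mod q ≡ x % q
mod≡% x (suc q) = ≡.refl

mat-≡ : ∀ {A B} → a A ≡ a B → b A ≡ b B → c A ≡ c B → d A ≡ d B → A ≡ B
mat-≡ ≡.refl ≡.refl ≡.refl ≡.refl = ≡.refl

indicator-≤ : ∀ A B {P : Set} (P? : Dec P) → (A ≡ B → P) → indicator A B ≤ 𝟙 P?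
indicator-≤ A B P? h with A ≟M B
... | yes A≡B = ℕₚ.≤-reflexive (≡.sym (𝟙-true P? (h A≡B)))
... | no _ = z≤n

module MatrixPowers (p : ℕ) (isPrime : Prime p) (A : Mat) (reduced : Reduced p A) (det : InSL2 p A)
    (noEigenvalue : NoEigenvalueInFp p A) where
  private
    instance
      p≢0 : NonZero p
      p≢0 = prime⇒nonZero isPrime
    module 𝔽 = PrimeField p isPrime
    open 𝔽 using (_≈_; ≈-%ℕ; ≈-+multiple; ≈⇒≡; below-p-nonzero)
    module Z = Field 𝔽.primeField
    open RingSolver 𝔽.ring
    α β′ γ′ δ : ℤ
    α = + a A
    β′ = + b A
    γ′ = + c A
    δ = + d A
  open QuadraticExtension 𝔽.primeField (α ℤ.+ δ)

  private
    mod< : ∀ x → x mod p < p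
    mod< x = ≡.subst (_< p) (≡.sym (mod≡% x p)) (m%n<n x p)

    +mod : ∀ x → + (x mod p) ≈ + x
    +mod x = ≡.subst (λ r → + r ≈ + x) (≡.sym (mod≡% x p)) (Z.sym (≈-%ℕ (+ x)))

    mod⇒≈ : ∀ {x y} → x mod p ≡ y mod p → + x ≈ + y
    mod⇒≈ {x} {y} e = Z.trans (Z.sym (+mod x)) (Z.trans (Z.reflexive (≡.cong +_ e)) (+mod y))

    ≈⇒mod : ∀ {x y} → + x ≈ + y → x mod p ≡ y mod p
    ≈⇒mod {x} {y} e = ≈⇒≡ (mod< x) (mod< y) (Z.trans (+mod x) (Z.trans e (Z.sym (+mod y))))

    +p≈0 : + p ≈ + 0
    +p≈0 = ≈-+multiple (+ 1) (≡.trans (≡.sym (ℤₚ.*-identityˡ (+ p))) (≡.sym (ℤₚ.+-identityˡ _)))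

    pos-∸ : ∀ {l} → l ≤ p → + (p ℕ.∸ l) ≈ ℤ.- + l
    pos-∸ {l} l≤p = Z.trans (Z.reflexive (≡.trans (≡.sym (ℤₚ.⊖-≥ l≤p)) (≡.sym (ℤₚ.m-n≡m⊖n p l))))
      (Z.trans (Z.+-congʳ { ℤ.- + l} +p≈0) (Z.+-identityˡ (ℤ.- + l)))

    pos-[x+y]*[z+y] : ∀ x y z → + ((x + y) * (z + y)) ≡ (+ x ℤ.+ + y) ℤ.* (+ z ℤ.+ + y)
    pos-[x+y]*[z+y] x y z = ≡.trans (ℤₚ.pos-* (x + y) (z + y)) (≡.cong₂ ℤ._*_ (ℤₚ.pos-+ x y) (ℤₚ.pos-+ z y))

    det≈ : α ℤ.* δ ≈ β′ ℤ.* γ′ ℤ.+ + 1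
    det≈ = Z.trans (Z.reflexive (≡.sym (ℤₚ.pos-* (a A) (d A)))) (Z.trans (mod⇒≈ det)
      (Z.reflexive (≡.trans (ℤₚ.pos-+ (b A * c A) 1) (≡.cong (ℤ._+ + 1) (ℤₚ.pos-* (b A) (c A))))))

  -- As the determinant is 1, the characteristic polynomial of `A` is `m² − (α + δ) m + 1`. A root
  -- of it modulo `p`, reduced to the range below `p`, would be an eigenvalue excluded by
  -- hypothesis.
  irreducible : ∀ m → ¬ m ℤ.* m ℤ.- (α ℤ.+ δ) ℤ.* m ℤ.+ + 1 ≈ + 0
  irreducible m e = noEigenvalue (m %ℕ p) (n%ℕd<d m p) (≈⇒mod (begin
    + ((a A + (p ℕ.∸ l)) * (d A + (p ℕ.∸ l))) ≈⟨ Z.reflexive (pos-[x+y]*[z+y] (a A) (p ℕ.∸ l) (d A)) ⟩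
    (α ℤ.+ + (p ℕ.∸ l)) ℤ.* (δ ℤ.+ + (p ℕ.∸ l))
        ≈⟨ Z.*-cong {α ℤ.+ + (p ℕ.∸ l)} {α ℤ.- m} {δ ℤ.+ + (p ℕ.∸ l)} {δ ℤ.- m} (Z.+-congˡ {α} -l≈-m)
            (Z.+-congˡ {δ} -l≈-m) ⟩
    (α ℤ.- m) ℤ.* (δ ℤ.- m)
        ≈⟨ solve 4 (λ a d m o → (a :- m) :* (d :- m) := (a :* d :- o) :+
            (m :* m :- (a :+ d) :* m :+ o)) Z.refl α δ m (+ 1) ⟩
    (α ℤ.* δ ℤ.- + 1) ℤ.+ (m ℤ.* m ℤ.- (α ℤ.+ δ) ℤ.* m ℤ.+ + 1) ≈⟨ Z.+-cong (Z.+-congʳ { ℤ.- + 1} det≈) e ⟩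
    (β′ ℤ.* γ′ ℤ.+ + 1 ℤ.- + 1) ℤ.+ + 0 ≈⟨ Z.+-identityʳ (β′ ℤ.* γ′ ℤ.+ + 1 ℤ.- + 1) ⟩
    β′ ℤ.* γ′ ℤ.+ + 1 ℤ.- + 1 ≈⟨ solve 2 (λ x o → x :+ o :- o := x) Z.refl (β′ ℤ.* γ′) (+ 1) ⟩
    β′ ℤ.* γ′ ≈⟨ Z.reflexive (≡.sym (ℤₚ.pos-* (b A) (c A))) ⟩
    + (b A * c A) ∎))
    where
    open Relation.Binary.Reasoning.Setoid Z.setoid
    l : ℕ
    l = m %ℕ p
    -l≈-m : + (p ℕ.∸ l) ≈ ℤ.- m
    -l≈-m = Z.trans (pos-∸ (ℕₚ.<⇒≤ (n%ℕd<d m p))) (Z.-‿cong (Z.sym (≈-%ℕ m)))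

  private
    -- With `b = 0` the matrix would be triangular and its entry `a` an eigenvalue in the prime
    -- field.
    b≉0 : ¬ β′ ≈ + 0
    b≉0 e = noEigenvalue (a A) (proj₁ reduced) (≈⇒mod (Z.trans left
        (Z.sym (Z.trans (Z.reflexive (ℤₚ.pos-* (b A) (c A))) (Z.trans (Z.*-congʳ e) (Z.zeroˡ γ′))))))
      where
      left : + ((a A + (p ℕ.∸ a A)) * (d A + (p ℕ.∸ a A))) ≈ + 0
      left = Z.trans (Z.reflexive (≡.trans (≡.cong (λ k → + (k * (d A + (p ℕ.∸ a A))))
          (ℕₚ.m+[n∸m]≡n (ℕₚ.<⇒≤ (proj₁ reduced)))) (ℤₚ.pos-* p _)))
        (Z.trans (Z.*-congʳ +p≈0) (Z.zeroˡ (+ (d A + (p ℕ.∸ a A)))))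

  K : Field
  K = quadraticField irreducible
  module K = Field K

  λ^ : ℕ → K.Carrier
  λ^ n = generator K.^ n

  private
    -- `B` is congruent to `s I + t A` for `x = s + t λ`: the identification of the algebra
    -- generated by `A` with the quadratic extension.
    record Represents (B : Mat) (x : K.Carrier) : Set where
      field
        a≈ : + a B ≈ proj₁ x ℤ.+ proj₂ x ℤ.* α
        b≈ : + b B ≈ proj₂ x ℤ.* β′
        c≈ : + c B ≈ proj₂ x ℤ.* γ′
        d≈ : + d B ≈ proj₁ x ℤ.+ proj₂ x ℤ.* δ
    open Represents

    entry : ∀ x y z w → + ((x * y + z * w) mod p) ≈ + x ℤ.* + y ℤ.+ + z ℤ.* + w
    entry x y z w = Z.trans (+mod _) (Z.reflexive (≡.trans (ℤₚ.pos-+ (x * y) (z * w))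
        (≡.cong₂ ℤ._+_ (ℤₚ.pos-* x y) (ℤₚ.pos-* z w))))

    -- The Cayley-Hamilton relation `A² = (α + δ) A − I`. Off the diagonal it is an identity of
    -- integers; on the diagonal it needs the determinant, which enters through `correction`.
    step : ∀ B x → Represents B x → Represents (mul p A B) (generator K.* x)
    step B (s , t) r = record
      { a≈ = Z.trans (entry (a A) (a B) (b A) (c B)) (Z.trans (Z.+-cong (Z.*-congˡ {α} (a≈ r)) (Z.*-congˡ {β′} (c≈ r)))
          (correction (lemma₁ α β′ γ′ δ s t)))
      ; b≈ = Z.trans (entry (a A) (b B) (b A) (d B)) (Z.trans (Z.+-cong (Z.*-congˡ {α} (b≈ r)) (Z.*-congˡ {β′} (d≈ r)))
          (Z.reflexive (lemma₂ α β′ δ s t)))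
      ; c≈ = Z.trans (entry (c A) (a B) (d A) (c B)) (Z.trans (Z.+-cong (Z.*-congˡ {γ′} (a≈ r)) (Z.*-congˡ {δ} (c≈ r)))
          (Z.reflexive (lemma₃ α γ′ δ s t)))
      ; d≈ = Z.trans (entry (c A) (b B) (d A) (d B)) (Z.trans (Z.+-cong (Z.*-congˡ {γ′} (b≈ r)) (Z.*-congˡ {δ} (d≈ r)))
          (correction (lemma₄ α β′ γ′ δ s t))) }
      where
      correction : ∀ {x y} → x ≡ y ℤ.+ t ℤ.* ((β′ ℤ.* γ′ ℤ.+ + 1) ℤ.- α ℤ.* δ) → x ≈ y
      correction {x} {y} e = Z.trans (Z.reflexive e) (Z.trans (Z.+-congˡ {y} (Z.trans (Z.*-congˡ {t}
        (Z.trans (Z.+-congˡ {β′ ℤ.* γ′ ℤ.+ + 1} (Z.-‿cong det≈)) (Z.-‿inverseʳ (β′ ℤ.* γ′ ℤ.+ + 1)))) (Z.zeroʳ t)))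
            (Z.+-identityʳ y))
      lemma₁ : ∀ a b c d s t → a ℤ.* (s ℤ.+ t ℤ.* a) ℤ.+ b ℤ.* (t ℤ.* c) ≡
        ((+ 0 ℤ.* s ℤ.- + 1 ℤ.* t) ℤ.+ (+ 0 ℤ.* t ℤ.+ + 1 ℤ.* s ℤ.+ (a ℤ.+ d) ℤ.* (+ 1 ℤ.* t)) ℤ.* a) ℤ.+ t ℤ.*
            ((b ℤ.* c ℤ.+ + 1) ℤ.- a ℤ.* d)
      lemma₁ = ℤ-Solver.solve-∀
      lemma₂ : ∀ a b d s t → a ℤ.* (t ℤ.* b) ℤ.+ b ℤ.* (s ℤ.+ t ℤ.* d) ≡
          (+ 0 ℤ.* t ℤ.+ + 1 ℤ.* s ℤ.+ (a ℤ.+ d) ℤ.* (+ 1 ℤ.* t)) ℤ.* b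
      lemma₂ = ℤ-Solver.solve-∀
      lemma₃ : ∀ a c d s t → c ℤ.* (s ℤ.+ t ℤ.* a) ℤ.+ d ℤ.* (t ℤ.* c) ≡
          (+ 0 ℤ.* t ℤ.+ + 1 ℤ.* s ℤ.+ (a ℤ.+ d) ℤ.* (+ 1 ℤ.* t)) ℤ.* c
      lemma₃ = ℤ-Solver.solve-∀
      lemma₄ : ∀ a b c d s t → c ℤ.* (t ℤ.* b) ℤ.+ d ℤ.* (s ℤ.+ t ℤ.* d) ≡
        ((+ 0 ℤ.* s ℤ.- + 1 ℤ.* t) ℤ.+ (+ 0 ℤ.* t ℤ.+ + 1 ℤ.* s ℤ.+ (a ℤ.+ d) ℤ.* (+ 1 ℤ.* t)) ℤ.* d) ℤ.+ t ℤ.*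
            ((b ℤ.* c ℤ.+ + 1) ℤ.- a ℤ.* d)
      lemma₄ = ℤ-Solver.solve-∀

    pow-represents : ∀ n → Represents (pow p A n) (λ^ n)
    pow-represents zero = record { a≈ = +mod 1 ; b≈ = Z.refl ; c≈ = Z.refl ; d≈ = +mod 1 }
    pow-represents (suc n) = step (pow p A n) (λ^ n) (pow-represents n)

    add-represents : ∀ {B B′ x x′} → Represents B x → Represents B′ x′ → Represents (add p B B′) (x K.+ x′)
    add-represents {B} {B′} {s , t} {s′ , t′} r r′ = record
      { a≈ = sum₁ (a≈ r) (a≈ r′) ; b≈ = sum₂ (b≈ r) (b≈ r′) ; c≈ = sum₂ (c≈ r) (c≈ r′) ; d≈ = sum₁ (d≈ r) (d≈ r′) }
      where
      plus : ∀ {x y u v} → + x ≈ u → + y ≈ v → + ((x + y) mod p) ≈ u ℤ.+ v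
      plus {x} {y} e e′ = Z.trans (+mod (x + y)) (Z.trans (Z.reflexive (ℤₚ.pos-+ x y)) (Z.+-cong e e′))
      sum₁ : ∀ {x y z} → + x ≈ s ℤ.+ t ℤ.* z → + y ≈ s′ ℤ.+ t′ ℤ.* z → + ((x + y) mod p) ≈ s ℤ.+ s′ ℤ.+ (t ℤ.+ t′) ℤ.* z
      sum₁ {z = z} e e′ = Z.trans (plus e e′) (Z.reflexive (lemma s s′ t t′ z))
        where lemma : ∀ s s′ t t′ z → (s ℤ.+ t ℤ.* z) ℤ.+ (s′ ℤ.+ t′ ℤ.* z) ≡ s ℤ.+ s′ ℤ.+ (t ℤ.+ t′) ℤ.* z
              lemma = ℤ-Solver.solve-∀
      sum₂ : ∀ {x y z} → + x ≈ t ℤ.* z → + y ≈ t′ ℤ.* z → + ((x + y) mod p) ≈ (t ℤ.+ t′) ℤ.* z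
      sum₂ {z = z} e e′ = Z.trans (plus e e′) (Z.reflexive (≡.sym (ℤₚ.*-distribʳ-+ z t t′)))

    -- The upper right entry is `t β′` with `β′` invertible, so it yields `t`; the upper left entry
    -- then yields `s`.
    represents-injective : ∀ {B B′ x x′} → Represents B x → Represents B′ x′ → B ≡ B′ → x ≈₂ x′
    represents-injective {B} {B′} {s , t} {s′ , t′} r r′ ≡.refl = componentwise s≈ t≈
      where
      open Algebra.Properties.Ring Z.ring using (x∙y⁻¹≈ε⇒x≈y; +-cancelʳ)
      t≈ : t ≈ t′
      t≈ = x∙y⁻¹≈ε⇒x≈y t t′ (Z.*-cancelˡ-0 b≉0 (Z.trans (solve 3
          (λ b t t′ → b :* (t :- t′) := t :* b :- t′ :* b) Z.refl β′ t t′)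
        (Z.trans (Z.+-congʳ { ℤ.- (t′ ℤ.* β′)} (Z.trans (Z.sym (b≈ r)) (b≈ r′))) (Z.-‿inverseʳ (t′ ℤ.* β′)))))
      s≈ : s ≈ s′
      s≈ = +-cancelʳ (t ℤ.* α) s s′ (Z.trans (Z.sym (a≈ r)) (Z.trans (a≈ r′) (Z.+-congˡ {s′} (Z.*-congʳ (Z.sym t≈)))))

    pow-reduced : ∀ n → Reduced p (pow p A n)
    pow-reduced zero = mod< 1 , ℕ.>-nonZero⁻¹ p , ℕ.>-nonZero⁻¹ p , mod< 1
    pow-reduced (suc n) = mod< _ , mod< _ , mod< _ , mod< _

  pow≡⇒λ^≈ : ∀ i j → pow p A i ≡ pow p A j → λ^ i ≈₂ λ^ j
  pow≡⇒λ^≈ i j = represents-injective (pow-represents i) (pow-represents j)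

  -- Equality in the extension only gives congruent entries; they are equal because powers have
  -- entries below `p`.
  λ^≈⇒pow≡ : ∀ i j → λ^ i ≈₂ λ^ j → pow p A i ≡ pow p A j
  λ^≈⇒pow≡ i j (componentwise s≈ t≈) = mat-≡
    (≈⇒≡ (proj₁ (pow-reduced i)) (proj₁ (pow-reduced j)) (Z.trans (a≈ r)
        (Z.trans (Z.+-cong s≈ (Z.*-congʳ t≈)) (Z.sym (a≈ r′)))))
    (≈⇒≡ (proj₁ (proj₂ (pow-reduced i))) (proj₁ (proj₂ (pow-reduced j)))
        (Z.trans (b≈ r) (Z.trans (Z.*-congʳ t≈) (Z.sym (b≈ r′)))))
    (≈⇒≡ (proj₁ (proj₂ (proj₂ (pow-reduced i)))) (proj₁ (proj₂ (proj₂ (pow-reduced j))))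
        (Z.trans (c≈ r) (Z.trans (Z.*-congʳ t≈) (Z.sym (c≈ r′)))))
    (≈⇒≡ (proj₂ (proj₂ (proj₂ (pow-reduced i)))) (proj₂ (proj₂ (proj₂ (pow-reduced j))))
        (Z.trans (d≈ r) (Z.trans (Z.+-cong s≈ (Z.*-congʳ t≈)) (Z.sym (d≈ r′)))))
    where
    r = pow-represents i
    r′ = pow-represents j

  sum≡⇒λ^-sum≈ : ∀ x y z x′ y′ z′ →
    add p (add p (pow p A x) (pow p A y)) (pow p A z) ≡ add p (add p (pow p A x′) (pow p A y′)) (pow p A z′) →
    λ^ x K.+ (λ^ y K.+ λ^ z) ≈₂ λ^ x′ K.+ (λ^ y′ K.+ λ^ z′)
  sum≡⇒λ^-sum≈ x y z x′ y′ z′ e = K.trans (K.sym (K.+-assoc (λ^ x) (λ^ y) (λ^ z))) (K.trans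
    (represents-injective (represents x y z) (represents x′ y′ z′) e) (K.+-assoc (λ^ x′) (λ^ y′) (λ^ z′)))
    where
    represents : ∀ x y z → Represents (add p (add p (pow p A x) (pow p A y)) (pow p A z)) (λ^ x K.+ λ^ y K.+ λ^ z)
    represents x y z = add-represents (add-represents (pow-represents x) (pow-represents y)) (pow-represents z)

  λ^-unit : ∀ i → conjugate (λ^ i) K.* λ^ i ≈₂ K.1#
  λ^-unit i = K.trans (K.*-congʳ (conjugate-^ i)) (K.trans (K.sym (^-distrib-* (conjugate generator) generator i))
    (K.trans (^-congˡ i (K.trans (conjugate-norm generator) (componentwise norm-generator Z.refl))) (K.1^ i)))
    where
    open Algebra.Properties.CommutativeSemiring.Exp K.commutativeSemiring using (^-distrib-*)
    open Algebra.Properties.Semiring.Exp K.semiring using (^-congˡ)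
    conjugate-^ : ∀ n → conjugate (λ^ n) ≈₂ conjugate generator K.^ n
    conjugate-^ zero = componentwise (Z.trans (Z.+-congˡ {+ 1} (Z.zeroʳ (α ℤ.+ δ))) (Z.+-identityʳ (+ 1))) Z.refl
    conjugate-^ (suc n) = K.trans (conjugate-* generator (λ^ n)) (K.*-congˡ {conjugate generator} (conjugate-^ n))

  ι-nonzero : ∀ k → 0 < k → k < p → ¬ K.ι k K.≈ K.0#
  ι-nonzero k 0<k k<p e = below-p-nonzero 0<k k<p (Z.trans (Z.sym (Z.trans (proj₁-ι k) (Z.reflexive (ι≡+ k)))) (fst≈ e))
    where
    ι≡+ : ∀ n → Z.ι n ≡ + n
    ι≡+ zero = ≡.refl
    ι≡+ (suc n) = ≡.cong (ℤ._+_ (+ 1)) (ι≡+ n)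

  module _ (τ : ℕ) (order : IsOrder p A τ) where
    private
      1≤τ : 1 ≤ τ
      1≤τ = proj₁ order

      λ^τ≈1 : λ^ τ ≈₂ K.1#
      λ^τ≈1 = pow≡⇒λ^≈ τ 0 (proj₁ (proj₂ order))

      ∈-range1 : ∀ {i} → i ∈ range1 τ → 1 ≤ i × i ≤ τ
      ∈-range1 i∈ with ∈-map⁻ suc i∈
      ... | j , j∈ , ≡.refl = s≤s z≤n , ∈-upTo⁻ j∈

      -- Multiplying by the conjugate of `λ^ i`, which is its inverse, leaves `λ^ (j − i) = 1`.
      -- Since exponents start at 1, `j − i` is less than `τ`, against the minimality of the order.
      incongruent : ∀ {i j} → 1 ≤ i → i < j → j ≤ τ → ¬ λ^ i ≈₂ λ^ j
      incongruent {i} {j} 1≤i i<j j≤τ e = proj₂ (proj₂ order) (j ℕ.∸ i) (ℕₚ.m<n⇒0<n∸m i<j)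
        (ℕₚ.<-≤-trans (ℕₚ.∸-monoʳ-< {j} 1≤i (ℕₚ.<⇒≤ i<j)) j≤τ) (λ^≈⇒pow≡ (j ℕ.∸ i) 0 unit)
        where
        open Algebra.Properties.Semiring.Exp K.semiring using (^-homo-*)
        unit : λ^ (j ℕ.∸ i) ≈₂ K.1#
        unit = K.trans (K.sym (K.*-identityˡ _)) (K.trans (K.*-congʳ (K.sym (λ^-unit i)))
            (K.trans (K.*-assoc (conjugate (λ^ i)) (λ^ i) _)
          (K.trans (K.*-congˡ {conjugate (λ^ i)} (K.trans (K.sym (^-homo-* generator i (j ℕ.∸ i)))
            (K.trans (K.reflexive (≡.cong λ^ (ℕₚ.m+[n∸m]≡n (ℕₚ.<⇒≤ i<j)))) (K.sym e)))) (λ^-unit i))))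

      λ^-injective : ∀ {i j} → i ∈ range1 τ → j ∈ range1 τ → λ^ i ≈₂ λ^ j → i ≡ j
      λ^-injective {i} {j} i∈ j∈ e with ℕₚ.<-cmp i j
      ... | tri< i<j _ _ = contradiction e (incongruent (proj₁ (∈-range1 i∈)) i<j (proj₂ (∈-range1 j∈)))
      ... | tri≈ _ i≡j _ = i≡j
      ... | tri> _ _ j<i = contradiction (K.sym e) (incongruent (proj₁ (∈-range1 j∈)) j<i (proj₂ (∈-range1 i∈)))

      λ^-order : ∀ i → λ^ i K.^ τ ≈₂ K.1#
      λ^-order i = K.trans (^-assocʳ generator i τ) (K.trans (K.reflexive (≡.cong λ^ (ℕₚ.*-comm i τ)))
        (K.trans (K.sym (^-assocʳ generator τ i)) (K.trans (^-congˡ i λ^τ≈1) (K.1^ i))))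
        where
        open Algebra.Properties.Semiring.Exp K.semiring using (^-assocʳ; ^-congˡ)

    module E = TripleEnergy K τ (range1 τ) (Uniqueₚ.map⁺ ℕₚ.suc-injective (Uniqueₚ.upTo⁺ τ))
      (≡.trans (Listₚ.length-map suc (upTo τ)) (Listₚ.length-upTo τ)) λ^ λ^-injective λ^-order
      conjugate conjugate-cong conjugate-+ λ^-unit 1≤τ

    F2≤energy : F2 p A τ ≤ E.energy
    F2≤energy = ∑ₗ-mono (range1 τ) λ {x} _ → ∑ₗ-mono (range1 τ) λ {y} _ → ∑ₗ-mono (range1 τ) λ {z} _ →
      ∑ₗ-mono (range1 τ) λ {x′} _ → ∑ₗ-mono (range1 τ) λ {y′} _ → ∑ₗ-mono (range1 τ) λ {z′} _ →
      indicator-≤ _ _ (λ^ x K.+ (λ^ y K.+ λ^ z) K.≈? λ^ x′ K.+ (λ^ y′ K.+ λ^ z′)) (sum≡⇒λ^-sum≈ x y z x′ y′ z′)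

    F2-bound : ∀ β → β ≤ τ → (2 ≤ β → β * β * β * 2 ≤ τ) → (2 ≤ β → τ * (β + β) ≤ p) →
        F2 p A τ * β ≤ 21 * (τ * τ * τ * τ)
    F2-bound β β≤τ small 2τβ≤p = ℕₚ.≤-trans (ℕₚ.*-monoˡ-≤ β F2≤energy)
      (E.energy-bound β β≤τ small λ 2≤β k 0<k k< → ι-nonzero k 0<k (ℕₚ.<-≤-trans k< (2τβ≤p 2≤β)))

-- Choice of `β` and conclusion.

^-distribʳ-* : ∀ n x y → (x * y) ^ n ≡ x ^ n * y ^ n
^-distribʳ-* zero x y = ≡.refl
^-distribʳ-* (suc n) x y = ≡.trans (≡.cong (x * y *_) (^-distribʳ-* n x y)) (arith x y (x ^ n) (y ^ n))
  where arith : ∀ a b c d → a * b * (c * d) ≡ a * c * (b * d)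
        arith = solve-∀

module Parameter (p τ : ℕ) (1≤τ : 1 ≤ τ) where
  -- The fifth power is chosen so that `τ⁴/β` becomes `τ^(19/5)` when the first condition is the one
  -- that stops `β`; when the second does, `β` is of size `p/τ` and `τ⁴/β` becomes `τ⁵/p`.
  Admissible : ℕ → Set
  Admissible β = β ^ 5 ≤ τ × τ * (β + β) ≤ p

  admissible? : ∀ β → Dec (Admissible β)
  admissible? β = (β ^ 5 ℕ.≤? τ) ×-dec (τ * (β + β) ℕ.≤? p)

  n≤n^5 : ∀ n → n ≤ n ^ 5
  n≤n^5 zero = z≤n
  n≤n^5 n@(suc _) = ℕₚ.m≤m*n n (n ^ 4) {{ℕₚ.m^n≢0 n 4}}

  -- The value 1 is accepted even when it is not admissible, so an optimal `β` always exists. Of its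
  -- maximality only the failure at `suc β` is recorded, which is what `conclude` exploits.
  record Optimal : Set where
    field
      β : ℕ
      1≤β : 1 ≤ β
      valid : β ≡ 1 ⊎ Admissible β
      maximal : ¬ Admissible (suc β)

  -- `β + fuel` stays at least `τ`. When the fuel is spent `suc β` cannot be admissible, as that
  -- would give `suc β ≤ (suc β)^5 ≤ τ ≤ β`.
  search : ∀ fuel β → 1 ≤ β → β ≡ 1 ⊎ Admissible β → τ ≤ β + fuel → Optimal
  search fuel β 1≤β valid enough with admissible? (suc β)
  ... | no bad = record { β = β ; 1≤β = 1≤β ; valid = valid ; maximal = bad }
  search zero β 1≤β valid enough | yes (β^5≤τ , _) = contradiction
    (ℕₚ.≤-trans (n≤n^5 (suc β)) (ℕₚ.≤-trans β^5≤τ (≡.subst (τ ≤_) (ℕₚ.+-identityʳ β) enough))) (ℕₚ.<-irrefl ≡.refl)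
  search (suc fuel) β 1≤β valid enough | yes good =
      search fuel (suc β) (s≤s z≤n) (inj₂ good) (≡.subst (τ ≤_) (ℕₚ.+-suc β fuel) enough)

  optimal : Optimal
  optimal = search τ 1 ℕₚ.≤-refl (inj₁ ≡.refl) (ℕₚ.m≤n+m τ 1)

  open Optimal optimal public

  β≤τ : β ≤ τ
  β≤τ with valid
  ... | inj₁ β≡1 = ≡.subst (_≤ τ) (≡.sym β≡1) 1≤τ
  ... | inj₂ (β^5≤τ , _) = ℕₚ.≤-trans (n≤n^5 β) β^5≤τ

  2≤β⇒admissible : 2 ≤ β → Admissible β
  2≤β⇒admissible 2≤β with valid
  ... | inj₁ β≡1 = contradiction (≡.subst (2 ≤_) β≡1 2≤β) λ { (s≤s ()) }
  ... | inj₂ good = good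

  -- `2 ≤ β²`, so `2 β³ ≤ β⁵ ≤ τ`.
  small : 2 ≤ β → β * β * β * 2 ≤ τ
  small 2≤β = ℕₚ.≤-trans (ℕₚ.≤-trans (ℕₚ.*-monoʳ-≤ (β * β * β) (ℕₚ.≤-trans 2≤β (ℕₚ.m≤m*n β β {{ℕ.>-nonZero 1≤β}})))
      (ℕₚ.≤-reflexive (arith β))) (proj₁ (2≤β⇒admissible 2≤β))
    where
    arith : ∀ b → b * b * b * (b * b) ≡ b * (b * (b * (b * (b * 1))))
    arith = solve-∀

  -- The two alternatives produce the terms τ^(19/5) and τ⁵/p respectively.
  conclude : ∀ F k → F * β ≤ k * (τ * τ * τ * τ) → F ^ 5 * p ^ 5 ≤ (4 * k) ^ 5 * (τ ^ 19 * p ^ 5 + τ ^ 25)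
  conclude F k Fβ≤ with suc β ^ 5 ℕ.≤? τ | τ * (suc β + suc β) ℕ.≤? p
  ... | yes e | yes e′ = contradiction (e , e′) maximal
  ... | no τ< | _ = begin
      F ^ 5 * p ^ 5
          ≤⟨ ℕₚ.*-monoˡ-≤ (p ^ 5) (ℕₚ.*-cancelʳ-≤ (F ^ 5) ((4 * k) ^ 5 * τ ^ 19) τ {{ℕ.>-nonZero 1≤τ}} bound) ⟩
      (4 * k) ^ 5 * τ ^ 19 * p ^ 5 ≡⟨ ℕₚ.*-assoc ((4 * k) ^ 5) (τ ^ 19) (p ^ 5) ⟩
      (4 * k) ^ 5 * (τ ^ 19 * p ^ 5) ≤⟨ ℕₚ.*-monoʳ-≤ ((4 * k) ^ 5) (ℕₚ.m≤m+n (τ ^ 19 * p ^ 5) (τ ^ 25)) ⟩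
      (4 * k) ^ 5 * (τ ^ 19 * p ^ 5 + τ ^ 25) ∎
    where
    open ℕₚ.≤-Reasoning
    -- The factor 4 is the one the other alternative obtains from `suc β + suc β`, so that both end
    -- with the same constant.
    1+β≤4β : suc β ≤ 4 * β
    1+β≤4β = ℕₚ.≤-trans (ℕₚ.+-monoˡ-≤ β 1≤β) (ℕₚ.+-monoʳ-≤ β (ℕₚ.m≤m+n β (β + (β + 0))))
    F4β≤ : F * (4 * β) ≤ 4 * k * τ ^ 4
    F4β≤ = ≡.subst₂ _≤_ (arith₁ F β) (arith₂ k τ) (ℕₚ.*-monoʳ-≤ 4 Fβ≤)
      where
      arith₁ : ∀ f b → 4 * (f * b) ≡ f * (4 * b)
      arith₁ = solve-∀
      arith₂ : ∀ k t → 4 * (k * (t * t * t * t)) ≡ 4 * k * (t * (t * (t * (t * 1))))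
      arith₂ = solve-∀
    -- The failure of `(suc β)^5 ≤ τ` replaces the factor `τ` by the fifth power of `4 * β`, which
    -- merges with `F ^ 5`. The result has `τ^20`, and cancelling `τ` leaves `τ^19`.
    bound : F ^ 5 * τ ≤ (4 * k) ^ 5 * τ ^ 19 * τ
    bound = begin
      F ^ 5 * τ ≤⟨ ℕₚ.*-monoʳ-≤ (F ^ 5) (ℕₚ.≤-trans (ℕₚ.<⇒≤ (ℕₚ.≰⇒> τ<)) (ℕₚ.^-monoˡ-≤ 5 1+β≤4β)) ⟩
      F ^ 5 * (4 * β) ^ 5 ≡⟨ ^-distribʳ-* 5 F (4 * β) ⟨
      (F * (4 * β)) ^ 5 ≤⟨ ℕₚ.^-monoˡ-≤ 5 F4β≤ ⟩
      (4 * k * τ ^ 4) ^ 5 ≡⟨ ^-distribʳ-* 5 (4 * k) (τ ^ 4) ⟩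
      (4 * k) ^ 5 * (τ ^ 4) ^ 5 ≡⟨ ≡.cong ((4 * k) ^ 5 *_) (≡.trans (ℕₚ.^-*-assoc τ 4 5) (ℕₚ.*-comm τ (τ ^ 19))) ⟩
      (4 * k) ^ 5 * (τ ^ 19 * τ) ≡⟨ ℕₚ.*-assoc ((4 * k) ^ 5) (τ ^ 19) τ ⟨
      (4 * k) ^ 5 * τ ^ 19 * τ ∎
  ... | yes _ | no p< = begin
      F ^ 5 * p ^ 5 ≡⟨ ^-distribʳ-* 5 F p ⟨
      (F * p) ^ 5 ≤⟨ ℕₚ.^-monoˡ-≤ 5 Fp≤ ⟩
      (4 * k * τ ^ 5) ^ 5 ≡⟨ ≡.trans (^-distribʳ-* 5 (4 * k) (τ ^ 5)) (≡.cong ((4 * k) ^ 5 *_) (ℕₚ.^-*-assoc τ 5 5)) ⟩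
      (4 * k) ^ 5 * τ ^ 25 ≤⟨ ℕₚ.*-monoʳ-≤ ((4 * k) ^ 5) (ℕₚ.m≤n+m (τ ^ 25) (τ ^ 19 * p ^ 5)) ⟩
      (4 * k) ^ 5 * (τ ^ 19 * p ^ 5 + τ ^ 25) ∎
    where
    open ℕₚ.≤-Reasoning
    p≤ : p ≤ τ * (4 * β)
    p≤ = ℕₚ.≤-trans (ℕₚ.<⇒≤ (ℕₚ.≰⇒> p<)) (ℕₚ.*-monoʳ-≤ τ (ℕₚ.≤-trans
        (ℕₚ.+-mono-≤ (ℕₚ.+-monoˡ-≤ β 1≤β) (ℕₚ.+-monoˡ-≤ β 1≤β)) (ℕₚ.≤-reflexive (arith β))))
      where
      arith : ∀ b → (b + b) + (b + b) ≡ 4 * b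
      arith = solve-∀
    Fp≤ : F * p ≤ 4 * k * τ ^ 5
    Fp≤ = ℕₚ.≤-trans (ℕₚ.*-monoʳ-≤ F p≤) (≡.subst₂ _≤_ (arith₁ F β τ) (arith₂ k τ) (ℕₚ.*-monoʳ-≤ (4 * τ) Fβ≤))
      where
      arith₁ : ∀ f b t → 4 * t * (f * b) ≡ f * (t * (4 * b))
      arith₁ = solve-∀
      arith₂ : ∀ k t → 4 * t * (k * (t * t * t * t)) ≡ 4 * k * (t * (t * (t * (t * (t * 1)))))
      arith₂ = solve-∀

-- The asymptotic bound in natural numbers, multiplied by `p` and raised to the fifth power. The
-- fifth power of a sum of two nonnegative numbers lies between the sum of their fifth powers and 16
-- times that sum, so only the absolute constant is affected.
theorem2p3 : ∃[ C ] ((p : ℕ) → Prime p → (A : Mat) → Reduced p A → InSL2 p A →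
    NoEigenvalueInFp p A → (τ : ℕ) → IsOrder p A τ →
    F2 p A τ ^ 5 * p ^ 5 ≤ C * (τ ^ 19 * p ^ 5 + τ ^ 25))
theorem2p3 = (4 * 21) ^ 5 , λ p isPrime A reduced det noEigenvalue τ order →
  let open Parameter p τ (proj₁ order)
      open MatrixPowers p isPrime A reduced det noEigenvalue
  in conclude (F2 p A τ) 21 (F2-bound τ order β β≤τ small λ 2≤β → proj₂ (2≤β⇒admissible 2≤β))
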